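{- There exist a constant $K>0$ and a function $\varepsilon(n)\to 0$ (as $n\to\infty$) such that the following holds for every positive integer $n$. Let $M=\binom{n}{\lfloor n/2\rfloor}$ and $s=2^{n}/M$. Then the Boolean lattice $2^{[n]}$ can be partitioned into $M$ chains such that all but at most $n^{ -\frac18+\varepsilon(n)}\cdot M$ of these chains $C$ satisfy $\bigl||C|-s\bigr|\le K\,s\,n^{ -\frac1{16}}$. (In the paper's notation: all but at most $n^{ -\frac18+o(1)}$ proportion of the chains have size $s(1+O(n^{ -\frac1{16}}))$.)
   Context: $2^{[n]}$ is the family of all subsets of $[n]=\{1,\dots,n\}$ ordered by inclusion. A chain is a family $x_1\subset x_2\subset\dots\subset x_k$ of pairwise comparable sets; a partition of $2^{[n]}$ into chains means every subset of $[n]$ lies in exactly one of the chains. -}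

module Defs where

open import Data.Nat using (ℕ; zero; suc; _+_; _*_; _^_; _≤_; _<_; ⌊_/2⌋; ∣_-_∣)
open import Data.Nat.Combinatorics using (_C_)
open import Data.Integer using (ℤ; +_; -[1+_]) renaming (_*_ to _*ℤ_; _-_ to _-ℤ_)
open import Data.Rational using (ℚ; ↥_; ↧ₙ_; ∣_∣) renaming (_<_ to _<ℚ_; 0ℚ to 0q)
open import Data.Fin using (Fin)
open import Data.Fin.Subset using (Subset; _⊂_)
open import Data.List using (List; length)
open import Data.List.Membership.Propositional using (_∈_; _∉_)
open import Data.List.Relation.Unary.AllPairs using (AllPairs)
open import Data.Product using (Σ; ∃; _×_; _,_)
open import Data.Sum using (_⊎_)
open import Relation.Binary.PropositionalEquality using (_≡_)

middle : ℕ → ℕ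
middle n = n C ⌊ n /2⌋

-- A chain in 2^[n]: a finite family of pairwise comparable sets.
-- Represented as a list of subsets any two (distinct positions) of which are
-- strictly comparable; in particular entries are pairwise distinct, so the
-- length of the list is the size |C| of the family.
IsChain : ∀ {n} → List (Subset n) → Set
IsChain = AllPairs (λ x y → x ⊂ y ⊎ y ⊂ x)

record ChainPartition (n m : ℕ) : Set where
  field
    chain    : Fin m → List (Subset n)
    isChain  : ∀ i → IsChain (chain i)
    nonempty : ∀ i → 1 ≤ length (chain i)
    covers   : ∀ (x : Subset n) → ∃ λ i → x ∈ chain i
    disjoint : ∀ (x : Subset n) i j → x ∈ chain i → x ∈ chain j → i ≡ j

-- "| |C| - s | ≤ K s n^(-1/16)" with s = 2^n / M, c = |C|.
-- Multiplying by M > 0 and raising to the 16th power (both sides ≥ 0):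
--   | c M - 2^n |^16 * n ≤ K^16 * (2^n)^16.
SizeOK : (K n M c : ℕ) → Set
SizeOK K n M c = (∣ c * M - 2 ^ n ∣ ^ 16) * n ≤ (K ^ 16) * ((2 ^ n) ^ 16)

-- PowBound n e d b M  encodes   b ≤ n^(e/d) * M   (n ≥ 1, d ≥ 1, e ∈ ℤ),
-- by raising to the d-th power:  b^d ≤ n^e * M^d, clearing negative powers of n.
PowBound : (n : ℕ) (e : ℤ) (d b M : ℕ) → Set
PowBound n (+ k)      d b M = b ^ d ≤ (n ^ k) * (M ^ d)
PowBound n -[1+ k ]   d b M = (b ^ d) * (n ^ suc k) ≤ M ^ d

-- b ≤ n^(-1/8 + q) * M  for a rational q = a/d :  exponent (8a - d)/(8d).
BoundedBy : (n : ℕ) (q : ℚ) (b M : ℕ) → Set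
BoundedBy n q b M =
  PowBound n ((+ 8 *ℤ (↥ q)) -ℤ (+ (↧ₙ q))) (8 * ↧ₙ q) b M

TendsToZero : (ℕ → ℚ) → Set
TendsToZero ε = ∀ (δ : ℚ) → 0q <ℚ δ → ∃ λ N → ∀ n → N ≤ n → ∣ ε n ∣ <ℚ δ

{-# OPTIONS --safe #-}
module Submission where

-- Dilworth's theorem is applied to the order "x ⊆ y and τ x < τ y" for a clock τ; the clock is injective
-- on every chain of this order.  Suppose the order has width M and τ takes most sets above the middle
-- level into a window of T values, where T M barely exceeds the number of these sets.  Then no chain
-- meets more than T of them, the average is about T, and by Markov's inequality almost all chains are
-- close to T; gluing the complements of the chains to them covers the lower half.
--
-- Clock: split [n] into a coordinates and d groups of b coordinates, and give x the type (k , p) ∈ ℕ × ℕ^d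
-- of its cardinalities.  The columns p are grouped into cubical blocks of m = q^d columns.  Typical
-- types with k1 ≤ k < k1 + V L form V layers of height L in each column.  The m V pieces of a block, of
-- weights W v, are listed layer by layer and cut into periods of total weight about (m − 1) ω, at most
-- m ω, and τ traverses each period in L steps.  All other types have their rank as clock.
--
-- Width: averaging over random maximal flags turns a τ-antichain into one of weighted grid types.  Its
-- pieces in comparable columns and different layers share a period, so along a diagonal of blocks the
-- total weight in excess of m ω per block stays bounded.  Replacing the scheduled part, which costs about ω per
-- column, by single elements of rank κ, which weigh at least (1 + 8/c) ω, yields an ordinary antichain of
-- at least the same weight, and Sperner's theorem applies.
--
-- With n of order t^1600 every parameter is a power of t.

open import Defs
open import Data.Nat
open import Data.Nat.Properties
open import Data.Nat.DivMod
open import Data.Nat.Divisibility using (n∣m*n)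
open import Data.Nat.Combinatorics using (nCn≡1; nCk≡nC[n∸k]; nCk+nC[k+1]≡[n+1]C[k+1]; k>n⇒nCk≡0) renaming (_C_ to choose)
open import Data.Nat.Tactic.RingSolver using (solve-∀)
open import Data.Bool using (Bool; true; false; _∧_; not) renaming (T to So)
import Data.Bool.Properties as Bool
open import Data.Rational using (ℚ; 0ℚ; 1ℚ) renaming (∣_∣ to ∣_∣ℚ; _<_ to _<ℚ_)
open import Data.Fin using (Fin; toℕ; fromℕ<) renaming (zero to fzero; suc to fsuc)
open import Data.Fin.Properties using (toℕ<n; toℕ-injective; toℕ-fromℕ<) renaming (any? to anyFin?)
open import Data.Fin.Subset using (Subset; inside; outside; ∁; _⊂_) renaming (_⊆_ to _⊆s_; ∣_∣ to card)
open import Data.Fin.Subset.Properties using (out⊆; s⊆s; out⊂; s⊂s; out⊂in; drop-∷-⊆; ∣p∣≤n; ⊆-refl; p⊆q⇒∣p∣≤∣q∣; _⊆?_; ∣∁p∣≡n∸∣p∣; ∁p⊆∁q⇒p⊇q) renaming (⊆-antisym to ⊆s-antisym; ⊆-trans to ⊆s-trans; ⊆-reflexive to ⊆s-reflexive)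
open import Data.List using (List; []; _∷_; length; map; filter; concatMap; tabulate; allFin) renaming (take to takeL; _++_ to _++L_)
open import Data.List.Properties using (length-filter; length-map; length-tabulate; length-take; length-++; filter-all; filter-notAll; filter-++)
open import Data.List.Membership.Propositional using (_∈_; _∉_; find; lose)
open import Data.List.Membership.Propositional.Properties using (∈-filter⁺; ∈-filter⁻; ∈-map⁺; ∈-map⁻; ∈-++⁺ˡ; ∈-++⁺ʳ; ∈-concatMap⁺; ∈-concatMap⁻; ∈-tabulate⁻; ∈-allFin)
open import Data.List.Relation.Unary.All as All using (All; []; _∷_)
open import Data.List.Relation.Unary.AllPairs as AllPairs using (AllPairs; []; _∷_)
import Data.List.Relation.Unary.AllPairs.Properties as AllPairs
open import Data.List.Relation.Unary.Any as Any using (Any; here; there; any?)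
open import Data.Vec using (Vec; []; _∷_; _++_; take; drop) renaming (here to vhere)
import Data.Vec.Properties as Vec
open import Data.Product using (Σ; ∃; _×_; _,_; proj₁; proj₂)
open import Data.Sum using (_⊎_; inj₁; inj₂)
open import Data.Unit using (⊤; tt)
open import Data.Empty using (⊥-elim) renaming (⊥ to Empty)
open import Function using (_∘_; id)
open import Relation.Binary using (tri<; tri≈; tri>)
open import Relation.Binary.PropositionalEquality
open import Relation.Nullary using (¬_; Dec; yes; no; does; _×-dec_; _⊎-dec_; ¬?)
open import Relation.Nullary.Decidable using (decidable-stable)

-- Sums and binomial coefficients

-- Dilworth's theorem by itself says nothing about the lengths of the chains. A clock turns an upper
-- bound for every chain into a lower bound for most: when nearly all sets share about as many times
-- as an average chain has members, no chain can be long, so few can be short. The price is that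
-- comparable sets whose times are in the wrong order become incomparable, which can only enlarge
-- the width. It must stay exactly C(n, n/2), as no surplus chain is affordable; an estimate up to a
-- factor 1 + o(1) does not suffice. Exactness comes from starting the window a little above the
-- middle of the a coordinates. A scheduled column is then worth less than the same column at the
-- rank κ, and this margin of order 1/c absorbs all errors: unequal columns within a block, overfull
-- blocks, tails beyond the window, unusual columns. The shift lowers the weights by only a share
-- 1/c₁, which is lost in the counting and not in the width. Columns are pooled into blocks because
-- a piece cannot be divided: cutting into periods wastes one piece per period, a share of about
-- 1/m.

sum< : ℕ → (ℕ → ℕ) → ℕ
sum< zero    f = 0
sum< (suc n) f = sum< n f + f n

sum<-cong : ∀ n {f g : ℕ → ℕ} → (∀ i → i < n → f i ≡ g i) → sum< n f ≡ sum< n g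
sum<-cong zero    h = refl
sum<-cong (suc n) h = cong₂ _+_ (sum<-cong n (λ i p → h i (m<n⇒m<1+n p))) (h n ≤-refl)

sum<-mono : ∀ n {f g : ℕ → ℕ} → (∀ i → i < n → f i ≤ g i) → sum< n f ≤ sum< n g
sum<-mono zero    h = z≤n
sum<-mono (suc n) h = +-mono-≤ (sum<-mono n (λ i p → h i (m<n⇒m<1+n p))) (h n ≤-refl)

interchange : ∀ a b c d → a + b + (c + d) ≡ a + c + (b + d)
interchange = solve-∀

sum<-+ : ∀ n (f g : ℕ → ℕ) → sum< n (λ i → f i + g i) ≡ sum< n f + sum< n g
sum<-+ zero    f g = refl
sum<-+ (suc n) f g = trans (cong (_+ (f n + g n)) (sum<-+ n f g)) (interchange (sum< n f) (sum< n g) (f n) (g n))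

sum<-*ˡ : ∀ n c (f : ℕ → ℕ) → sum< n (λ i → c * f i) ≡ c * sum< n f
sum<-*ˡ zero    c f = sym (*-zeroʳ c)
sum<-*ˡ (suc n) c f = trans (cong (_+ c * f n) (sum<-*ˡ n c f)) (sym (*-distribˡ-+ c (sum< n f) (f n)))

sum<-zero : ∀ n {f : ℕ → ℕ} → (∀ i → i < n → f i ≡ 0) → sum< n f ≡ 0
sum<-zero zero    h = refl
sum<-zero (suc n) h = cong₂ _+_ (sum<-zero n (λ i p → h i (m<n⇒m<1+n p))) (h n ≤-refl)

sum<-const : ∀ n c → sum< n (λ _ → c) ≡ n * c
sum<-const zero    c = refl
sum<-const (suc n) c = trans (cong (_+ c) (sum<-const n c)) (+-comm (n * c) c)

sum<-swap : ∀ n k (f : ℕ → ℕ → ℕ) → sum< n (λ i → sum< k (f i)) ≡ sum< k (λ j → sum< n (λ i → f i j))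
sum<-swap zero    k f = sym (sum<-zero k (λ _ _ → refl))
sum<-swap (suc n) k f = trans (cong (_+ sum< k (f n)) (sum<-swap n k f)) (sym (sum<-+ k _ (f n)))

sum<-split : ∀ m n (f : ℕ → ℕ) → sum< (m + n) f ≡ sum< m f + sum< n (λ i → f (m + i))
sum<-split m zero    f = trans (cong (λ x → sum< x f) (+-identityʳ m)) (sym (+-identityʳ _))
sum<-split m (suc n) f = trans (cong (λ x → sum< x f) (+-suc m n))
  (trans (cong (_+ f (m + n)) (sum<-split m n f)) (+-assoc (sum< m f) _ _))

sum<-suc : ∀ n (f : ℕ → ℕ) → sum< (suc n) f ≡ f 0 + sum< n (f ∘ suc)
sum<-suc n f = sum<-split 1 n f

sum<-blocks : ∀ x r (f : ℕ → ℕ) → sum< x (λ i → sum< r (λ j → f (i * r + j))) ≡ sum< (x * r) f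
sum<-blocks zero    r f = refl
sum<-blocks (suc x) r f = trans (cong (_+ sum< r (λ j → f (x * r + j))) (sum<-blocks x r f))
  (trans (sym (sum<-split (x * r) r f)) (cong (λ y → sum< y f) (+-comm (x * r) r)))

sum<-≤ : ∀ {m n} (f : ℕ → ℕ) → m ≤ n → sum< m f ≤ sum< n f
sum<-≤ {m} {n} f m≤n = subst (λ x → sum< m f ≤ sum< x f) (m+[n∸m]≡n m≤n)
  (≤-trans (m≤m+n _ _) (≤-reflexive (sym (sum<-split m (n ∸ m) f))))

term≤sum< : ∀ {n} (f : ℕ → ℕ) {i} → i < n → f i ≤ sum< n f
term≤sum< f {i} i<n = ≤-trans (m≤n+m (f i) (sum< i f)) (sum<-≤ f i<n)

sum<-shift : ∀ i n (f : ℕ → ℕ) → (∀ j → j < i → f j ≡ 0) → sum< n f ≤ sum< n (λ j → f (i + j))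
sum<-shift i n f h = ≤-trans (sum<-≤ f (m≤n+m n i))
  (≤-reflexive (trans (sum<-split i n f) (cong (_+ sum< n (λ j → f (i + j))) (sum<-zero i h))))

sum<-single : ∀ n (f : ℕ → ℕ) c → (∀ i → i < n → f i ≤ c) →
  (∀ i j → i < j → j < n → f i ≢ 0 → f j ≢ 0 → Empty) → sum< n f ≤ c
sum<-single zero    f c b u = z≤n
sum<-single (suc n) f c b u with f n ≟ 0
... | yes e = ≤-trans (≤-reflexive (trans (cong (sum< n f +_) e) (+-identityʳ _)))
                (sum<-single n f c (λ i p → b i (m<n⇒m<1+n p)) (λ i j p q → u i j p (m<n⇒m<1+n q)))
... | no  e = ≤-trans (≤-reflexive (cong (_+ f n) (sum<-zero n z))) (b n ≤-refl)
  where
  z : ∀ i → i < n → f i ≡ 0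
  z i p with f i ≟ 0
  ... | yes w = w
  ... | no  w = ⊥-elim (u i n p ≤-refl w e)

sum<≢0 : ∀ n (f : ℕ → ℕ) → sum< n f ≢ 0 → ∃ λ i → i < n × f i ≢ 0
sum<≢0 zero    f h = ⊥-elim (h refl)
sum<≢0 (suc n) f h with f n ≟ 0
... | no  e = n , ≤-refl , e
... | yes e with sum<≢0 n f (λ z → h (cong₂ _+_ z e))
... | i , p , q = i , m<n⇒m<1+n p , q

average : ∀ n (f : ℕ → ℕ) s → suc n * s ≤ sum< (suc n) f → ∃ λ i → i ≤ n × s ≤ f i
average n f s h with f n <? s
... | no  e = n , ≤-refl , ≮⇒≥ e
average zero f s h | yes e = ⊥-elim (<-irrefl refl (<-≤-trans e (≤-trans (≤-reflexive (sym (+-identityʳ s))) h)))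
average (suc n) f s h | yes e with average n f s (+-cancelˡ-≤ s _ _ (≤-trans h
    (≤-trans (+-monoʳ-≤ (sum< (suc n) f) (<⇒≤ e)) (≤-reflexive (+-comm _ s)))))
... | i , p , q = i , m≤n⇒m≤1+n p , q

𝟙 : Bool → ℕ
𝟙 true  = 1
𝟙 false = 0

𝟙≤1 : ∀ b → 𝟙 b ≤ 1
𝟙≤1 true  = ≤-refl
𝟙≤1 false = z≤n

-- Pascal's recursion is the definition because the inductions over subsets follow it; `binom-C`
-- identifies it with the coefficient used in `middle`.
binom : ℕ → ℕ → ℕ
binom n       zero    = 1
binom zero    (suc k) = 0
binom (suc n) (suc k) = binom n k + binom n (suc k)

binom-> : ∀ n k → n < k → binom n k ≡ 0
binom-> zero    (suc k) p       = refl
binom-> (suc n) (suc k) (s≤s p) = cong₂ _+_ (binom-> n k p) (binom-> n (suc k) (m<n⇒m<1+n p))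

binom-absorb : ∀ n k → binom (suc n) (suc k) * suc k ≡ suc n * binom n k
binom-absorb n zero = trans (*-identityʳ _) (trans (binom1 (suc n)) (sym (*-identityʳ (suc n))))
  where
  binom1 : ∀ n → binom n 1 ≡ n
  binom1 zero    = refl
  binom1 (suc n) = cong suc (binom1 n)
binom-absorb zero (suc k) = refl
binom-absorb (suc n) (suc k) = trans (lem (binom (suc n) (suc k)) (binom (suc n) (suc (suc k))) (suc k))
  (trans (cong₂ (λ u v → u + binom (suc n) (suc k) + v) (binom-absorb n k) (binom-absorb n (suc k)))
    (lem2 (suc n) (binom n k) (binom n (suc k))))
  where
  lem : ∀ x y k → (x + y) * suc k ≡ x * k + x + y * suc k
  lem = solve-∀
  lem2 : ∀ n x y → n * x + (x + y) + n * y ≡ suc n * (x + y)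
  lem2 = solve-∀

binom-sucˡ : ∀ n k → k ≤ n → binom (suc n) k * (suc n ∸ k) ≡ suc n * binom n k
binom-sucˡ n zero    _ = trans (*-identityˡ (suc n)) (sym (*-identityʳ (suc n)))
binom-sucˡ n (suc k) p = +-cancelʳ-≡ (suc n * binom n k) _ _ (begin
    B * (n ∸ k) + suc n * binom n k  ≡⟨ cong (B * (n ∸ k) +_) (sym (binom-absorb n k)) ⟩
    B * (n ∸ k) + B * suc k          ≡⟨ sym (*-distribˡ-+ B (n ∸ k) (suc k)) ⟩
    B * (n ∸ k + suc k)              ≡⟨ cong (B *_) (trans (+-suc (n ∸ k) k) (cong suc (m∸n+n≡m (<⇒≤ p)))) ⟩
    B * suc n                        ≡⟨ *-comm B (suc n) ⟩
    suc n * (binom n k + binom n (suc k)) ≡⟨ cong (suc n *_) (+-comm (binom n k) _) ⟩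
    suc n * (binom n (suc k) + binom n k) ≡⟨ *-distribˡ-+ (suc n) (binom n (suc k)) (binom n k) ⟩
    suc n * binom n (suc k) + suc n * binom n k ∎)
  where
  open ≡-Reasoning
  B = binom (suc n) (suc k)

binom-ratio : ∀ n k → binom n (suc k) * suc k ≡ binom n k * (n ∸ k)
binom-ratio zero    k = sym (trans (cong (binom zero k *_) (0∸n≡0 k)) (*-zeroʳ (binom zero k)))
binom-ratio (suc n) k with k ≤? n
... | yes p = trans (binom-absorb n k) (sym (binom-sucˡ n k p))
... | no  p = trans (cong (_* suc k) (binom-> (suc n) (suc k) (s≤s (≰⇒> p))))
  (sym (trans (cong (binom (suc n) k *_) (m≤n⇒m∸n≡0 (≰⇒> p))) (*-zeroʳ (binom (suc n) k))))

binom-sum : ∀ n → sum< (suc n) (binom n) ≡ 2 ^ n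
binom-sum zero = refl
binom-sum (suc n) = begin
  sum< (suc (suc n)) (binom (suc n)) ≡⟨ sum<-suc (suc n) (binom (suc n)) ⟩
  1 + sum< (suc n) (λ k → binom n k + binom n (suc k)) ≡⟨ cong (1 +_) (sum<-+ (suc n) (binom n) (binom n ∘ suc)) ⟩
  1 + (S + sum< (suc n) (binom n ∘ suc)) ≡⟨ lem S _ ⟩
  S + (1 + sum< (suc n) (binom n ∘ suc)) ≡⟨ cong (S +_) (sym (sum<-suc (suc n) (binom n))) ⟩
  S + (S + binom n (suc n)) ≡⟨ cong (λ z → S + (S + z)) (binom-> n (suc n) ≤-refl) ⟩
  S + (S + 0) ≡⟨ cong (2 *_) (binom-sum n) ⟩
  2 ^ suc n ∎
  where
  open ≡-Reasoning
  S = sum< (suc n) (binom n)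
  lem : ∀ s x → 1 + (s + x) ≡ s + (1 + x)
  lem = solve-∀

-- Random flags

sumS : ∀ n → (Subset n → ℕ) → ℕ
sumS zero    f = f []
sumS (suc n) f = sumS n (λ x → f (outside ∷ x)) + sumS n (λ x → f (inside ∷ x))

sumS-cong : ∀ n {f g : Subset n → ℕ} → (∀ x → f x ≡ g x) → sumS n f ≡ sumS n g
sumS-cong zero    h = h []
sumS-cong (suc n) h = cong₂ _+_ (sumS-cong n (λ x → h (outside ∷ x))) (sumS-cong n (λ x → h (inside ∷ x)))

sumS-mono : ∀ n {f g : Subset n → ℕ} → (∀ x → f x ≤ g x) → sumS n f ≤ sumS n g
sumS-mono zero    h = h []
sumS-mono (suc n) h = +-mono-≤ (sumS-mono n (λ x → h (outside ∷ x))) (sumS-mono n (λ x → h (inside ∷ x)))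

sumS-+ : ∀ n (f g : Subset n → ℕ) → sumS n (λ x → f x + g x) ≡ sumS n f + sumS n g
sumS-+ zero    f g = refl
sumS-+ (suc n) f g = trans (cong₂ _+_ (sumS-+ n _ _) (sumS-+ n _ _)) (interchange (sumS n _) (sumS n _) (sumS n _) (sumS n _))

sumS-*ˡ : ∀ n c (f : Subset n → ℕ) → sumS n (λ x → c * f x) ≡ c * sumS n f
sumS-*ˡ zero    c f = refl
sumS-*ˡ (suc n) c f = trans (cong₂ _+_ (sumS-*ˡ n c _) (sumS-*ˡ n c _)) (sym (*-distribˡ-+ c (sumS n _) (sumS n _)))

sumS-swap : ∀ n k (f : Subset n → ℕ → ℕ) → sumS n (λ x → sum< k (f x)) ≡ sum< k (λ i → sumS n (λ x → f x i))
sumS-swap zero    k f = refl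
sumS-swap (suc n) k f = trans (cong₂ _+_ (sumS-swap n k _) (sumS-swap n k _)) (sym (sum<-+ k _ _))

sumS-++ : ∀ m n (f : Subset (m + n) → ℕ) → sumS (m + n) f ≡ sumS m (λ x → sumS n (λ y → f (x ++ y)))
sumS-++ zero    n f = refl
sumS-++ (suc m) n f = cong₂ _+_ (sumS-++ m n _) (sumS-++ m n _)

sumS-∁ : ∀ n (f : Subset n → ℕ) → sumS n (f ∘ ∁) ≡ sumS n f
sumS-∁ zero    f = refl
sumS-∁ (suc n) f = trans (cong₂ _+_ (sumS-∁ n (λ x → f (inside ∷ x))) (sumS-∁ n (λ x → f (outside ∷ x)))) (+-comm (sumS n _) _)

sumS-const : ∀ n c → sumS n (λ _ → c) ≡ 2 ^ n * c
sumS-const zero    c = sym (+-identityʳ c)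
sumS-const (suc n) c = trans (cong₂ _+_ (sumS-const n c) (sumS-const n c)) (lem (2 ^ n) c)
  where
  lem : ∀ x c → x * c + x * c ≡ (x + (x + 0)) * c
  lem = solve-∀

sumS-card : ∀ n (F : ℕ → ℕ) → sumS n (F ∘ card) ≡ sum< (suc n) (λ k → binom n k * F k)
sumS-card zero    F = sym (+-identityʳ (F 0))
sumS-card (suc n) F = begin
  sumS n (F ∘ card) + sumS n (F ∘ suc ∘ card) ≡⟨ cong₂ _+_ (sumS-card n F) (sumS-card n (F ∘ suc)) ⟩
  sum< (suc n) (λ k → binom n k * F k) + B ≡⟨ cong (_+ B) (sym (trans (cong (sum< (suc n) (λ k → binom n k * F k) +_)
      (cong (_* F (suc n)) (binom-> n (suc n) ≤-refl))) (+-identityʳ _))) ⟩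
  sum< (suc (suc n)) (λ k → binom n k * F k) + B ≡⟨ cong (_+ B) (sum<-suc (suc n) _) ⟩
  1 * F 0 + C + B ≡⟨ +-assoc (1 * F 0) C B ⟩
  1 * F 0 + (C + B) ≡⟨ cong (1 * F 0 +_) (trans (+-comm C B) (sym (sum<-+ (suc n) _ _))) ⟩
  1 * F 0 + sum< (suc n) (λ k → binom n k * F (suc k) + binom n (suc k) * F (suc k))
    ≡⟨ cong (1 * F 0 +_) (sum<-cong (suc n) (λ k _ → sym (*-distribʳ-+ (F (suc k)) (binom n k) (binom n (suc k))))) ⟩
  1 * F 0 + sum< (suc n) (λ k → binom (suc n) (suc k) * F (suc k)) ≡⟨ sym (sum<-suc (suc n) _) ⟩
  sum< (suc (suc n)) (λ k → binom (suc n) k * F k) ∎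
  where
  open ≡-Reasoning
  B = sum< (suc n) (λ k → binom n k * F (suc k))
  C = sum< (suc n) (λ k → binom n (suc k) * F (suc k))

-- A maximal chain of the cube, indexed by cardinality. Indexing by all of ℕ avoids carrying bounds;
-- beyond n only monotonicity is required.
record Flag (n : ℕ) : Set where
  field
    set  : ℕ → Subset n
    mono : ∀ {i j} → i ≤ j → set i ⊆s set j
    size : ∀ k → k ≤ n → card (set k) ≡ k

pick : ∀ {A : Set} → ℕ → ℕ → A → A → A
pick k i x y with k ≤? i
... | yes _ = x
... | no  _ = y

pick-yes : ∀ {A : Set} {k i} {x y : A} → k ≤ i → pick k i x y ≡ x
pick-yes {k = k} {i} p with k ≤? i
... | yes _ = refl
... | no  q = ⊥-elim (q p)

pick-no : ∀ {A : Set} {k i} {x y : A} → i < k → pick k i x y ≡ y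
pick-no {k = k} {i} p with k ≤? i
... | yes q = ⊥-elim (<⇒≱ p q)
... | no  _ = refl

out⊆in : ∀ {n} {x y : Subset n} → x ⊆s y → (outside ∷ x) ⊆s (inside ∷ y)
out⊆in = out⊆

insertFlag : ∀ {n} → Flag n → (i : ℕ) → i ≤ n → Flag (suc n)
insertFlag {n} c i i≤n = record { set = s ; mono = m ; size = z }
  where
  open Flag c
  s : ℕ → Subset (suc n)
  s k = pick k i (outside ∷ set k) (inside ∷ set (k ∸ 1))
  m : ∀ {j k} → j ≤ k → s j ⊆s s k
  m {j} {k} p with j ≤? i | k ≤? i
  ... | yes _ | yes _ = s⊆s (mono p)
  ... | yes a | no  b = out⊆in (mono (≤-trans a (∸-monoˡ-≤ 1 (≰⇒> b))))
  ... | no  a | yes b = ⊥-elim (a (≤-trans p b))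
  ... | no  a | no  b = s⊆s (mono (∸-monoˡ-≤ 1 p))
  z : ∀ k → k ≤ suc n → card (s k) ≡ k
  z k p with k ≤? i
  ... | yes a = size k (≤-trans a i≤n)
  z zero p | no a = ⊥-elim (a z≤n)
  z (suc k) (s≤s p) | no a = cong suc (size k p)

sum-pick : ∀ n k x y → k ≤ n → sum< n (λ i → pick k i x y) ≡ (n ∸ k) * x + k * y
sum-pick n k x y k≤n = begin
  sum< n g ≡⟨ cong (λ t → sum< t g) (sym (m+[n∸m]≡n k≤n)) ⟩
  sum< (k + (n ∸ k)) g ≡⟨ sum<-split k (n ∸ k) g ⟩
  sum< k g + sum< (n ∸ k) (λ i → g (k + i)) ≡⟨ cong₂ _+_ (sum<-cong k (λ i p → pick-no p)) (sum<-cong (n ∸ k) (λ i _ → pick-yes (m≤m+n k i))) ⟩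
  sum< k (λ _ → y) + sum< (n ∸ k) (λ _ → x) ≡⟨ cong₂ _+_ (sum<-const k y) (sum<-const (n ∸ k) x) ⟩
  k * y + (n ∸ k) * x ≡⟨ +-comm (k * y) _ ⟩
  (n ∸ k) * x + k * y ∎
  where
  open ≡-Reasoning
  g : ℕ → ℕ
  g i = pick k i x y

-- Inserting the new coordinate at a uniformly random position of a flag of 2^[n] turns
-- C(n+1,k)-weighted sums over the new flag into C(n,k)-weighted sums over the old one.
flag-average : ∀ n (u w : ℕ → ℕ) →
  sum< (suc n) (λ i → sum< (suc (suc n)) (λ k → binom (suc n) k * pick k i (u k) (w (k ∸ 1))))
  ≡ suc n * sum< (suc n) (λ k → binom n k * (u k + w k))
flag-average n u w = begin
  sum< (suc n) (λ i → sum< N (λ k → binom (suc n) k * pick k i (u k) (w (k ∸ 1)))) ≡⟨ sum<-swap (suc n) N _ ⟩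
  sum< N (λ k → sum< (suc n) (λ i → binom (suc n) k * pick k i (u k) (w (k ∸ 1)))) ≡⟨ sum<-cong N h ⟩
  sum< N (λ k → f k + g k) ≡⟨ sum<-+ N f g ⟩
  sum< N f + sum< N g ≡⟨ cong₂ _+_ e1 e2 ⟩
  sum< (suc n) (λ k → suc n * (binom n k * u k)) + sum< (suc n) (λ k → suc n * (binom n k * w k)) ≡⟨ sym (sum<-+ (suc n) _ _) ⟩
  sum< (suc n) (λ k → suc n * (binom n k * u k) + suc n * (binom n k * w k)) ≡⟨ sum<-cong (suc n) (λ k _ → lem3 (suc n) (binom n k) (u k) (w k)) ⟩
  sum< (suc n) (λ k → suc n * (binom n k * (u k + w k))) ≡⟨ sum<-*ˡ (suc n) (suc n) _ ⟩
  suc n * sum< (suc n) (λ k → binom n k * (u k + w k)) ∎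
  where
  open ≡-Reasoning
  N = suc (suc n)
  f g : ℕ → ℕ
  f k = binom (suc n) k * (suc n ∸ k) * u k
  g k = binom (suc n) k * k * w (k ∸ 1)
  lem3 : ∀ n b u w → n * (b * u) + n * (b * w) ≡ n * (b * (u + w))
  lem3 = solve-∀
  lem4 : ∀ b x u k w → b * (x * u + k * w) ≡ b * x * u + b * k * w
  lem4 = solve-∀
  h : ∀ k → k < N → sum< (suc n) (λ i → binom (suc n) k * pick k i (u k) (w (k ∸ 1))) ≡ f k + g k
  h k (s≤s p) = trans (sum<-*ˡ (suc n) (binom (suc n) k) _)
    (trans (cong (binom (suc n) k *_) (sum-pick (suc n) k _ _ p)) (lem4 (binom (suc n) k) _ (u k) k _))
  e1 : sum< N f ≡ sum< (suc n) (λ k → suc n * (binom n k * u k))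
  e1 = trans (cong (sum< (suc n) f +_) (cong (_* u (suc n)) (trans (cong (binom (suc n) (suc n) *_) (n∸n≡0 n)) (*-zeroʳ (binom (suc n) (suc n))))))
    (trans (+-identityʳ _) (sum<-cong (suc n) (λ { k (s≤s p) → trans (cong (_* u k) (binom-sucˡ n k p)) (*-assoc (suc n) (binom n k) (u k)) })))
  e2 : sum< N g ≡ sum< (suc n) (λ k → suc n * (binom n k * w k))
  e2 = trans (sum<-suc (suc n) g) (sum<-cong (suc n) (λ k _ → trans (cong (_* w k) (binom-absorb n k)) (*-assoc (suc n) (binom n k) (w k))))

-- A uniformly random maximal flag meets level k in a uniformly random k-set, so the right side has
-- expectation `sumS n f`. The flag is built one coordinate at a time, with an insertion position
-- that is at least average.
flag-exists : ∀ n (f : Subset n → ℕ) →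
  Σ (Flag n) λ c → sumS n f ≤ sum< (suc n) (λ k → binom n k * f (Flag.set c k))
flag-exists zero f = record { set = λ _ → [] ; mono = λ _ → ⊆-refl ; size = λ { zero _ → refl } } , ≤-reflexive (sym (+-identityʳ (f [])))
flag-exists (suc n) f with flag-exists n (λ x → f (outside ∷ x) + f (inside ∷ x))
... | c , h with average n (λ i → sum< (suc (suc n)) (λ k → binom (suc n) k * pick k i (f (outside ∷ Flag.set c k)) (f (inside ∷ Flag.set c (k ∸ 1)))))
                  _ (≤-reflexive (sym (flag-average n (λ k → f (outside ∷ Flag.set c k)) (λ k → f (inside ∷ Flag.set c k)))))
... | i , i≤n , q = insertFlag c i i≤n ,
  ≤-trans (≤-reflexive (sym (sumS-+ n _ _))) (≤-trans h (≤-trans q (≤-reflexive (sum<-cong (suc (suc n)) λ k _ → cong (binom (suc n) k *_) (pull k)))))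
  where
  pull : ∀ k → pick k i (f (outside ∷ Flag.set c k)) (f (inside ∷ Flag.set c (k ∸ 1))) ≡ f (Flag.set (insertFlag c i i≤n) k)
  pull k with k ≤? i
  ... | yes _ = refl
  ... | no  _ = refl

binom-dec : ∀ n k → n ≤ suc (k + k) → binom n (suc k) ≤ binom n k
binom-dec n k p = *-cancelʳ-≤ _ _ (suc k) (≤-trans (≤-reflexive (binom-ratio n k))
  (*-monoʳ-≤ (binom n k) (≤-trans (∸-monoˡ-≤ k p) (≤-reflexive (m+n∸m≡n k (suc k) ∙ cong (_∸ k) (sym (+-suc k k)))))))
  where
  _∙_ : ∀ {x y z : ℕ} → x ≡ y → z ≡ x → z ≡ y
  e ∙ d = trans d e

binom-inc : ∀ n k → suc (k + k) ≤ n → binom n k ≤ binom n (suc k)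
binom-inc n k p = *-cancelʳ-≤ _ _ (suc k) (≤-trans (*-monoʳ-≤ (binom n k)
  (≤-trans (≤-reflexive (sym (trans (cong (_∸ k) (sym (+-suc k k))) (m+n∸m≡n k (suc k))))) (∸-monoˡ-≤ k p))) (≤-reflexive (sym (binom-ratio n k))))

half-lower : ∀ n → ⌊ n /2⌋ + ⌊ n /2⌋ ≤ n
half-lower n = ≤-trans (+-monoʳ-≤ ⌊ n /2⌋ (⌊n/2⌋≤⌈n/2⌉ n)) (≤-reflexive (⌊n/2⌋+⌈n/2⌉≡n n))

half-upper : ∀ n → n ≤ suc (⌊ n /2⌋ + ⌊ n /2⌋)
half-upper zero          = z≤n
half-upper (suc zero)    = ≤-refl
half-upper (suc (suc n)) = s≤s (s≤s (≤-trans (half-upper n) (≤-reflexive (sym (+-suc _ _)))))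

binom-anti : ∀ n i j → n ≤ suc (i + i) → i ≤ j → binom n j ≤ binom n i
binom-anti n i j p i≤j = subst (λ t → binom n t ≤ binom n i) (m+[n∸m]≡n i≤j) (go (j ∸ i))
  where
  go : ∀ d → binom n (i + d) ≤ binom n i
  go zero    = ≤-reflexive (cong (binom n) (+-identityʳ i))
  go (suc d) = ≤-trans (≤-reflexive (cong (binom n) (+-suc i d)))
    (≤-trans (binom-dec n (i + d) (≤-trans p (s≤s (+-mono-≤ (m≤m+n i d) (m≤m+n i d))))) (go d))

binom-mono : ∀ n i j → j + j ≤ suc n → i ≤ j → binom n i ≤ binom n j
binom-mono n i j p i≤j with m≤n⇒m<n∨m≡n i≤j
... | inj₂ refl = ≤-refl
binom-mono n i (suc j) p i≤j | inj₁ (s≤s q) = ≤-trans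
  (binom-mono n i j (≤-trans (+-mono-≤ (n≤1+n j) (n≤1+n j)) p) q) (binom-inc n j (s≤s⁻¹ (≤-trans (≤-reflexive (cong suc (sym (+-suc j j)))) p)))

binom≤middle : ∀ n k → binom n k ≤ binom n ⌊ n /2⌋
binom≤middle n k with ≤-total k ⌊ n /2⌋
... | inj₁ p = binom-mono n k ⌊ n /2⌋ (≤-trans (half-lower n) (n≤1+n n)) p
... | inj₂ p = binom-anti n ⌊ n /2⌋ k (half-upper n) p

*-≢0ʳ : ∀ a {b} → a * b ≢ 0 → b ≢ 0
*-≢0ʳ a h refl = h (*-zeroʳ a)

𝟙≢0 : ∀ {b} → 𝟙 b ≢ 0 → b ≡ true
𝟙≢0 {true}  h = refl
𝟙≢0 {false} h = ⊥-elim (h refl)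

*-𝟙≤ : ∀ a b → a * 𝟙 b ≤ a
*-𝟙≤ a b = ≤-trans (*-monoʳ-≤ a (𝟙≤1 b)) (≤-reflexive (*-identityʳ a))

-- A flag meets an antichain at most once, so the weighted sum along the flag of `flag-exists` has
-- at most one nonzero term.
sperner : ∀ n (A : Subset n → Bool) → (∀ x y → A x ≡ true → A y ≡ true → x ⊆s y → x ≡ y) →
  sumS n (𝟙 ∘ A) ≤ binom n ⌊ n /2⌋
sperner n A anti with flag-exists n (𝟙 ∘ A)
... | c , h = ≤-trans h (sum<-single (suc n) _ _ (λ k _ → ≤-trans (*-𝟙≤ _ _) (binom≤middle n k)) u)
  where
  open Flag c
  u : ∀ i j → i < j → j < suc n → binom n i * 𝟙 (A (set i)) ≢ 0 → binom n j * 𝟙 (A (set j)) ≢ 0 → Empty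
  u i j i<j (s≤s j≤n) p q = <⇒≢ i<j (trans (sym (size i (≤-trans (<⇒≤ i<j) j≤n)))
    (trans (cong card (anti _ _ (𝟙≢0 (*-≢0ʳ (binom n i) p)) (𝟙≢0 (*-≢0ʳ (binom n j) q)) (mono (<⇒≤ i<j)))) (size j j≤n)))

-- Products of cubes and of flags

sumV : ∀ d → ℕ → (Vec ℕ d → ℕ) → ℕ
sumV zero    r f = f []
sumV (suc d) r f = sum< r (λ i → sumV d r (λ v → f (i ∷ v)))

_≤v_ : ∀ {d} → Vec ℕ d → Vec ℕ d → Set
[]      ≤v []      = ⊤
(x ∷ v) ≤v (y ∷ w) = x ≤ y × v ≤v w

Below : ∀ {d} → ℕ → Vec ℕ d → Set
Below r []      = ⊤
Below r (x ∷ v) = x < r × Below r v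

sumV-cong : ∀ d r {f g : Vec ℕ d → ℕ} → (∀ p → Below r p → f p ≡ g p) → sumV d r f ≡ sumV d r g
sumV-cong zero    r h = h [] tt
sumV-cong (suc d) r h = sum<-cong r (λ i i<r → sumV-cong d r (λ p b → h (i ∷ p) (i<r , b)))

sumV-mono : ∀ d r {f g : Vec ℕ d → ℕ} → (∀ p → Below r p → f p ≤ g p) → sumV d r f ≤ sumV d r g
sumV-mono zero    r h = h [] tt
sumV-mono (suc d) r h = sum<-mono r (λ i i<r → sumV-mono d r (λ p b → h (i ∷ p) (i<r , b)))

sumV-+ : ∀ d r (f g : Vec ℕ d → ℕ) → sumV d r (λ p → f p + g p) ≡ sumV d r f + sumV d r g
sumV-+ zero    r f g = refl
sumV-+ (suc d) r f g = trans (sum<-cong r (λ i _ → sumV-+ d r _ _)) (sum<-+ r _ _)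

sumV-*ˡ : ∀ d r c (f : Vec ℕ d → ℕ) → sumV d r (λ p → c * f p) ≡ c * sumV d r f
sumV-*ˡ zero    r c f = refl
sumV-*ˡ (suc d) r c f = trans (sum<-cong r (λ i _ → sumV-*ˡ d r c _)) (sum<-*ˡ r c _)

sumV-swap : ∀ d r k (f : Vec ℕ d → ℕ → ℕ) → sumV d r (λ p → sum< k (f p)) ≡ sum< k (λ i → sumV d r (λ p → f p i))
sumV-swap zero    r k f = refl
sumV-swap (suc d) r k f = trans (sum<-cong r (λ i _ → sumV-swap d r k _)) (sum<-swap r k _)

term≤sumV : ∀ d r (f : Vec ℕ d → ℕ) p → Below r p → f p ≤ sumV d r f
term≤sumV zero    r f []      b       = ≤-refl
term≤sumV (suc d) r f (x ∷ p) (l , b) = ≤-trans (term≤sumV d r _ p b) (term≤sum< (λ i → sumV d r (λ v → f (i ∷ v))) l)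

sumV-≤ : ∀ d {r s} (f : Vec ℕ d → ℕ) → r ≤ s → sumV d r f ≤ sumV d s f
sumV-≤ zero    f h = ≤-refl
sumV-≤ (suc d) {r} f h = ≤-trans (sum<-mono r (λ i _ → sumV-≤ d _ h)) (sum<-≤ _ h)

weight : ∀ {d} → ℕ → Vec ℕ d → ℕ
weight b []      = 1
weight b (x ∷ v) = binom b x * weight b v

cards : ∀ d b → Subset (d * b) → Vec ℕ d
cards zero    b z = []
cards (suc d) b z = card (take b z) ∷ cards d b (drop b z)

take-++ : ∀ {m n} (x : Subset m) (y : Subset n) → take m (x ++ y) ≡ x
take-++ []      y = refl
take-++ (s ∷ x) y = cong (s ∷_) (take-++ x y)

drop-++ : ∀ {m n} (x : Subset m) (y : Subset n) → drop m (x ++ y) ≡ y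
drop-++ []      y = refl
drop-++ (s ∷ x) y = drop-++ x y

++-⊆ : ∀ {m n} (x x' : Subset m) {y y' : Subset n} → x ⊆s x' → y ⊆s y' → (x ++ y) ⊆s (x' ++ y')
++-⊆ []            []             p q = q
++-⊆ (outside ∷ x) (s ∷ x')       p q = out⊆ (++-⊆ x x' (drop-∷-⊆ p) q)
++-⊆ (inside  ∷ x) (inside  ∷ x') p q = s⊆s (++-⊆ x x' (drop-∷-⊆ p) q)
++-⊆ (inside  ∷ x) (outside ∷ x') p q with p vhere
... | ()

sumS-cards : ∀ d b (F : Vec ℕ d → ℕ) → sumS (d * b) (F ∘ cards d b) ≡ sumV d (suc b) (λ p → weight b p * F p)
sumS-cards zero    b F = sym (+-identityʳ _)
sumS-cards (suc d) b F = begin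
  sumS (b + d * b) (F ∘ cards (suc d) b) ≡⟨ sumS-++ b (d * b) _ ⟩
  sumS b (λ x → sumS (d * b) (λ y → F (cards (suc d) b (x ++ y))))
    ≡⟨ sumS-cong b (λ x → sumS-cong (d * b) (λ y → cong₂ (λ u v → F (card u ∷ cards d b v)) (take-++ x y) (drop-++ x y))) ⟩
  sumS b (λ x → sumS (d * b) (λ y → F (card x ∷ cards d b y))) ≡⟨ sumS-cong b (λ x → sumS-cards d b (λ p → F (card x ∷ p))) ⟩
  sumS b (λ x → G (card x)) ≡⟨ sumS-card b G ⟩
  sum< (suc b) (λ k → binom b k * G k) ≡⟨ sum<-cong (suc b) (λ k _ → trans (sym (sumV-*ˡ d (suc b) (binom b k) _))
     (sumV-cong d (suc b) (λ p _ → sym (*-assoc (binom b k) (weight b p) _)))) ⟩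
  sumV (suc d) (suc b) (λ p → weight b p * F p) ∎
  where
  open ≡-Reasoning
  G : ℕ → ℕ
  G k = sumV d (suc b) (λ p → weight b p * F (k ∷ p))

record Flags (d b : ℕ) : Set where
  field
    set  : Vec ℕ d → Subset (d * b)
    mono : ∀ {p p'} → p ≤v p' → set p ⊆s set p'
    size : ∀ p → Below (suc b) p → cards d b (set p) ≡ p

-- The averaging operator on the second factor is arbitrary, so that the lemma serves both the
-- induction over the d groups and the final product with the a coordinates.
flag-product : ∀ a {n} (f : Subset (a + n) → ℕ) {J : Set} (sumJ : (J → ℕ) → ℕ) (R : Set) (at : R → J → Subset n)
  → (∀ (g : Subset n → ℕ) → Σ R λ c → sumS n g ≤ sumJ (λ j → g (at c j)))
  → Σ (Flag a) λ c → Σ R λ e → sumS (a + n) f ≤ sumJ (λ j → sum< (suc a) (λ k → binom a k * f (Flag.set c k ++ at e j)))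
flag-product a {n} f sumJ R at ex with flag-exists a (λ x → sumS n (λ y → f (x ++ y)))
... | c , h with ex (λ y → sum< (suc a) (λ k → binom a k * f (Flag.set c k ++ y)))
... | e , q = c , e , ≤-trans (≤-reflexive (sumS-++ a n f)) (≤-trans h (≤-trans (≤-reflexive
    (trans (sum<-cong (suc a) (λ k _ → sym (sumS-*ˡ n (binom a k) _))) (sym (sumS-swap n (suc a) _)))) q))

flags-exist : ∀ d b (f : Subset (d * b) → ℕ) →
  Σ (Flags d b) λ c → sumS (d * b) f ≤ sumV d (suc b) (λ p → weight b p * f (Flags.set c p))
flags-exist zero    b f = record { set = λ _ → [] ; mono = λ _ → ⊆-refl ; size = λ { [] _ → refl } } , ≤-reflexive (sym (+-identityʳ (f [])))
flags-exist (suc d) b f with flag-product b f (λ g → sumV d (suc b) (λ p → weight b p * g p)) (Flags d b) Flags.set (flags-exist d b)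
... | c , e , h = record { set = s ; mono = m ; size = z } , ≤-trans h (≤-reflexive eq)
  where
  s : Vec ℕ (suc d) → Subset (suc d * b)
  s (k ∷ p) = Flag.set c k ++ Flags.set e p
  m : ∀ {p p'} → p ≤v p' → s p ⊆s s p'
  m {k ∷ p} {k' ∷ p'} (u , v) = ++-⊆ _ _ (Flag.mono c u) (Flags.mono e v)
  z : ∀ p → Below (suc b) p → cards (suc d) b (s p) ≡ p
  z (k ∷ p) (s≤s u , v) = cong₂ _∷_ (trans (cong card (take-++ (Flag.set c k) _)) (Flag.size c k u))
    (trans (cong (cards d b) (drop-++ (Flag.set c k) _)) (Flags.size e p v))
  rearr : ∀ w y z → w * (y * z) ≡ y * w * z
  rearr = solve-∀
  eq : sumV d (suc b) (λ p → weight b p * sum< (suc b) (λ k → binom b k * f (s (k ∷ p))))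
     ≡ sum< (suc b) (λ k → sumV d (suc b) (λ p → weight b (k ∷ p) * f (s (k ∷ p))))
  eq = trans (sumV-cong d (suc b) (λ p _ → trans (sym (sum<-*ˡ (suc b) (weight b p) _))
      (sum<-cong (suc b) (λ k _ → rearr (weight b p) (binom b k) (f (s (k ∷ p))))))) (sumV-swap d (suc b) (suc b) _)

-- Dilworth's theorem

Distinct : {A : Set} → List A → Set
Distinct = AllPairs _≢_

length-filter-≢ : ∀ {k : ℕ} (P? : ∀ x → Dec (x ≢ k)) (xs : List ℕ) → Distinct xs → length xs ≤ suc (length (filter P? xs))
length-filter-≢ P? [] _ = z≤n
length-filter-≢ {k} P? (x ∷ xs) (p ∷ ps) with P? x
... | yes _ = s≤s (length-filter-≢ P? xs ps)
... | no  n = s≤s (≤-reflexive (sym (cong length (filter-all P? (All.map (λ q e → n (λ f → q (trans f (sym e)))) p)))))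

distinct-bound : ∀ k (xs : List ℕ) → Distinct xs → (∀ x → x ∈ xs → x < k) → length xs ≤ k
distinct-bound zero    []       d b = z≤n
distinct-bound zero    (x ∷ xs) d b = ⊥-elim (n≮0 (b x (here refl)))
distinct-bound (suc k) xs       d b = ≤-trans (length-filter-≢ (λ x → ¬? (x ≟ k)) xs d)
  (s≤s (distinct-bound k (filter (λ x → ¬? (x ≟ k)) xs) (AllPairs.filter⁺ (λ x → ¬? (x ≟ k)) d) λ x q →
    let (i , x≢k) = ∈-filter⁻ (λ x → ¬? (x ≟ k)) q in ≤∧≢⇒< (s≤s⁻¹ (b x i)) x≢k))

map-distinct : {A B : Set} (f : A → B) {R : A → A → Set} {xs : List A} → AllPairs R xs →
  (∀ x y → x ∈ xs → y ∈ xs → R x y → f x ≢ f y) → Distinct (map f xs)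
map-distinct f [] h = []
map-distinct f {xs = x ∷ xs} (p ∷ ps) h = All.tabulate (λ q → let (y , y∈ , e) = ∈-map⁻ f q in
    λ e' → h x y (here refl) (there y∈) (All.lookup p y∈) (trans e' e))
  ∷ map-distinct f ps (λ x y a b → h x y (there a) (there b))

-- A missing value could be added to the list, giving more than k distinct numbers below k.
distinct-onto : ∀ k (xs : List ℕ) → Distinct xs → (∀ x → x ∈ xs → x < k) → k ≤ length xs → ∀ i → i < k → i ∈ xs
distinct-onto k xs d b l i i<k with any? (i ≟_) xs
... | yes p = p
... | no  p = ⊥-elim (<-irrefl refl (≤-trans (s≤s l) (distinct-bound k (i ∷ xs)
    (All.tabulate (λ {y} q e → p (subst (_∈ xs) (sym e) q)) ∷ d) λ { x (here refl) → i<k ; x (there q) → b x q })))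

-- Enumerating all lists of a given length makes membership in some maximum antichain decidable.
tuples : {A : Set} → ℕ → List A → List (List A)
tuples zero    xs = [] ∷ []
tuples (suc k) xs = concatMap (λ x → map (x ∷_) (tuples k xs)) xs

∈-tuples : {A : Set} (ys : List A) {xs : List A} → (∀ y → y ∈ ys → y ∈ xs) → ys ∈ tuples (length ys) xs
∈-tuples []       h = here refl
∈-tuples (y ∷ ys) h = ∈-concatMap⁺ _ (Any.map (λ { refl → ∈-map⁺ (y ∷_) (∈-tuples ys (λ z q → h z (there q))) }) (h y (here refl)))

tuples-∈ : {A : Set} (k : ℕ) (xs ys : List A) → ys ∈ tuples k xs → length ys ≡ k × (∀ y → y ∈ ys → y ∈ xs)
tuples-∈ zero xs ys (here refl) = refl , λ y ()
tuples-∈ (suc k) xs ys p with find (∈-concatMap⁻ (λ x → map (x ∷_) (tuples k xs)) {xs = xs} p)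
... | x , x∈ , q with ∈-map⁻ (x ∷_) q
... | zs , zs∈ , refl with tuples-∈ k xs zs zs∈
... | l , h = cong suc l , λ { y (here refl) → x∈ ; y (there r) → h y r }

take-∈ : {A : Set} (k : ℕ) (xs : List A) {x : A} → x ∈ takeL k xs → x ∈ xs
take-∈ (suc k) (y ∷ xs) (here e)  = here e
take-∈ (suc k) (y ∷ xs) (there p) = there (take-∈ k xs p)

module Dilworth {X : Set} (_≡?_ : (x y : X) → Dec (x ≡ y)) (_≺_ : X → X → Set) (_≺?_ : (x y : X) → Dec (x ≺ y))
  (≺-trans : ∀ {x y z} → x ≺ y → y ≺ z → x ≺ z) (≺-irrefl : ∀ {x} → ¬ (x ≺ x)) where

  Incomparable : X → X → Set
  Incomparable x y = x ≢ y × ¬ (x ≺ y) × ¬ (y ≺ x)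

  Comparable : X → X → Set
  Comparable x y = x ≡ y ⊎ x ≺ y ⊎ y ≺ x

  Antichain : List X → Set
  Antichain = AllPairs Incomparable

  antichain? : ∀ ys → Dec (Antichain ys)
  antichain? = AllPairs.allPairs? (λ x y → ¬? (x ≡? y) ×-dec ¬? (x ≺? y) ×-dec ¬? (y ≺? x))

  antichain-⊀ : ∀ {ys x y} → Antichain ys → x ∈ ys → y ∈ ys → ¬ (x ≺ y)
  antichain-⊀ (p ∷ ps) (here refl) (here refl) = ≺-irrefl
  antichain-⊀ (p ∷ ps) (here refl) (there q)   = proj₁ (proj₂ (All.lookup p q))
  antichain-⊀ (p ∷ ps) (there q)   (here refl) = proj₂ (proj₂ (All.lookup p q))
  antichain-⊀ (p ∷ ps) (there q)   (there r)   = antichain-⊀ ps q r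

  record Colouring (xs : List X) (k : ℕ) : Set where
    field
      colour : X → ℕ
      bound  : ∀ x → x ∈ xs → colour x < k
      chain  : ∀ x y → x ∈ xs → y ∈ xs → colour x ≡ colour y → Comparable x y

  record AntichainOf (xs : List X) (k : ℕ) : Set where
    field
      elems : List X
      sub   : ∀ y → y ∈ elems → y ∈ xs
      anti  : Antichain elems
      size  : length elems ≡ k

  maximal : ∀ x xs → Σ X λ m → m ∈ (x ∷ xs) × (∀ z → z ∈ (x ∷ xs) → ¬ (m ≺ z))
  maximal x [] = x , here refl , λ { z (here refl) → ≺-irrefl }
  maximal x (y ∷ xs) with maximal y xs
  ... | m , m∈ , h with m ≺? x
  ...   | yes p = x , here refl , λ { z (here refl) → ≺-irrefl ; z (there q) r → h z q (≺-trans p r) }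
  ...   | no  p = m , there m∈ , λ { z (here refl) → p ; z (there q) → h z q }

  -- Elements of one colour are comparable, so the k members of the antichain use k different
  -- colours, hence all of them.
  rainbow : ∀ {xs k} (C : Colouring xs k) (A : AntichainOf xs k) → ∀ i → i < k →
    ∃ λ y → y ∈ AntichainOf.elems A × Colouring.colour C y ≡ i
  rainbow {xs} {k} C A i i<k with ∈-map⁻ colour (distinct-onto k (map colour elems)
      (map-distinct colour anti (λ x y x∈ y∈ R e → clash (chain x y (sub x x∈) (sub y y∈) e) R))
      (λ x q → let (y , y∈ , e) = ∈-map⁻ colour q in subst (_< k) (sym e) (bound y (sub y y∈)))
      (≤-reflexive (sym (trans (length-map colour elems) size))) i i<k)
    where
    open Colouring C
    open AntichainOf A
    clash : ∀ {x y} → Comparable x y → Incomparable x y → Empty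
    clash (inj₁ e)        (a , b , c) = a e
    clash (inj₂ (inj₁ e)) (a , b , c) = b e
    clash (inj₂ (inj₂ e)) (a , b , c) = c e
  ... | y , y∈ , e = y , y∈ , sym e

  -- Galvin's argument: a is maximal and C, A certify that the rest has width k.
  module Step (xs : List X) (a : X) (a∉ : a ∉ xs) (a-max : ∀ z → z ∈ xs → ¬ (a ≺ z))
    (k : ℕ) (C : Colouring xs k) (A : AntichainOf xs k) where
    open Colouring C

    InMaximum : X → Set
    InMaximum x = Any (λ ys → Antichain ys × x ∈ ys) (tuples k xs)

    inMaximum? : ∀ x → Dec (InMaximum x)
    inMaximum? x = any? (λ ys → antichain? ys ×-dec any? (x ≡?_) ys) (tuples k xs)

    inMaximum⁺ : ∀ {x} (B : AntichainOf xs k) → x ∈ AntichainOf.elems B → InMaximum x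
    inMaximum⁺ B q = lose (subst (λ l → AntichainOf.elems B ∈ tuples l xs) (AntichainOf.size B)
      (∈-tuples (AntichainOf.elems B) (AntichainOf.sub B))) (AntichainOf.anti B , q)

    inMaximum⁻ : ∀ {x} → InMaximum x → Σ (AntichainOf xs k) λ B → x ∈ AntichainOf.elems B
    inMaximum⁻ p with find p
    ... | ys , ys∈ , anti , q with tuples-∈ k xs ys ys∈
    ... | l , h = record { elems = ys ; sub = h ; anti = anti ; size = l } , q

    Candidate : ℕ → X → Set
    Candidate i x = colour x ≡ i × InMaximum x

    candidate? : ∀ i x → Dec (Candidate i x)
    candidate? i x = (colour x ≟ i) ×-dec inMaximum? x

    record Top (i : ℕ) : Set where
      field
        top   : X
        top∈  : top ∈ xs
        cand  : Candidate i top
        isTop : ∀ z → z ∈ xs → Candidate i z → ¬ (top ≺ z)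

    top-of : ∀ i → i < k → Top i
    top-of i i<k with rainbow C A i i<k
    ... | y , y∈ , e = go (filter (candidate? i) xs) refl
      (∈-filter⁺ (candidate? i) (AntichainOf.sub A y y∈) (e , inMaximum⁺ A y∈))
      where
      go : ∀ zs → zs ≡ filter (candidate? i) xs → y ∈ zs → Top i
      go (z ∷ zs) eq _ with maximal z zs
      ... | m , m∈ , h with ∈-filter⁻ (candidate? i) {xs = xs} (subst (m ∈_) eq m∈)
      ... | m∈xs , c = record { top = m ; top∈ = m∈xs ; cand = c
        ; isTop = λ w w∈ cw → h w (subst (w ∈_) (sym eq) (∈-filter⁺ (candidate? i) w∈ cw)) }

    open Top

    -- A maximum antichain through `top t` contains some y of colour i, and y is at most `top s`
    -- because `top s` is the highest candidate of its colour. If `top s` were below `top t`, then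
    -- so would be y, inside one antichain.
    top-⊀ : ∀ {i j} (s : Top i) (t : Top j) → i < k → ¬ (top s ≺ top t)
    top-⊀ {i} s t i<k p with inMaximum⁻ (proj₂ (cand t))
    ... | B , t∈ with rainbow C B i i<k
    ... | y , y∈ , e with chain (top s) y (top∈ s) (AntichainOf.sub B y y∈) (trans (proj₁ (cand s)) (sym e))
    ... | inj₁ refl     = antichain-⊀ (AntichainOf.anti B) y∈ t∈ p
    ... | inj₂ (inj₁ q) = isTop s y (AntichainOf.sub B y y∈) (e , inMaximum⁺ B y∈) q
    ... | inj₂ (inj₂ q) = antichain-⊀ (AntichainOf.anti B) y∈ t∈ (≺-trans q p)

    topF : (i : Fin k) → Top (toℕ i)
    topF i = top-of (toℕ i) (toℕ<n i)

    -- The tops are pairwise incomparable by `top-⊀`; if none is below the maximal element `a`, they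
    -- form with it an antichain of size k + 1, and `a` may receive a new colour.
    extend : (∀ i → ¬ (top (topF i) ≺ a)) → Σ ℕ λ k' → Colouring (a ∷ xs) k' × AntichainOf (a ∷ xs) k'
    extend h = suc k , record { colour = col ; bound = bnd ; chain = chn } ,
      record { elems = a ∷ tabulate (λ i → top (topF i)) ; sub = sb
             ; anti = All.tabulate inc ∷ AllPairs.tabulate⁺ (λ {i} {j} → tops i j)
             ; size = cong suc (length-tabulate (λ i → top (topF i))) }
      where
      col : X → ℕ
      col x with x ≡? a
      ... | yes _ = k
      ... | no  _ = colour x
      strip : ∀ {x} → x ≢ a → x ∈ (a ∷ xs) → x ∈ xs
      strip n (here e)  = ⊥-elim (n e)
      strip n (there q) = q
      bnd : ∀ x → x ∈ (a ∷ xs) → col x < suc k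
      bnd x q with x ≡? a
      ... | yes _ = ≤-refl
      ... | no  n = m<n⇒m<1+n (bound x (strip n q))
      chn : ∀ x y → x ∈ (a ∷ xs) → y ∈ (a ∷ xs) → col x ≡ col y → Comparable x y
      chn x y p q e with x ≡? a | y ≡? a
      ... | yes refl | yes refl = inj₁ refl
      ... | yes _    | no  m    = ⊥-elim (<⇒≢ (bound y (strip m q)) (sym e))
      ... | no  n    | yes _    = ⊥-elim (<⇒≢ (bound x (strip n p)) e)
      ... | no  n    | no  m    = chain x y (strip n p) (strip m q) e
      sb : ∀ y → y ∈ (a ∷ tabulate (λ i → top (topF i))) → y ∈ (a ∷ xs)
      sb y (here e) = here e
      sb y (there q) with ∈-tabulate⁻ q
      ... | i , refl = there (top∈ (topF i))
      inc : ∀ {y} → y ∈ tabulate (λ i → top (topF i)) → Incomparable a y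
      inc q with ∈-tabulate⁻ q
      ... | i , refl = (λ e → a∉ (subst (_∈ xs) (sym e) (top∈ (topF i)))) , a-max _ (top∈ (topF i)) , h i
      tops : ∀ i j → i ≢ j → Incomparable (top (topF i)) (top (topF j))
      tops i j i≢j = (λ e → i≢j (toℕ-injective (trans (sym (proj₁ (cand (topF i)))) (trans (cong colour e) (proj₁ (cand (topF j)))))))
        , top-⊀ (topF i) (topF j) (toℕ<n i) , top-⊀ (topF j) (topF i) (toℕ<n j)

    -- If `a` lies above the top of chain i, this part and `a` form one chain. The part meets every
    -- maximum antichain, because each of these has a member of colour i and that member is a
    -- candidate; deleting it therefore lowers the width (`rest-width`).
    Removed : Fin k → X → Set
    Removed i z = colour z ≡ toℕ i × (z ≡ top (topF i) ⊎ z ≺ top (topF i))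

    removed? : ∀ i z → Dec (Removed i z)
    removed? i z = (colour z ≟ toℕ i) ×-dec ((z ≡? top (topF i)) ⊎-dec (z ≺? top (topF i)))

    rest : Fin k → List X
    rest i = filter (λ z → ¬? (removed? i z)) xs

    rest∈ : ∀ i {z} → z ∈ rest i → z ∈ xs × ¬ Removed i z
    rest∈ i q = ∈-filter⁻ (λ z → ¬? (removed? i z)) {xs = xs} q

    rest-width : ∀ i k' → AntichainOf (rest i) k' → k' < k
    rest-width i k' B with k ≤? k'
    ... | no  p = ≰⇒> p
    ... | yes p = ⊥-elim contra
      where
      B' : AntichainOf xs k
      B' = record { elems = takeL k (AntichainOf.elems B)
        ; sub = λ y q → proj₁ (rest∈ i (AntichainOf.sub B y (take-∈ k _ q)))
        ; anti = AllPairs.take⁺ k (AntichainOf.anti B)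
        ; size = trans (length-take k (AntichainOf.elems B)) (m≤n⇒m⊓n≡m (subst (k ≤_) (sym (AntichainOf.size B)) p)) }
      contra : Empty
      contra with rainbow C B' (toℕ i) (toℕ<n i)
      ... | y , y∈ , e with rest∈ i (AntichainOf.sub B y (take-∈ k _ y∈))
      ... | y∈xs , nr with chain y (top (topF i)) y∈xs (top∈ (topF i)) (trans e (sym (proj₁ (cand (topF i)))))
      ... | inj₁ q        = nr (e , inj₁ q)
      ... | inj₂ (inj₁ q) = nr (e , inj₂ q)
      ... | inj₂ (inj₂ q) = isTop (topF i) y y∈xs (e , inMaximum⁺ B' y∈) q

    module _ (i : Fin k) (below : top (topF i) ≺ a) (k' : ℕ) (C' : Colouring (rest i) k') (k'<k : k' < k) where
      OnChain : X → Set
      OnChain z = z ≡ a ⊎ Removed i z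

      onChain? : ∀ z → Dec (OnChain z)
      onChain? z = (z ≡? a) ⊎-dec removed? i z

      newColour : X → ℕ
      newColour z with onChain? z
      ... | yes _ = k'
      ... | no  _ = Colouring.colour C' z

      in-rest : ∀ {z} → ¬ OnChain z → z ∈ (a ∷ xs) → z ∈ rest i
      in-rest n (here e)  = ⊥-elim (n (inj₁ e))
      in-rest n (there q) = ∈-filter⁺ (λ z → ¬? (removed? i z)) q (n ∘ inj₂)

      removed≺a : ∀ {z} → Removed i z → z ≺ a
      removed≺a (_ , inj₁ refl) = below
      removed≺a (_ , inj₂ p)    = ≺-trans p below

      on-chain : ∀ {x y} → OnChain x → OnChain y → x ∈ (a ∷ xs) → y ∈ (a ∷ xs) → Comparable x y
      on-chain (inj₁ refl) (inj₁ refl) _ _ = inj₁ refl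
      on-chain (inj₁ refl) (inj₂ q) _ _ = inj₂ (inj₂ (removed≺a q))
      on-chain (inj₂ p) (inj₁ refl) _ _ = inj₂ (inj₁ (removed≺a p))
      on-chain (inj₂ p) (inj₂ q) (here refl) y∈ = inj₂ (inj₂ (removed≺a q))
      on-chain (inj₂ p) (inj₂ q) (there x∈) (here refl) = inj₂ (inj₁ (removed≺a p))
      on-chain (inj₂ p) (inj₂ q) (there x∈) (there y∈) = chain _ _ x∈ y∈ (trans (proj₁ p) (sym (proj₁ q)))

      recolour : Colouring (a ∷ xs) k
      recolour = record { colour = newColour ; bound = bnd ; chain = chn }
        where
        bnd : ∀ x → x ∈ (a ∷ xs) → newColour x < k
        bnd x q with onChain? x
        ... | yes _ = k'<k
        ... | no  n = <-trans (Colouring.bound C' x (in-rest n q)) k'<k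
        chn : ∀ x y → x ∈ (a ∷ xs) → y ∈ (a ∷ xs) → newColour x ≡ newColour y → Comparable x y
        chn x y p q e with onChain? x | onChain? y
        ... | yes u | yes v = on-chain u v p q
        ... | yes u | no  v = ⊥-elim (<⇒≢ (Colouring.bound C' y (in-rest v q)) (sym e))
        ... | no  u | yes v = ⊥-elim (<⇒≢ (Colouring.bound C' x (in-rest u p)) e)
        ... | no  u | no  v = Colouring.chain C' x y (in-rest u p) (in-rest v q) e

    step : ((ys : List X) → length ys ≤ length xs → Σ ℕ λ k' → Colouring ys k' × AntichainOf ys k') →
      Σ ℕ λ k' → Colouring (a ∷ xs) k' × AntichainOf (a ∷ xs) k'
    step rec with anyFin? (λ i → top (topF i) ≺? a)
    ... | no  p = extend (λ i q → p (i , q))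
    ... | yes (i , q) with rec (rest i) (length-filter (λ z → ¬? (removed? i z)) xs)
    ... | k' , C' , A' = k , recolour i q k' C' (rest-width i k' A') ,
      record { elems = AntichainOf.elems A ; sub = λ y r → there (AntichainOf.sub A y r)
             ; anti = AntichainOf.anti A ; size = AntichainOf.size A }

  transfer : ∀ {a xs ys} → (∀ z → z ∈ (a ∷ xs) → z ∈ ys) → (∀ z → z ∈ ys → z ∈ (a ∷ xs)) →
    (Σ ℕ λ k → Colouring (a ∷ xs) k × AntichainOf (a ∷ xs) k) → Σ ℕ λ k → Colouring ys k × AntichainOf ys k
  transfer f g (k , C , A) = k ,
    record { colour = Colouring.colour C ; bound = λ x q → Colouring.bound C x (g x q)
           ; chain = λ x y p q → Colouring.chain C x y (g x p) (g y q) } ,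
    record { elems = AntichainOf.elems A ; sub = λ y q → f y (AntichainOf.sub A y q)
           ; anti = AntichainOf.anti A ; size = AntichainOf.size A }

  -- The length bound f is the recursion measure, since `Step.step` calls back on a filtered list.
  dilworth-fuel : ∀ f (xs : List X) → length xs ≤ f → Σ ℕ λ k → Colouring xs k × AntichainOf xs k
  dilworth-fuel f [] _ = 0 , record { colour = λ _ → 0 ; bound = λ _ () ; chain = λ _ _ () } ,
    record { elems = [] ; sub = λ _ () ; anti = [] ; size = refl }
  dilworth-fuel (suc f) (x ∷ xs) (s≤s l) = remove-maximal (maximal x xs)
    where
    remove-maximal : (Σ X λ m → m ∈ (x ∷ xs) × (∀ z → z ∈ (x ∷ xs) → ¬ (m ≺ z))) →
      Σ ℕ λ k → Colouring (x ∷ xs) k × AntichainOf (x ∷ xs) k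
    remove-maximal (a , a∈ , h) = transfer to from (with-rest (dilworth-fuel f others len))
      where
      ≢a? : ∀ z → Dec (z ≢ a)
      ≢a? z = ¬? (z ≡? a)
      others : List X
      others = filter ≢a? (x ∷ xs)
      len : length others ≤ f
      len = ≤-trans (s≤s⁻¹ (filter-notAll ≢a? (x ∷ xs) (Any.map (λ { refl n → n refl }) a∈))) l
      others∈ : ∀ {z} → z ∈ others → z ∈ (x ∷ xs) × z ≢ a
      others∈ q = ∈-filter⁻ ≢a? {xs = x ∷ xs} q
      to : ∀ z → z ∈ (a ∷ others) → z ∈ (x ∷ xs)
      to z (here refl) = a∈
      to z (there q)   = proj₁ (others∈ q)
      from : ∀ z → z ∈ (x ∷ xs) → z ∈ (a ∷ others)
      from z q with z ≡? a
      ... | yes e = here e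
      ... | no  n = there (∈-filter⁺ ≢a? q n)
      with-rest : (Σ ℕ λ k → Colouring others k × AntichainOf others k) → Σ ℕ λ k → Colouring (a ∷ others) k × AntichainOf (a ∷ others) k
      with-rest (k , C , A) = Step.step others a (λ q → proj₂ (others∈ q) refl) (λ z q → h z (proj₁ (others∈ q))) k C A
        (λ ys m → dilworth-fuel f ys (≤-trans m len))

  dilworth : ∀ (xs : List X) M → (∀ k → AntichainOf xs k → k ≤ M) → Colouring xs M
  dilworth xs M w with dilworth-fuel (length xs) xs ≤-refl
  ... | k , C , A = record { colour = Colouring.colour C ; bound = λ x q → <-≤-trans (Colouring.bound C x q) (w k A) ; chain = Colouring.chain C }

-- Scheduling along a diagonal

≡ᵇ-true : ∀ {x y} → x ≡ y → (x ≡ᵇ y) ≡ true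
≡ᵇ-true {x} {y} e with x ≡ᵇ y | ≡⇒≡ᵇ x y e
... | true | _ = refl

≡ᵇ-sound : ∀ x y → (x ≡ᵇ y) ≡ true → x ≡ y
≡ᵇ-sound x y e = ≡ᵇ⇒≡ x y (subst So (sym e) _)

least : {Q : ℕ → Set} (Q? : ∀ x → Dec (Q x)) → ∀ n →
  (∀ x → x < n → ¬ Q x) ⊎ (Σ ℕ λ x → x < n × Q x × (∀ y → y < x → ¬ Q y))
least Q? zero = inj₁ (λ x ())
least Q? (suc n) with least Q? n
... | inj₂ (x , l , q , h) = inj₂ (x , m<n⇒m<1+n l , q , h)
... | inj₁ h with Q? n
...   | yes q = inj₂ (n , ≤-refl , q , h)
...   | no  q = inj₁ (λ x l → step x (m≤n⇒m<n∨m≡n (s≤s⁻¹ l)))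
  where
  step : ∀ x → x < n ⊎ x ≡ n → ¬ _
  step x (inj₁ l)    = h x l
  step x (inj₂ refl) = q

-- Layers v < V of m jobs each are executed in periods; a block of columns meets a set of jobs.
-- Along a diagonal of blocks the total overfull weight is bounded by a potential argument.
record Schedule : Set where
  field
    m V P μ    : ℕ
    W          : ℕ → ℕ
    per        : ℕ → ℕ → ℕ
    per-<      : ∀ v j → v < V → j < m → per v j < P
    per-mono   : ∀ v v' j j' → v < v' → v' < V → j < m → j' < m → per v j ≤ per v' j'
    period-sum : ∀ π → sum< m (λ j → sum< V (λ v → W v * 𝟙 (per v j ≡ᵇ π))) ≤ μ
    layer-sum  : ∀ v → v < V → m * W v ≤ μ

module Diagonal (S : Schedule) (χ : ℕ → ℕ → ℕ → Bool) where
  open Schedule S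

  record Job (i v j : ℕ) : Set where
    constructor job
    field
      v< : v < V
      j< : j < m
      on : χ i v j ≡ true
  open Job

  load : ℕ → ℕ
  load i = sum< m (λ j → sum< V (λ v → W v * 𝟙 (χ i v j)))

  private
    rangeTerm : ℕ → ℕ → ℕ → ℕ → ℕ
    rangeTerm π r v j = sum< r (λ x → W v * 𝟙 (per v j ≡ᵇ (π + x)))

    star-sum : ∀ v* → sum< m (λ j → sum< V (λ v → W v * 𝟙 (v ≡ᵇ v*))) ≤ μ
    star-sum v* with v* <? V
    ... | yes p = ≤-trans (sum<-mono m (λ j _ → sum<-single V _ (W v*) bnd uniq))
                          (≤-trans (≤-reflexive (sum<-const m (W v*))) (layer-sum v* p))
      where
      bnd : ∀ v → v < V → W v * 𝟙 (v ≡ᵇ v*) ≤ W v*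
      bnd v _ with v ≡ᵇ v* in e
      ... | true  = ≤-reflexive (trans (*-identityʳ (W v)) (cong W (≡ᵇ-sound v v* e)))
      ... | false = ≤-trans (≤-reflexive (*-zeroʳ (W v))) z≤n
      nz : ∀ v → W v * 𝟙 (v ≡ᵇ v*) ≢ 0 → v ≡ v*
      nz v h with v ≡ᵇ v* in e
      ... | true  = ≡ᵇ-sound v v* e
      ... | false = ⊥-elim (h (*-zeroʳ (W v)))
      uniq : ∀ a b → a < b → b < V → W a * 𝟙 (a ≡ᵇ v*) ≢ 0 → W b * 𝟙 (b ≡ᵇ v*) ≢ 0 → Empty
      uniq a b a<b _ p q = <⇒≢ a<b (trans (nz a p) (sym (nz b q)))
    ... | no p = ≤-trans (≤-reflexive (sum<-zero m (λ j _ → sum<-zero V (λ v l → none v l)))) z≤n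
      where
      none : ∀ v → v < V → W v * 𝟙 (v ≡ᵇ v*) ≡ 0
      none v l with v ≡ᵇ v* in e
      ... | true  = ⊥-elim (p (subst (_< V) (≡ᵇ-sound v v* e) l))
      ... | false = *-zeroʳ (W v)

    range-sum : ∀ π r → sum< m (λ j → sum< V (λ v → rangeTerm π r v j)) ≤ r * μ
    range-sum π r = ≤-trans (≤-reflexive (trans (sum<-cong m (λ j _ → sum<-swap V r _)) (sum<-swap m r _)))
      (≤-trans (sum<-mono r (λ x _ → period-sum (π + x))) (≤-reflexive (sum<-const r μ)))

    InRange : ℕ → ℕ → ℕ → ℕ → Set
    InRange π r v j = π ≤ per v j × per v j < π + r

    range-term : ∀ π r v j → InRange π r v j → W v ≤ rangeTerm π r v j
    range-term π r v j (l , u) = ≤-trans (≤-reflexive (sym (trans (cong (λ b → W v * 𝟙 b) (≡ᵇ-true (sym (m+[n∸m]≡n l)))) (*-identityʳ (W v)))))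
      (term≤sum< (λ x → W v * 𝟙 (per v j ≡ᵇ (π + x)))
        (+-cancelˡ-< π _ _ (subst (_< π + r) (sym (m+[n∸m]≡n l)) u)))

    load-bound : ∀ i π r v* → (∀ v j → Job i v j → InRange π r v j ⊎ v ≡ v*) → load i ≤ r * μ + μ
    load-bound i π r v* h = ≤-trans (sum<-mono m (λ j lj → sum<-mono V (λ v lv → pw v j lv lj)))
      (≤-trans (≤-reflexive (trans (sum<-cong m (λ j _ → sum<-+ V _ _)) (sum<-+ m _ _)))
        (+-mono-≤ (range-sum π r) (star-sum v*)))
      where
      pw : ∀ v j → v < V → j < m → W v * 𝟙 (χ i v j) ≤ rangeTerm π r v j + W v * 𝟙 (v ≡ᵇ v*)
      pw v j lv lj with χ i v j in e
      ... | false = ≤-trans (≤-reflexive (*-zeroʳ (W v))) z≤n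
      ... | true with h v j (job lv lj e)
      ...   | inj₁ x = ≤-trans (≤-reflexive (*-identityʳ (W v))) (≤-trans (range-term π r v j x) (m≤m+n _ _))
      ...   | inj₂ x = ≤-trans (≤-reflexive (cong (λ b → W v * 𝟙 b) (sym (≡ᵇ-true x)))) (m≤n+m _ _)

    load-range : ∀ i π r → (∀ v j → Job i v j → InRange π r v j) → load i ≤ r * μ
    load-range i π r h = ≤-trans (sum<-mono m (λ j lj → sum<-mono V (λ v lv → pw v j lv lj))) (range-sum π r)
      where
      pw : ∀ v j → v < V → j < m → W v * 𝟙 (χ i v j) ≤ rangeTerm π r v j
      pw v j lv lj with χ i v j in e
      ... | false = ≤-trans (≤-reflexive (*-zeroʳ (W v))) z≤n
      ... | true  = ≤-trans (≤-reflexive (*-identityʳ (W v))) (range-term π r v j (h v j (job lv lj e)))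

    load-star : ∀ i v* → (∀ v j → Job i v j → v ≡ v*) → load i ≤ μ
    load-star i v* h = ≤-trans (load-bound i 0 0 v* (λ v j x → inj₂ (h v j x))) ≤-refl

    some-job? : ∀ i {Q : ℕ → ℕ → Set} → (∀ v j → Dec (Q v j)) → Dec (Σ ℕ λ v → Σ ℕ λ j → Job i v j × Q v j)
    some-job? i {Q} Q? with anyUpTo? (λ v → anyUpTo? (λ j → (χ i v j Bool.≟ true) ×-dec Q? v j) m) V
    ... | yes (v , lv , j , lj , e , q) = yes (v , j , job lv lj e , q)
    ... | no  n = no (λ { (v , j , job lv lj e , q) → n (v , lv , j , lj , e , q) })

  module _ (compatible : ∀ i i' v v' j j' → i < i' → Job i v j → Job i' v' j' → v < v' → per v j ≡ per v' j') where
    private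
      -- π is the least period met so far. In state `fresh` an earlier block ran layer v* in period
      -- π, so later jobs beyond π are confined to layer v*. In state `spent` an earlier block also
      -- ran a lower layer in period π, and then no later job can go beyond π. The index φ is a
      -- credit for one more overfull block at the current π.
      data Mode (i π : ℕ) : ℕ → Set where
        start : π ≡ P → Mode i π 1
        fresh : ∀ i' v* j* → i' < i → Job i' v* j* → per v* j* ≡ π → Mode i π 1
        spent : ∀ i' v* j* → i' < i → Job i' v* j* → per v* j* ≡ π →
                ∀ i'' v₁ j₁ → i'' < i → Job i'' v₁ j₁ → v₁ < v* → per v₁ j₁ ≡ π → Mode i π 0

      record State (i : ℕ) : Set where
        constructor state
        field
          π φ   : ℕ
          mode  : Mode i π φ
          -- If π falls by x ≥ 1, the excess is at most (x + 1) μ and the credit is restored; 3 x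
          -- covers x + 2, which is why each period counts 3.
          total : sum< i (λ k → load k ∸ μ) + μ * (3 * π + φ) ≤ μ * (3 * P + 1)

      -- Below layer v* the monotonicity of the periods, and above it the compatibility with the
      -- earlier job, excludes a period beyond π.
      layer-of : ∀ i i' v* j* π v j → i' < i → Job i' v* j* → per v* j* ≡ π → Job i v j → π < per v j → v ≡ v*
      layer-of i i' v* j* π v j l J e K p with <-cmp v v*
      ... | tri≈ _ q _ = q
      ... | tri< q _ _ = ⊥-elim (<⇒≱ p (≤-trans (per-mono v v* j j* q (v< J) (j< K) (j< J)) (≤-reflexive e)))
      ... | tri> _ _ q = ⊥-elim (<⇒≢ p (trans (sym e) (compatible i' i v* v j* j l J K q)))

      star : ∀ {i π φ} → Mode i π φ → Σ ℕ λ v* → ∀ v j → Job i v j → π < per v j → v ≡ v*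
      star {i} {π} (start refl) = 0 , λ v j K p → ⊥-elim (<-asym p (per-< v j (v< K) (j< K)))
      star {i} {π} (fresh i' v* j* l J e) = v* , λ v j K p → layer-of i i' v* j* π v j l J e K p
      star {i} {π} (spent i' v* j* l J e _ _ _ _ _ _ _) = v* , λ v j K p → layer-of i i' v* j* π v j l J e K p

      wk : ∀ {i π φ} → Mode i π φ → Mode (suc i) π φ
      wk (start e) = start e
      wk (fresh i' v* j* l J e) = fresh i' v* j* (m<n⇒m<1+n l) J e
      wk (spent i' v* j* l J e i'' v₁ j₁ l₁ J₁ q e₁) = spent i' v* j* (m<n⇒m<1+n l) J e i'' v₁ j₁ (m<n⇒m<1+n l₁) J₁ q e₁

      pay : ∀ x y a b c M → x ≤ y * c → y + a ≤ b → M + c * b ≤ c * (3 * P + 1) → M + x + c * a ≤ c * (3 * P + 1)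
      pay x y a b c M h₁ h₂ h₃ = ≤-trans (≤-reflexive (+-assoc M x _)) (≤-trans (+-monoʳ-≤ M (≤-trans (+-monoˡ-≤ (c * a) h₁)
        (≤-trans (≤-reflexive (lem y c a)) (*-monoʳ-≤ c h₂)))) h₃)
        where
        lem : ∀ y c a → y * c + c * a ≡ c * (y + a)
        lem = solve-∀

      excess : ∀ i r → load i ≤ r * μ + μ → load i ∸ μ ≤ r * μ
      excess i r h = ≤-trans (∸-monoˡ-≤ μ h) (≤-reflexive (m+n∸n≡m (r * μ) μ))

      none : ∀ i → load i ≤ μ → load i ∸ μ ≤ 0 * μ
      none i h = ≤-reflexive (m≤n⇒m∸n≡0 h)

      drop-total : ∀ π π' φ → π' < π → (suc π ∸ π') + (3 * π' + 1) ≤ 3 * π + φ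
      drop-total π π' φ l = ≤-trans (≤-reflexive (trans (+-comm (suc π ∸ π') _) (trans (lem π' (suc π ∸ π')) (cong (λ z → 2 * π' + 1 + z) (m∸n+n≡m (m≤n⇒m≤1+n (<⇒≤ l)))))))
        (≤-trans (≤-trans (≤-reflexive (lem2 π' π)) (+-monoˡ-≤ π (*-monoʳ-≤ 2 l))) (≤-trans (≤-reflexive (lem3 π)) (m≤m+n (3 * π) φ)))
        where
        lem : ∀ p x → 3 * p + 1 + x ≡ 2 * p + 1 + (x + p)
        lem = solve-∀
        lem2 : ∀ p q → 2 * p + 1 + suc q ≡ 2 * suc p + q
        lem2 = solve-∀
        lem3 : ∀ p → 2 * p + p ≡ 3 * p
        lem3 = solve-∀

      advance : ∀ i → State i → State (suc i)
      advance i (state π φ mo tot) with least (λ x → some-job? i {λ v j → per v j ≡ x} (λ v j → per v j ≟ x)) π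
      ... | inj₂ (π' , π'<π , (v , j , K , e) , low) = state π' 1 (fresh i v j ≤-refl K e)
          (pay _ (suc π ∸ π') _ _ μ _ (excess i (suc π ∸ π') (load-bound i π' (suc π ∸ π') (proj₁ (star mo)) rng)) (drop-total π π' φ π'<π) tot)
        where
        rng : ∀ v j → Job i v j → InRange π' (suc π ∸ π') v j ⊎ v ≡ proj₁ (star mo)
        rng v j K with per v j ≤? π
        ... | yes p = inj₁ ((≮⇒≥ λ q → low (per v j) q (v , j , K , refl)) , subst (per v j <_) (sym (m+[n∸m]≡n (m≤n⇒m≤1+n (<⇒≤ π'<π)))) (s≤s p))
        ... | no  p = inj₂ (proj₂ (star mo) v j K (≰⇒> p))
      ... | inj₁ low = stay mo tot
        where
        ge : ∀ {v j} → Job i v j → π ≤ per v j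
        ge {v} {j} K = ≮⇒≥ λ q → low (per v j) q (v , j , K , refl)
        one : ∀ v j → Job i v j → ¬ (π < per v j) → InRange π 1 v j
        one v j K n = ge K , ≤-trans (s≤s (≮⇒≥ n)) (≤-reflexive (+-comm 1 π))
        le1 : load i ≤ 1 * μ → load i ≤ μ
        le1 h = ≤-trans h (≤-reflexive (*-identityˡ μ))
        stay : ∀ {φ} → Mode i π φ → sum< i (λ k → load k ∸ μ) + μ * (3 * π + φ) ≤ μ * (3 * P + 1) → State (suc i)
        stay {φ} mo@(start refl) tot = state π φ (wk mo) (pay _ 0 (3 * π + φ) _ μ _ (none i (≤-trans (load-range i 0 0
            (λ v j K → ⊥-elim (<⇒≱ (per-< v j (v< K) (j< K)) (ge K)))) z≤n)) ≤-refl tot)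
        stay {φ} mo@(spent i' v* j* l J e i'' v₁ j₁ l₁ J₁ q e₁) tot = state π φ (wk mo)
          (pay _ 0 (3 * π + φ) _ μ _ (none i (le1 (load-range i π 1 (λ v j K → one v j K (nope v j K))))) ≤-refl tot)
          where
          nope : ∀ v j → Job i v j → ¬ (π < per v j)
          nope v j K p with layer-of i i' v* j* π v j l J e K p
          ... | refl = <⇒≢ p (trans (sym e₁) (compatible i'' i v₁ v j₁ j l₁ J₁ K q))
        -- A job in a layer below v* is squeezed into period π exactly. It makes the state spent,
        -- and the credit pays for the single excess μ.
        stay mo@(fresh i' v* j* l J e) tot with some-job? i {λ v j → v < v*} (λ v j → v <? v*)
        ... | yes (v , j , K , p) = state π 0 (spent i' v* j* (m<n⇒m<1+n l) J e i v j ≤-refl K p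
              (≤-antisym (≤-trans (per-mono v v* j j* p (v< J) (j< K) (j< J)) (≤-reflexive e)) (ge K)))
            (pay _ 1 (3 * π + 0) _ μ _ (excess i 1 (load-bound i π 1 v* (λ v j K → rng v j K))) (≤-reflexive (lem π)) tot)
          where
          lem : ∀ x → 1 + (3 * x + 0) ≡ 3 * x + 1
          lem = solve-∀
          rng : ∀ v j → Job i v j → InRange π 1 v j ⊎ v ≡ v*
          rng v j K with π <? per v j
          ... | yes p = inj₂ (layer-of i i' v* j* π v j l J e K p)
          ... | no  p = inj₁ (one v j K p)
        -- Without lower layers, a job of layer v* beyond π confines the whole block to layer v*,
        -- and otherwise the whole block runs in π. Either way its load is at most μ.
        ... | no low* with some-job? i {λ v j → v ≡ v* × π < per v j} (λ v j → (v ≟ v*) ×-dec (π <? per v j))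
        ...   | yes (v₀ , j₀ , K₀ , refl , p₀) = state π 1 (wk mo) (pay _ 0 (3 * π + 1) _ μ _ (none i (load-star i v* only)) ≤-refl tot)
          where
          only : ∀ v j → Job i v j → v ≡ v*
          only v j K with π <? per v j
          ... | yes p = layer-of i i' v* j* π v j l J e K p
          ... | no  p with <-cmp v v*
          ...   | tri< q _ _ = ⊥-elim (low* (v , j , K , q))
          ...   | tri≈ _ q _ = q
          ...   | tri> _ _ q = ⊥-elim (p (<-≤-trans p₀ (per-mono v* v j₀ j q (v< K) (j< K₀) (j< K))))
        ...   | no  none* = state π 1 (wk mo) (pay _ 0 (3 * π + 1) _ μ _ (none i (le1 (load-range i π 1 (λ v j K → one v j K (λ p →
                none* (v , j , K , layer-of i i' v* j* π v j l J e K p , p)))))) ≤-refl tot)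

      run : ∀ i → State i
      run zero    = state P 1 (start refl) ≤-refl
      run (suc i) = advance i (run i)

    excess-sum : ∀ G → sum< G (λ i → load i ∸ μ) ≤ μ * (3 * P + 1)
    excess-sum G = ≤-trans (m≤m+n _ _) (State.total (run G))

-- Weighted antichains of the grid

total : ∀ {d} → Vec ℕ d → ℕ
total []      = 0
total (x ∷ v) = x + total v

InBox : ∀ {d} → ℕ → ℕ → Vec ℕ d → Set
InBox lo hi []      = ⊤
InBox lo hi (x ∷ v) = (lo ≤ x × x < hi) × InBox lo hi v

inBox? : ∀ {d} lo hi (v : Vec ℕ d) → Dec (InBox lo hi v)
inBox? lo hi []      = yes tt
inBox? lo hi (x ∷ v) = ((lo ≤? x) ×-dec (x <? hi)) ×-dec inBox? lo hi v

col : ∀ {d} → ℕ → Vec ℕ d → Vec ℕ d → Vec ℕ d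
col q []      []      = []
col q (x ∷ u) (y ∷ l) = (x * q + y) ∷ col q u l

shift : ∀ {d} → ℕ → Vec ℕ d → Vec ℕ d
shift i []      = []
shift i (x ∷ u) = (i + x) ∷ shift i u

shift-back : ∀ {d} → ℕ → Vec ℕ d → Vec ℕ d
shift-back i []      = []
shift-back i (x ∷ u) = (x ∸ i) ∷ shift-back i u

shift-back-shift : ∀ {d} i (u : Vec ℕ d) → shift-back i (shift i u) ≡ u
shift-back-shift i []      = refl
shift-back-shift i (x ∷ u) = cong₂ _∷_ (m+n∸m≡n i x) (shift-back-shift i u)

shift-+ : ∀ {d} i j (u : Vec ℕ d) → shift i (shift j u) ≡ shift (i + j) u
shift-+ i j []      = refl
shift-+ i j (x ∷ u) = cong₂ _∷_ (sym (+-assoc i j x)) (shift-+ i j u)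

≤v-refl : ∀ {d} (u : Vec ℕ d) → u ≤v u
≤v-refl []      = tt
≤v-refl (x ∷ u) = ≤-refl , ≤v-refl u

≤v-trans : ∀ {d} {u v w : Vec ℕ d} → u ≤v v → v ≤v w → u ≤v w
≤v-trans {u = []} {[]} {[]} _ _ = tt
≤v-trans {u = _ ∷ _} {_ ∷ _} {_ ∷ _} (a , b) (a' , b') = ≤-trans a a' , ≤v-trans b b'

rank-< : ∀ {d} {k k'} (u v : Vec ℕ d) → k ≤ k' → u ≤v v → (k + total u < k' + total v) ⊎ (k ≡ k' × u ≡ v)
rank-< {k = k} {k'} [] [] k≤k' _ with m≤n⇒m<n∨m≡n k≤k'
... | inj₁ l = inj₁ (+-monoˡ-< 0 l)
... | inj₂ e = inj₂ (e , refl)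
rank-< {k = k} {k'} (x ∷ u) (y ∷ v) k≤k' (x≤y , u≤v) with rank-< {k = x} {y} u v x≤y u≤v
... | inj₁ l = inj₁ (+-mono-≤-< k≤k' l)
... | inj₂ (refl , refl) with m≤n⇒m<n∨m≡n k≤k'
...   | inj₁ l    = inj₁ (+-monoˡ-< (x + total u) l)
...   | inj₂ refl = inj₂ (refl , refl)

-- One unit in every block coordinate outweighs any difference of positions within blocks. Hence
-- every column of a block lies below every column of a later block on the same diagonal, which is
-- why the schedule is analysed along diagonals.
col-step : ∀ {d} q i (u l l' : Vec ℕ d) → Below q l → 1 ≤ i → col q u l ≤v col q (shift i u) l'
col-step q i [] [] [] _ _ = tt
col-step q (suc i) (x ∷ u) (y ∷ l) (y' ∷ l') (b , bs) p = step , col-step q (suc i) u l l' bs p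
  where
  step : x * q + y ≤ (suc i + x) * q + y'
  step = ≤-trans (+-monoʳ-≤ (x * q) (<⇒≤ b)) (≤-trans (≤-reflexive (+-comm (x * q) q))
    (≤-trans (*-monoˡ-≤ q {suc x} {suc i + x} (s≤s (m≤n+m x i))) (m≤m+n _ y')))

col-box : ∀ {d} q lo hi (u l : Vec ℕ d) → Below q l → InBox lo hi u → InBox (lo * q) (hi * q) (col q u l)
col-box q lo hi [] [] _ _ = tt
col-box q lo hi (x ∷ u) (y ∷ l) (c , cs) ((a , b) , bs) =
  (≤-trans (*-monoˡ-≤ q a) (m≤m+n (x * q) y) , <-≤-trans (+-monoʳ-< (x * q) c) (≤-trans (≤-reflexive (+-comm (x * q) q)) (*-monoˡ-≤ q b)))
  , col-box q lo hi u l cs bs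

box-col : ∀ {d} q lo hi (u l : Vec ℕ d) → Below q l → InBox (lo * q) (hi * q) (col q u l) → InBox lo hi u
box-col q lo hi [] [] _ _ = tt
box-col q lo hi (x ∷ u) (y ∷ l) (c , cs) ((a , b) , bs) =
  (s≤s⁻¹ (*-cancelʳ-< q lo (suc x) (≤-<-trans a (<-≤-trans (+-monoʳ-< (x * q) c) (≤-reflexive (+-comm (x * q) q))))) ,
   *-cancelʳ-< q x hi (≤-<-trans (m≤m+n (x * q) y) b)) , box-col q lo hi u l cs bs

box-weaken : ∀ {d} {lo lo' hi hi'} (u : Vec ℕ d) → lo' ≤ lo → hi ≤ hi' → InBox lo hi u → InBox lo' hi' u
box-weaken [] p q _ = tt
box-weaken (x ∷ u) p q ((a , b) , bs) = (≤-trans p a , <-≤-trans b q) , box-weaken u p q bs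

box-unshift : ∀ {d} i {lo hi} (u : Vec ℕ d) → InBox lo hi (shift i u) → InBox (lo ∸ i) hi u
box-unshift i [] _ = tt
box-unshift i {lo} (x ∷ u) ((a , b) , bs) = (m≤n+o⇒m∸n≤o lo i a , ≤-<-trans (m≤n+m x i) b) , box-unshift i u bs

sumV-blocks : ∀ d r q (f : Vec ℕ d → ℕ) → sumV d (r * q) f ≡ sumV d r (λ u → sumV d q (λ l → f (col q u l)))
sumV-blocks zero    r q f = refl
sumV-blocks (suc d) r q f = begin
  sum< (r * q) (λ i → sumV d (r * q) (λ v → f (i ∷ v))) ≡⟨ sym (sum<-blocks r q _) ⟩
  sum< r (λ x → sum< q (λ y → sumV d (r * q) (λ v → f (x * q + y ∷ v))))
    ≡⟨ sum<-cong r (λ x _ → sum<-cong q (λ y _ → sumV-blocks d r q _)) ⟩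
  sum< r (λ x → sum< q (λ y → sumV d r (λ u → sumV d q (λ l → f (x * q + y ∷ col q u l)))))
    ≡⟨ sum<-cong r (λ x _ → sym (sumV-swap d r q _)) ⟩
  sum< r (λ x → sumV d r (λ u → sum< q (λ y → sumV d q (λ l → f (x * q + y ∷ col q u l))))) ∎
  where open ≡-Reasoning

-- Translation along the diagonal; the terms that fall off at the lower boundary vanish by the
-- hypothesis on the support.
sumV-shift : ∀ d r i (f : Vec ℕ d → ℕ) → (∀ u → f u ≢ 0 → InBox i r u) → sumV d r f ≤ sumV d r (λ u → f (shift i u))
sumV-shift zero    r i f h = ≤-refl
sumV-shift (suc d) r i f h = ≤-trans (sum<-mono r (λ x _ → sumV-shift d r i (λ u → f (x ∷ u)) (λ u n → proj₂ (h (x ∷ u) n))))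
  (sum<-shift i r _ (λ j j<i → sumV-zero d r _ (λ u → zero-at j j<i (shift i u))))
  where
  sumV-zero : ∀ d r (g : Vec ℕ d → ℕ) → (∀ u → g u ≡ 0) → sumV d r g ≡ 0
  sumV-zero zero    r g h = h []
  sumV-zero (suc d) r g h = sum<-zero r (λ x _ → sumV-zero d r _ (λ u → h (x ∷ u)))
  zero-at : ∀ j → j < i → ∀ u → f (j ∷ u) ≡ 0
  zero-at j j<i u with f (j ∷ u) ≟ 0
  ... | yes e = e
  ... | no  n = ⊥-elim (<⇒≱ j<i (proj₁ (proj₁ (h (j ∷ u) n))))

sumV≢0 : ∀ d r (f : Vec ℕ d → ℕ) → sumV d r f ≢ 0 → ∃ λ u → Below r u × f u ≢ 0
sumV≢0 zero    r f h = [] , tt , h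
sumV≢0 (suc d) r f h with sum<≢0 r _ h
... | x , l , n with sumV≢0 d r _ n
... | u , b , k = (x ∷ u) , (l , b) , k

-- Base-q digits number the q^d columns of a block, so that its pieces can be put in a linear list.
module Digits (q : ℕ) .{{_ : NonZero q}} where
  quot rem : ℕ → ℕ → ℕ
  quot d j = _/_ j (q ^ d) {{m^n≢0 q d}}
  rem  d j = _%_ j (q ^ d) {{m^n≢0 q d}}

  lab : ∀ d → ℕ → Vec ℕ d
  lab zero    j = []
  lab (suc d) j = quot d j ∷ lab d (rem d j)

  idx : ∀ {d} → Vec ℕ d → ℕ
  idx []              = 0
  idx {suc d} (x ∷ v) = x * q ^ d + idx v

  blk : ∀ {d} → Vec ℕ d → Vec ℕ d
  blk []      = []
  blk (x ∷ v) = x / q ∷ blk v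

  residue : ∀ {d} → Vec ℕ d → Vec ℕ d
  residue []      = []
  residue (x ∷ v) = x % q ∷ residue v

  div-block : ∀ r .{{_ : NonZero r}} x y → y < r → (x * r + y) / r ≡ x
  div-block r x y y<r = trans (+-distrib-/-∣ˡ y (n∣m*n x)) (trans (cong₂ _+_ (m*n/n≡m x r) (m<n⇒m/n≡0 y<r)) (+-identityʳ x))

  mod-block : ∀ r .{{_ : NonZero r}} x y → y < r → (x * r + y) % r ≡ y
  mod-block r x y y<r = trans (cong (_% r) (+-comm (x * r) y)) (trans ([m+kn]%n≡m%n y x r) (m<n⇒m%n≡m y<r))

  blk-col : ∀ {d} (u l : Vec ℕ d) → Below q l → blk (col q u l) ≡ u
  blk-col [] [] _ = refl
  blk-col (x ∷ u) (y ∷ l) (b , bs) = cong₂ _∷_ (div-block q x y b) (blk-col u l bs)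

  residue-col : ∀ {d} (u l : Vec ℕ d) → Below q l → residue (col q u l) ≡ l
  residue-col [] [] _ = refl
  residue-col (x ∷ u) (y ∷ l) (b , bs) = cong₂ _∷_ (mod-block q x y b) (residue-col u l bs)

  lab-below : ∀ d j → j < q ^ d → Below q (lab d j)
  lab-below zero    j _ = tt
  lab-below (suc d) j p = m<n*o⇒m/o<n {j} {q} {{m^n≢0 q d}} p , lab-below d _ (m%n<n j (q ^ d) {{m^n≢0 q d}})

  idx-lab : ∀ d j → j < q ^ d → idx (lab d j) ≡ j
  idx-lab zero    zero    _         = refl
  idx-lab zero    (suc j) (s≤s ())
  idx-lab (suc d) j p = trans (cong (quot d j * q ^ d +_) (idx-lab d _ (m%n<n j (q ^ d) {{m^n≢0 q d}})))
    (trans (+-comm (quot d j * q ^ d) _) (sym (m≡m%n+[m/n]*n j (q ^ d) {{m^n≢0 q d}})))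

  residue-below : ∀ {d} (p : Vec ℕ d) → Below q (residue p)
  residue-below []      = tt
  residue-below (x ∷ p) = m%n<n x q , residue-below p

  idx-below : ∀ {d} (p : Vec ℕ d) → Below q p → idx p < q ^ d
  idx-below [] _ = s≤s z≤n
  idx-below {suc d} (x ∷ p) (l , b) = <-≤-trans (+-monoʳ-< (x * q ^ d) (idx-below p b))
    (≤-trans (≤-reflexive (+-comm (x * q ^ d) (q ^ d))) (*-monoˡ-≤ (q ^ d) l))

  sum-lab : ∀ d (f : Vec ℕ d → ℕ) → sumV d q f ≡ sum< (q ^ d) (f ∘ lab d)
  sum-lab zero    f = refl
  sum-lab (suc d) f = trans (sum<-cong q (λ x _ → trans (sum-lab d _) (sum<-cong (q ^ d) (λ j l →
      cong₂ (λ s t → f (s ∷ lab d t)) (sym (div-block (q ^ d) {{m^n≢0 q d}} x j l)) (sym (mod-block (q ^ d) {{m^n≢0 q d}} x j l)))))) (sum<-blocks q (q ^ d) _)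

  sum-columns : ∀ d r (f : Vec ℕ d → ℕ) → sumV d (r * q) f ≡ sumV d r (λ u → sum< (q ^ d) (λ j → f (col q u (lab d j))))
  sum-columns d r f = trans (sumV-blocks d r q f) (sumV-cong d r (λ u _ → sum-lab d _))

does-true : ∀ {P : Set} (d : Dec P) → P → does d ≡ true
does-true (yes _) p = refl
does-true (no n)  p = ⊥-elim (n p)

does-sound : ∀ {P : Set} (d : Dec P) → does d ≡ true → P
does-sound (yes p) _ = p

𝟙d : ∀ {P : Set} → Dec P → ℕ
𝟙d d = 𝟙 (does d)

𝟙d-yes : ∀ {P : Set} (d : Dec P) → P → 𝟙d d ≡ 1
𝟙d-yes d p = cong 𝟙 (does-true d p)

𝟙d-no : ∀ {P : Set} (d : Dec P) → ¬ P → 𝟙d d ≡ 0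
𝟙d-no (yes p) n = ⊥-elim (n p)
𝟙d-no (no _)  n = refl

𝟙d-≢0 : ∀ {P : Set} (d : Dec P) → 𝟙d d ≢ 0 → P
𝟙d-≢0 d h = does-sound d (𝟙≢0 h)

𝟙d-mono : ∀ {P Q : Set} (d : Dec P) (e : Dec Q) → (P → Q) → 𝟙d d ≤ 𝟙d e
𝟙d-mono (no _)  e h = z≤n
𝟙d-mono (yes p) e h = ≤-reflexive (sym (𝟙d-yes e (h p)))

sum<-window : ∀ n k r (g : ℕ → ℕ) → (∀ i → g i ≢ 0 → k ≤ i × i < k + r) → sum< n g ≤ sum< r (λ j → g (k + j))
sum<-window n k r g h = ≤-trans (sum<-≤ g (m≤n+m n (k + r))) (≤-reflexive (begin
  sum< (k + r + n) g ≡⟨ sum<-split (k + r) n g ⟩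
  sum< (k + r) g + sum< n (λ i → g (k + r + i)) ≡⟨ cong₂ _+_ (sum<-split k r g) (sum<-zero n (λ i _ → zero-at (k + r + i) (λ w → <⇒≱ (proj₂ w) (m≤m+n (k + r) i)))) ⟩
  sum< k g + sum< r (λ j → g (k + j)) + 0 ≡⟨ +-identityʳ _ ⟩
  sum< k g + sum< r (λ j → g (k + j)) ≡⟨ cong (_+ sum< r (λ j → g (k + j))) (sum<-zero k (λ i l → zero-at i (λ w → <⇒≱ l (proj₁ w)))) ⟩
  sum< r (λ j → g (k + j)) ∎))
  where
  open ≡-Reasoning
  zero-at : ∀ i → ¬ (k ≤ i × i < k + r) → g i ≡ 0
  zero-at i n with g i ≟ 0
  ... | yes e = e
  ... | no  e = ⊥-elim (n (h i e))

zeros : ∀ d → Vec ℕ d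
zeros zero    = []
zeros (suc d) = 0 ∷ zeros d

-- The slack is the polynomial in e = c − 2 with nonnegative coefficients that the proof inserts.
combine : ∀ {c} → 2 ≤ c → ∀ x y {R W A b z} → b ≡ x + y → c * R + (c + 8) * b ≤ c * A + x + c * y + z → z ≤ b →
  c * (c * (c * W)) ≤ suc c * (c * (suc c * x) + suc c * b) → R + W ≤ A
combine {suc (suc e)} (s≤s (s≤s z≤n)) x y {R} {W} {A} {_} {z} refl h₁ h₂ h₃ = *-cancelˡ-≤ (c * (c * c)) (+-cancelʳ-≤ (c * (c * ((c + 8) * (x + y)))) _ _ (begin
  c * (c * c) * (R + W) + c * (c * ((c + 8) * (x + y))) ≡⟨ l1 c R W ((c + 8) * (x + y)) ⟩
  c * (c * (c * R + (c + 8) * (x + y))) + c * (c * (c * W)) ≤⟨ +-mono-≤ (*-monoʳ-≤ c (*-monoʳ-≤ c (≤-trans h₁ (+-monoʳ-≤ _ h₂)))) h₃ ⟩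
  c * (c * (c * A + x + c * y + (x + y))) + suc c * (c * (suc c * x) + suc c * (x + y)) ≤⟨ m≤m+n _ ((3 * (e * e) + 9 * e + 5) * x + (6 * (e * e) + 22 * e + 19) * y) ⟩
  c * (c * (c * A + x + c * y + (x + y))) + suc c * (c * (suc c * x) + suc c * (x + y)) + ((3 * (e * e) + 9 * e + 5) * x + (6 * (e * e) + 22 * e + 19) * y) ≡⟨ l2 e A x y ⟩
  c * (c * c) * A + c * (c * ((c + 8) * (x + y))) ∎))
  where
  open ≤-Reasoning
  c = 2 + e
  l1 : ∀ c r w t → c * (c * c) * (r + w) + c * (c * t) ≡ c * (c * (c * r + t)) + c * (c * (c * w))
  l1 = solve-∀
  l2 : ∀ e A x y → (2 + e) * ((2 + e) * ((2 + e) * A + x + (2 + e) * y + (x + y))) + (3 + e) * ((2 + e) * ((3 + e) * x) + (3 + e) * (x + y)) + ((3 * (e * e) + 9 * e + 5) * x + (6 * (e * e) + 22 * e + 19) * y)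
    ≡ (2 + e) * ((2 + e) * (2 + e)) * A + (2 + e) * ((2 + e) * (((2 + e) + 8) * (x + y)))
  l2 = solve-∀

-- The data are separated from the hypotheses in `Grid` because the bound `antichain-mass` is proved
-- from the shape alone, before a `Grid` can be formed. The `u` and ρ bound block coordinates, G is
-- the length of the diagonals, y0 the middle of the a coordinates, P the number of periods, and 1/c
-- the relative size of all errors.
record GridShape : Set where
  field
    d q' ρ a G V L P c u1 u2 u3 k1 κ y0 T0 αm M : ℕ
    α   : ℕ → ℕ
    β   : Vec ℕ d → ℕ
    τ   : ℕ → Vec ℕ d → ℕ
    per : ℕ → ℕ → ℕ
  q m ω μ : ℕ
  q = suc q'
  m = q ^ d
  ω = α k1
  μ = m * ω
  W : ℕ → ℕ
  W v = α (k1 + v * L)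
  open Digits q public

  Typical Near Usual : Vec ℕ d → Set
  Typical = InBox (u1 * q) (u3 * q)
  Near    = InBox ((u1 ∸ G) * q) (u3 * q)
  Usual   = InBox 0 (u2 * q)

  usual? : ∀ p → Dec (Usual p)
  usual? = inBox? 0 (u2 * q)

  InWindow : ℕ → Vec ℕ d → Set
  InWindow k p = Typical p × k1 ≤ k × k < k1 + V * L

  inWindow? : ∀ k p → Dec (InWindow k p)
  inWindow? k p = inBox? (u1 * q) (u3 * q) p ×-dec (k1 ≤? k) ×-dec (k <? k1 + V * L)

  column : Vec ℕ d → ℕ → Vec ℕ d
  column u j = col q u (lab d j)

  gsum : (Vec ℕ d → ℕ) → ℕ
  gsum F = sumV d ρ (λ u → sum< m (λ j → F (column u j)))

  colsum : (ℕ → Vec ℕ d → ℕ) → Vec ℕ d → ℕ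
  colsum f p = sum< (suc a) (λ k → α k * f k p)

  mass : (ℕ → Vec ℕ d → ℕ) → ℕ
  mass f = gsum (λ p → β p * colsum f p)

  β⁰ : Vec ℕ d → ℕ
  β⁰ u = β (col q u (zeros d))

record Grid : Set where
  field
    shape : GridShape
  open GridShape shape public
  field
    G≤u1     : G ≤ u1
    u3≤u2    : u3 ≤ u2
    u2≤ρ     : u2 ≤ ρ
    -- Rank κ meets a usual column at a level from y0 upwards, where α decreases, and a near column
    -- at a level at most `k1`. So lowering an element of a usual column to rank κ loses no weight.
    κ-usual  : ∀ p → Usual p → y0 + total p ≤ κ
    κ-near   : ∀ p → Near p → κ ≤ k1 + total p
    k1≤a     : k1 ≤ a
    y0≤k1    : y0 ≤ k1
    α-anti   : ∀ i j → y0 ≤ i → i ≤ j → α j ≤ α i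
    α-max    : ∀ k → α k ≤ αm
    α-base   : ∀ p → Near p → (c + 8) * ω ≤ c * α (κ ∸ total p)
    α-tail   : ∀ k → k1 + V * L ≤ k → c * α k ≤ ω
    rank-T0  : ∀ k (p : Vec ℕ d) → k ≤ a → Below (ρ * q) p → k + total p < T0
    τ-window : ∀ u j v o → InBox u1 u3 u → j < m → v < V → o < L → τ (k1 + (v * L + o)) (column u j) ≡ T0 + (per v j * L + o)
    τ-rank   : ∀ k p → ¬ InWindow k p → τ k p ≡ k + total p
    per-<    : ∀ v j → v < V → j < m → per v j < P
    per-mono : ∀ v v' j j' → v < v' → v' < V → j < m → j' < m → per v j ≤ per v' j'
    period-sum : ∀ π → sum< m (λ j → sum< V (λ v → W v * 𝟙 (per v j ≡ᵇ π))) ≤ μ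
    β-near   : ∀ u l → InBox u1 u3 u → Below q l → c * β (col q u l) ≤ suc c * β⁰ u
    β-near'  : ∀ u l → InBox (u1 ∸ G) u3 u → Below q l → c * β⁰ u ≤ suc c * β (col q u l)
    β-back   : ∀ u i → InBox u1 u3 u → i ≤ G → β⁰ u ≤ 2 * β⁰ (shift-back i u)
    G-large  : 2 * (c * (3 * P + 2)) ≤ G
    -- A single near column outweighs all unusual ones together, even at maximal level weight and
    -- after multiplication by c.
    unusual-small : ∀ p → Near p → c * (αm * gsum (λ p' → β p' * 𝟙d (¬? (usual? p')))) ≤ ω * β p
    2≤c      : 2 ≤ c
    antichain-mass : ∀ (f : ℕ → Vec ℕ d → Bool) →
      (∀ k p k' p' → f k p ≡ true → f k' p' ≡ true → k ≤ k' → p ≤v p' → k ≡ k' × p ≡ p') → mass (λ k p → 𝟙 (f k p)) ≤ M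

module GridBound (gr : Grid) (A : ℕ → Vec ℕ (Grid.d gr) → Bool)
  (A-range : ∀ k p → A k p ≡ true → k ≤ Grid.a gr × Below (Grid.ρ gr * Grid.q gr) p)
  (A-anti : ∀ k p k' p' → A k p ≡ true → A k' p' ≡ true → k ≤ k' → p ≤v p' → ¬ (Grid.τ gr k p < Grid.τ gr k' p')) where
  open Grid gr

  private
    gsum-mono : ∀ {F H : Vec ℕ d → ℕ} → (∀ u j → Below ρ u → j < m → F (column u j) ≤ H (column u j)) → gsum F ≤ gsum H
    gsum-mono h = sumV-mono d ρ (λ u b → sum<-mono m (λ j l → h u j b l))

    gsum-+ : ∀ (F H : Vec ℕ d → ℕ) → gsum (λ p → F p + H p) ≡ gsum F + gsum H
    gsum-+ F H = trans (sumV-cong d ρ (λ u _ → sum<-+ m _ _)) (sumV-+ d ρ _ _)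

    gsum-* : ∀ x (F : Vec ℕ d → ℕ) → gsum (λ p → x * F p) ≡ x * gsum F
    gsum-* x F = trans (sumV-cong d ρ (λ u _ → sum<-*ˡ m x _)) (sumV-*ˡ d ρ x _)

    R Wn : ℕ → Vec ℕ d → Set
    R  k p = A k p ≡ true × ¬ InWindow k p
    Wn k p = A k p ≡ true × InWindow k p

    abstract
      R? : ∀ k p → Dec (R k p)
      R? k p = (A k p Bool.≟ true) ×-dec ¬? (inWindow? k p)

      W? : ∀ k p → Dec (Wn k p)
      W? k p = (A k p Bool.≟ true) ×-dec inWindow? k p

      A-split : ∀ k p → 𝟙 (A k p) ≡ 𝟙d (R? k p) + 𝟙d (W? k p)
      A-split k p = split (A k p) (does (inWindow? k p))
        where
        split : ∀ x y → 𝟙 x ≡ 𝟙 (does (x Bool.≟ true) ∧ not y) + 𝟙 (does (x Bool.≟ true) ∧ y)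
        split false _     = refl
        split true  true  = refl
        split true  false = refl

    mass-split : mass (λ k p → 𝟙 (A k p)) ≡ mass (λ k p → 𝟙d (R? k p)) + mass (λ k p → 𝟙d (W? k p))
    mass-split = trans (sumV-cong d ρ (λ u _ → sum<-cong m (λ j _ → pw (column u j)))) (gsum-+ (λ p → β p * colsum (λ k p → 𝟙d (R? k p)) p) (λ p → β p * colsum (λ k p → 𝟙d (W? k p)) p))
      where
      pw : ∀ p → β p * colsum (λ k p → 𝟙 (A k p)) p ≡ β p * colsum (λ k p → 𝟙d (R? k p)) p + β p * colsum (λ k p → 𝟙d (W? k p)) p
      pw p = trans (cong (β p *_) (trans (sum<-cong (suc a) (λ k _ → trans (cong (α k *_) (A-split k p)) (*-distribˡ-+ (α k) _ _))) (sum<-+ (suc a) _ _))) (*-distribˡ-+ (β p) _ _)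

    -- Outside the window the clock is the rank, which is strictly larger at the larger of two
    -- distinct comparable types.
    R-true : ∀ k p k' p' → R k p → R k' p' → k ≤ k' → p ≤v p' → k ≡ k' × p ≡ p'
    R-true k p k' p' (x , n) (y , n') l l' with rank-< p p' l l'
    ... | inj₂ e = e
    ... | inj₁ s = ⊥-elim (A-anti k p k' p' x y l l' (subst₂ _<_ (sym (τ-rank k p n)) (sym (τ-rank k' p' n')) s))

    χ : ℕ → Vec ℕ d → Set
    χ v p = Typical p × (∃ λ o → o < L × A (k1 + (v * L + o)) p ≡ true)

    abstract
      χ? : ∀ v p → Dec (χ v p)
      χ? v p = inBox? (u1 * q) (u3 * q) p ×-dec anyUpTo? (λ o → A (k1 + (v * L + o)) p Bool.≟ true) L

    load : Vec ℕ d → ℕ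
    load u = sum< m (λ j → sum< V (λ v → W v * 𝟙d (χ? v (column u j))))

    lab< : ∀ j → j < m → Below q (lab d j)
    lab< = lab-below d

    window-level : ∀ v o → α (k1 + (v * L + o)) ≤ W v
    window-level v o = α-anti _ _ (≤-trans y0≤k1 (m≤m+n k1 _)) (+-monoʳ-≤ k1 (m≤m+n (v * L) o))

    -- Within one piece the clock rises with the level, so `A` has at most one element there, and
    -- its weight is at most that of the bottom level of the piece.
    column-load : ∀ u j → j < m → colsum (λ k p → 𝟙d (W? k p)) (column u j) ≤ sum< V (λ v → W v * 𝟙d (χ? v (column u j)))
    column-load u j lj = ≤-trans (sum<-window (suc a) k1 (V * L) g (λ i n → proj₂ (proj₂ (𝟙d-≢0 (W? i p) (*-≢0ʳ (α i) n)))))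
      (≤-trans (≤-reflexive (sym (sum<-blocks V L _))) (sum<-mono V (λ v lv → sum<-single L _ _ (bnd v lv) (uniq v lv))))
      where
      p = column u j
      g : ℕ → ℕ
      g k = α k * 𝟙d (W? k p)
      bnd : ∀ v → v < V → ∀ o → o < L → g (k1 + (v * L + o)) ≤ W v * 𝟙d (χ? v p)
      bnd v lv o lo with W? (k1 + (v * L + o)) p
      ... | no _ = ≤-trans (≤-reflexive (*-zeroʳ (α (k1 + (v * L + o))))) z≤n
      ... | yes (x , w) = ≤-trans (≤-reflexive (*-identityʳ _)) (≤-trans (window-level v o)
          (≤-reflexive (sym (trans (cong (W v *_) (𝟙d-yes (χ? v p) (proj₁ w , o , lo , x))) (*-identityʳ (W v))))))
      uniq : ∀ v → v < V → ∀ o o' → o < o' → o' < L → g (k1 + (v * L + o)) ≢ 0 → g (k1 + (v * L + o')) ≢ 0 → Empty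
      uniq v lv o o' l lo' n n' with 𝟙d-≢0 (W? _ p) (*-≢0ʳ (α (k1 + (v * L + o))) n) | 𝟙d-≢0 (W? _ p) (*-≢0ʳ (α (k1 + (v * L + o'))) n')
      ... | (x , w) | (y , w') = A-anti _ p _ p x y (+-monoʳ-≤ k1 (+-monoʳ-≤ (v * L) (<⇒≤ l))) (≤v-refl p)
        (subst₂ _<_ (sym (τ-window u j v o t lj lv (<-trans l lo'))) (sym (τ-window u j v o' t lj lv lo')) (+-monoʳ-< T0 (+-monoʳ-< (per v j * L) l)))
        where t = box-col q u1 u3 u (lab d j) (lab< j lj) (proj₁ w)

    schedule : Schedule
    schedule = record { m = m ; V = V ; P = P ; μ = μ ; W = W ; per = per ; per-< = per-< ; per-mono = per-mono
      ; period-sum = period-sum ; layer-sum = λ v _ → *-monoʳ-≤ m (α-anti _ _ y0≤k1 (m≤m+n k1 _)) }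

    module Diag (u : Vec ℕ d) where
      χᵢ : ℕ → ℕ → ℕ → Bool
      χᵢ i v j = does (χ? v (column (shift (suc i) u) j))
      open Diagonal schedule χᵢ public

      -- With different periods the job of the lower layer would be strictly earlier, while it is
      -- also lower both in level and, by `col-step`, in column; this contradicts `A-anti`.
      compatible : ∀ i i' v v' j j' → i < i' → Job i v j → Job i' v' j' → v < v' → per v j ≡ per v' j'
      compatible i i' v v' j j' i<i' (job lv lj x) (job lv' lj' x') v<v' with does-sound (χ? v _) x | does-sound (χ? v' _) x'
      ... | t , o , lo , y | t' , o' , lo' , y' with <-cmp (per v j) (per v' j')
      ...   | tri≈ _ e _ = e
      ...   | tri> _ _ g = ⊥-elim (<⇒≱ g (per-mono v v' j j' v<v' lv' lj lj'))
      ...   | tri< g _ _ = ⊥-elim (A-anti _ _ _ _ y y' (+-monoʳ-≤ k1 (≤-trans (<⇒≤ (block v o lo v<v')) (m≤m+n (v' * L) o')))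
            (subst (λ w → column (shift (suc i) u) j ≤v column w j') (trans (shift-+ (i' ∸ i) (suc i) u) (cong (λ z → shift z u) (trans (+-suc (i' ∸ i) i) (cong suc (m∸n+n≡m (<⇒≤ i<i'))))))
              (col-step q (i' ∸ i) (shift (suc i) u) (lab d j) (lab d j') (lab< j lj) (m<n⇒0<n∸m i<i')))
            (subst₂ _<_ (sym (τ-window (shift (suc i) u) j v o (box-col q u1 u3 _ (lab d j) (lab< j lj) t) lj lv lo))
                        (sym (τ-window (shift (suc i') u) j' v' o' (box-col q u1 u3 _ (lab d j') (lab< j' lj') t') lj' lv' lo'))
              (+-monoʳ-< T0 (<-≤-trans (block (per v j) o lo g) (m≤m+n _ o')))))
        where
        block : ∀ x {y} o → o < L → x < y → x * L + o < y * L
        block x {y} o lo l = <-≤-trans (+-monoʳ-< (x * L) lo) (≤-trans (≤-reflexive (+-comm (x * L) L)) (*-monoˡ-≤ L l))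

    abstract
      loaded? : ∀ u → Dec (load u ≢ 0)
      loaded? u = ¬? (load u ≟ 0)

    load-typical : ∀ u → load u ≢ 0 → InBox u1 u3 u × (∃ λ j → j < m × (∃ λ v → v < V × (∃ λ o → o < L × A (k1 + (v * L + o)) (column u j) ≡ true)))
    load-typical u n with sum<≢0 m _ n
    ... | j , lj , n' with sum<≢0 V _ n'
    ... | v , lv , n'' with 𝟙d-≢0 (χ? v (column u j)) (*-≢0ʳ (W v) n'')
    ... | t , o , lo , x = box-col q u1 u3 u (lab d j) (lab< j lj) t , j , lj , v , lv , o , lo , x

    -- A loaded block at most G steps further up the diagonal puts a window element of `A` above
    -- every column of this block. That expels rank-timed elements from the levels up to `k1` and
    -- makes room for substitutes of rank κ.
    Fed : Vec ℕ d → Set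
    Fed u = InBox (u1 ∸ G) u3 u × (∃ λ i → i < G × load (shift (suc i) u) ≢ 0)

    abstract
      fed? : ∀ u → Dec (Fed u)
      fed? u = inBox? (u1 ∸ G) u3 u ×-dec anyUpTo? (λ i → loaded? (shift (suc i) u)) G

    fed : ∀ u i → i < G → load (shift (suc i) u) ≢ 0 → Fed u
    fed u i l n = box-weaken u (∸-monoʳ-≤ u1 l) ≤-refl (box-unshift (suc i) u (proj₁ (load-typical _ n))) , i , l , n

    record Above (p : Vec ℕ d) : Set where
      field
        k   : ℕ
        p'  : Vec ℕ d
        p≤  : p ≤v p'
        k1≤ : k1 ≤ k
        inA : A k p' ≡ true
        T0≤ : T0 ≤ τ k p'

    above : ∀ u l → Below q l → Fed u → Above (col q u l)
    above u l bl (_ , i , li , n) with load-typical _ n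
    ... | t , j , lj , v , lv , o , lo , x = record { k = k1 + (v * L + o) ; p' = column (shift (suc i) u) j
      ; p≤ = col-step q (suc i) u l (lab d j) bl (s≤s z≤n) ; k1≤ = m≤m+n k1 _ ; inA = x
      ; T0≤ = ≤-trans (m≤m+n T0 _) (≤-reflexive (sym (τ-window _ j v o t lj lv lo))) }

    -- All rank times precede T0 and hence all window times, so a rank-timed element at or below the
    -- level of the witness would be comparable with it and earlier.
    above-R : ∀ {p} (w : Above p) k p₀ → R k p₀ → p₀ ≤v p → Above.k w < k
    above-R w k p₀ (x , n) l = ≰⇒> λ k≤ → A-anti k p₀ _ _ x inA k≤ (≤v-trans l p≤)
      (<-≤-trans (≤-<-trans (≤-reflexive (τ-rank k p₀ n)) (rank-T0 k p₀ (proj₁ (A-range k p₀ x)) (proj₂ (A-range k p₀ x)))) T0≤)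
      where open Above w hiding (k)

    High : Vec ℕ d → Set
    High p = ∃ λ k → k < suc a × R k p × κ < k + total p

    abstract
      high? : ∀ p → Dec (High p)
      high? p = anyUpTo? (λ k → R? k p ×-dec (κ <? k + total p)) (suc a)

    -- The comparison antichain: low rank-timed elements, and the rank-κ element of every
    -- fed column and of every usual column with a high rank-timed element.
    A' : ℕ → Vec ℕ d → Set
    A' k p = (R k p × k + total p ≤ κ) ⊎ (k + total p ≡ κ × Usual p × ((Fed (blk p) × col q (blk p) (residue p) ≡ p) ⊎ High p))

    vec-≟ : ∀ {n} (u v : Vec ℕ n) → Dec (u ≡ v)
    vec-≟ [] [] = yes refl
    vec-≟ (x ∷ u) (y ∷ v) with x ≟ y | vec-≟ u v
    ... | yes refl | yes refl = yes refl
    ... | no n     | _        = no λ { refl → n refl }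
    ... | yes _    | no n     = no λ { refl → n refl }

    abstract
      A'? : ∀ k p → Dec (A' k p)
      A'? k p = (R? k p ×-dec (k + total p ≤? κ)) ⊎-dec ((k + total p ≟ κ) ×-dec usual? p ×-dec
        ((fed? (blk p) ×-dec vec-≟ (col q (blk p) (residue p)) p) ⊎-dec high? p))

    near-fed : ∀ u l → Below q l → Fed u → Near (col q u l)
    near-fed u l bl (b , _) = col-box q (u1 ∸ G) u3 u l bl b

    -- The essential case is a low rank-timed element below a substitute of rank κ. If the
    -- substitute replaces a high element, that element lies above it in the same column and hence
    -- above the low one, against `R-true`. If its column is fed, `above-R` puts the low element
    -- above level `k1`, which rank κ does not exceed in a near column.
    A'-anti : ∀ k p k' p' → A' k p → A' k' p' → k ≤ k' → p ≤v p' → k ≡ k' × p ≡ p'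
    A'-anti k p k' p' x y l l' with rank-< p p' l l'
    ... | inj₂ e = e
    A'-anti k p k' p' (inj₁ (r , _)) (inj₁ (r' , _)) l l' | inj₁ s = R-true k p k' p' r r' l l'
    A'-anti k p k' p' (inj₂ (e , _)) (inj₁ (_ , h)) l l' | inj₁ s = ⊥-elim (<⇒≱ s (≤-trans h (≤-reflexive (sym e))))
    A'-anti k p k' p' (inj₂ (e , _)) (inj₂ (e' , _)) l l' | inj₁ s = ⊥-elim (<⇒≢ s (trans e (sym e')))
    A'-anti k p k' p' (inj₁ (r , _)) (inj₂ (e , us , inj₂ (k₂ , _ , r₂ , hi))) l l' | inj₁ s =
      ⊥-elim (<⇒≱ (+-cancelʳ-< (total p') k' k₂ (≤-<-trans (≤-reflexive e) hi)) (≤-trans (≤-reflexive (sym (proj₁ eq))) l))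
      where
      eq : k ≡ k₂ × p ≡ p'
      eq = R-true k p k₂ p' r r₂ (≤-trans l (<⇒≤ (+-cancelʳ-< (total p') k' k₂ (≤-<-trans (≤-reflexive e) hi)))) l'
    A'-anti k p k' p' (inj₁ (r , _)) (inj₂ (e , us , inj₁ (fd , eq))) l l' | inj₁ s =
      ⊥-elim (<⇒≱ (above-R w k p r (subst (p ≤v_) (sym eq) l')) (≤-trans l (≤-trans k'≤k1 (Above.k1≤ w))))
      where
      w : Above (col q (blk p') (residue p'))
      w = above (blk p') (residue p') (residue-below p') fd
      k'≤k1 : k' ≤ k1
      k'≤k1 = +-cancelʳ-≤ (total p') k' k1 (≤-trans (≤-reflexive e) (κ-near p' (subst Near eq (near-fed (blk p') _ (residue-below p') fd))))

    a' : Vec ℕ d → ℕ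
    a' = colsum (λ k p → 𝟙d (A'? k p))

    r : Vec ℕ d → ℕ
    r = colsum (λ k p → 𝟙d (R? k p))

    r-single : ∀ p b → (∀ k → k ≤ a → R k p → α k ≤ b) → r p ≤ b
    r-single p b h = sum<-single (suc a) _ b bnd uniq
      where
      bnd : ∀ k → k < suc a → α k * 𝟙d (R? k p) ≤ b
      bnd k lk with R? k p
      ... | no  _ = ≤-trans (≤-reflexive (*-zeroʳ (α k))) z≤n
      ... | yes x = ≤-trans (≤-reflexive (*-identityʳ (α k))) (h k (s≤s⁻¹ lk) x)
      uniq : ∀ i j → i < j → j < suc a → α i * 𝟙d (R? i p) ≢ 0 → α j * 𝟙d (R? j p) ≢ 0 → Empty
      uniq i j l _ n n' = <⇒≢ l (proj₁ (R-true i p j p (𝟙d-≢0 (R? i p) (*-≢0ʳ (α i) n)) (𝟙d-≢0 (R? j p) (*-≢0ʳ (α j) n')) (<⇒≤ l) (≤v-refl p)))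

    a'-term : ∀ k p → k ≤ a → A' k p → α k ≤ a' p
    a'-term k p l x = ≤-trans (≤-reflexive (sym (trans (cong (α k *_) (𝟙d-yes (A'? k p) x)) (*-identityʳ (α k)))))
      (term≤sum< (λ k → α k * 𝟙d (A'? k p)) (s≤s l))

    r≤a'-usual : ∀ p → Usual p → r p ≤ a' p
    r≤a'-usual p us = r-single p (a' p) go
      where
      go : ∀ k → k ≤ a → R k p → α k ≤ a' p
      go k lk x with k + total p ≤? κ
      ... | yes l = a'-term k p lk (inj₁ (x , l))
      ... | no  n = ≤-trans (α-anti (κ ∸ total p) k y0≤b b≤k) (a'-term (κ ∸ total p) p (≤-trans b≤k lk)
            (inj₂ (m∸n+n≡m (≤-trans (m≤n+m (total p) y0) (κ-usual p us)) , us , inj₂ (k , s≤s lk , x , ≰⇒> n))))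
        where
        y0≤b : y0 ≤ κ ∸ total p
        y0≤b = ≤-trans (≤-reflexive (sym (m+n∸n≡m y0 (total p)))) (∸-monoˡ-≤ (total p) (κ-usual p us))
        b≤k : κ ∸ total p ≤ k
        b≤k = m≤n+o⇒m∸n≤o κ (total p) (≤-trans (<⇒≤ (≰⇒> n)) (≤-reflexive (+-comm k (total p))))

    r≤a'-unusual : ∀ p → r p ≤ a' p + αm
    r≤a'-unusual p = r-single p _ (λ k _ _ → ≤-trans (α-max k) (m≤n+m αm (a' p)))

    fT fN fF br : Vec ℕ d → ℕ
    fT p = 𝟙d (fed? (blk p) ×-dec inBox? u1 u3 (blk p))
    fN p = 𝟙d (fed? (blk p) ×-dec ¬? (inBox? u1 u3 (blk p)))
    fF p = 𝟙d (fed? (blk p))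
    br p = 𝟙d (¬? (usual? p))

    usual-near : ∀ p → Near p → Usual p
    usual-near p n = box-weaken p z≤n (*-monoˡ-≤ q u3≤u2) n

    -- A fed column gains a substitute worth (1 + 8/c) ω. It gives up at most ω, and at most ω/c if
    -- it is typical, because a rank-timed element above `k1` then has to lie beyond the window.
    -- Typical fed columns thus release about ω each, which is to pay for the scheduled part. Other
    -- columns lose nothing unless they are unusual.
    column-bound : ∀ u j → j < m → let p = column u j in
      c * r p + (c + 8) * ω * fF p ≤ c * a' p + ω * fT p + c * ω * fN p + c * αm * br p
    column-bound u j lj with fed? (blk (column u j)) in fe
    ... | no nf = ≤-trans (≤-reflexive (trans (cong (c * r p +_) (*-zeroʳ ((c + 8) * ω))) (+-identityʳ _)))
          (≤-trans go (≤-reflexive (lem (c * a' p) (ω * 0) (c * ω * 0) (c * αm * br p) (*-zeroʳ ω) (*-zeroʳ (c * ω)))))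
      where
      p = column u j
      lem : ∀ x y z w → y ≡ 0 → z ≡ 0 → x + w ≡ x + y + z + w
      lem x y z w refl refl = cong (_+ w) (sym (trans (+-identityʳ (x + 0)) (+-identityʳ x)))
      go : c * r p ≤ c * a' p + c * αm * br p
      go with usual? p
      ... | yes us = ≤-trans (*-monoʳ-≤ c (r≤a'-usual p us)) (m≤m+n _ _)
      ... | no  nu = ≤-trans (*-monoʳ-≤ c (r≤a'-unusual p)) (≤-reflexive (trans (*-distribˡ-+ c (a' p) αm) (cong (c * a' p +_) (sym (*-identityʳ (c * αm))))))
    ... | yes fd = final
      where
      p = column u j
      l = lab d j
      bl : Below q l
      bl = lab< j lj
      bu : blk p ≡ u
      bu = blk-col u l bl
      fu : Fed u
      fu = subst Fed bu fd
      w : Above p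
      w = above u l bl fu
      near : Near p
      near = near-fed u l bl fu
      base : (c + 8) * ω ≤ c * a' p
      base = ≤-trans (α-base p near) (*-monoʳ-≤ c (a'-term (κ ∸ total p) p
          (≤-trans (m≤n+o⇒m∸n≤o κ (total p) (≤-trans (κ-near p near) (≤-reflexive (+-comm k1 (total p))))) k1≤a)
          (inj₂ (m∸n+n≡m (≤-trans (m≤n+m (total p) y0) (κ-usual p (usual-near p near))) , usual-near p near ,
            inj₁ (fd , trans (cong₂ (col q) bu (residue-col u l bl)) refl)))))
      rω : r p ≤ ω
      rω = r-single p ω (λ k _ x → α-anti k1 k y0≤k1 (<⇒≤ (≤-<-trans (Above.k1≤ w) (above-R w k p x (≤v-refl p)))))
      rT : Typical p → c * r p ≤ ω
      rT t = ≤-trans (≤-reflexive (trans (sym (sum<-*ˡ (suc a) c _)) (sum<-cong (suc a) (λ k _ → sym (*-assoc c (α k) _)))))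
        (sum<-single (suc a) _ ω bnd uniq)
        where
        bnd : ∀ k → k < suc a → c * α k * 𝟙d (R? k p) ≤ ω
        bnd k lk with R? k p
        ... | no  _ = ≤-trans (≤-reflexive (*-zeroʳ (c * α k))) z≤n
        ... | yes x = ≤-trans (≤-reflexive (*-identityʳ (c * α k))) (α-tail k (≮⇒≥ λ s →
              proj₂ x (t , <⇒≤ (≤-<-trans (Above.k1≤ w) (above-R w k p x (≤v-refl p))) , s)))
        uniq : ∀ i j → i < j → j < suc a → c * α i * 𝟙d (R? i p) ≢ 0 → c * α j * 𝟙d (R? j p) ≢ 0 → Empty
        uniq i j l _ n n' = <⇒≢ l (proj₁ (R-true i p j p (𝟙d-≢0 (R? i p) (*-≢0ʳ (c * α i) n)) (𝟙d-≢0 (R? j p) (*-≢0ʳ (c * α j) n')) (<⇒≤ l) (≤v-refl p)))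
      final : c * r p + (c + 8) * ω * 1 ≤ c * a' p + ω * 𝟙d (yes fd ×-dec inBox? u1 u3 (blk p)) + c * ω * 𝟙d (yes fd ×-dec ¬? (inBox? u1 u3 (blk p))) + c * αm * br p
      final with inBox? u1 u3 (blk p)
      ... | yes t = ≤-trans (≤-reflexive (trans (cong (c * r p +_) (*-identityʳ _)) (+-comm (c * r p) _)))
            (≤-trans (+-mono-≤ base (rT (col-box q u1 u3 u l bl (subst (InBox u1 u3) bu t))))
              (≤-trans (≤-reflexive (cong (c * a' p +_) (sym (*-identityʳ ω)))) (≤-trans (m≤m+n _ (c * ω * 0)) (m≤m+n _ (c * αm * br p)))))
      ... | no nt = ≤-trans (≤-reflexive (trans (cong (c * r p +_) (*-identityʳ _)) (+-comm (c * r p) _)))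
            (≤-trans (+-mono-≤ base (*-monoʳ-≤ c rω))
              (≤-trans (≤-reflexive (cong₂ _+_ (sym (trans (cong (c * a' p +_) (*-zeroʳ ω)) (+-identityʳ _))) (sym (*-identityʳ (c * ω))))) (m≤m+n _ (c * αm * br p))))

    bT bN bF BR Rm Wm Am : ℕ
    bT = gsum (λ p → β p * fT p)
    bN = gsum (λ p → β p * fN p)
    bF = gsum (λ p → β p * fF p)
    BR = gsum (λ p → β p * br p)
    Rm = mass (λ k p → 𝟙d (R? k p))
    Wm = mass (λ k p → 𝟙d (W? k p))
    Am = mass (λ k p → 𝟙d (A'? k p))

    scale : ∀ x (F : Vec ℕ d → ℕ) → gsum (λ p → β p * (x * F p)) ≡ x * gsum (λ p → β p * F p)
    scale x F = trans (sumV-cong d ρ (λ u _ → sum<-cong m (λ j _ → lem (β (column u j)) x (F (column u j))))) (gsum-* x (λ p → β p * F p))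
      where
      lem : ∀ b x f → b * (x * f) ≡ x * (b * f)
      lem = solve-∀

    gsum-β+ : ∀ (F H : Vec ℕ d → ℕ) → gsum (λ p → β p * (F p + H p)) ≡ gsum (λ p → β p * F p) + gsum (λ p → β p * H p)
    gsum-β+ F H = trans (sumV-cong d ρ (λ u _ → sum<-cong m (λ j _ → *-distribˡ-+ (β (column u j)) (F (column u j)) (H (column u j))))) (gsum-+ (λ p → β p * F p) (λ p → β p * H p))

    bF-split : bF ≡ bT + bN
    bF-split = trans (sumV-cong d ρ (λ u _ → sum<-cong m (λ j _ → cong (β (column u j) *_) (split (does (fed? (blk (column u j)))) (does (inBox? u1 u3 (blk (column u j)))))))) (gsum-β+ fT fN)
      where
      split : ∀ x y → 𝟙 x ≡ 𝟙 (x ∧ y) + 𝟙 (x ∧ not y)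
      split false _     = refl
      split true  true  = refl
      split true  false = refl

    rank-bound : c * Rm + (c + 8) * ω * bF ≤ c * Am + ω * bT + c * ω * bN + c * αm * BR
    rank-bound = subst₂ _≤_ lhs rhs (gsum-mono {λ p → β p * F p} {λ p → β p * H p} (λ u j _ lj → *-monoʳ-≤ (β (column u j)) (column-bound u j lj)))
      where
      F H₁ H₂ H₃ H₄ H : Vec ℕ d → ℕ
      F p = c * r p + (c + 8) * ω * fF p
      H₁ p = c * a' p
      H₂ p = ω * fT p
      H₃ p = c * ω * fN p
      H₄ p = c * αm * br p
      H p = H₁ p + H₂ p + H₃ p + H₄ p
      lhs : gsum (λ p → β p * F p) ≡ c * Rm + (c + 8) * ω * bF
      lhs = trans (gsum-β+ (λ p → c * r p) (λ p → (c + 8) * ω * fF p)) (cong₂ _+_ (scale c r) (scale ((c + 8) * ω) fF))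
      rhs : gsum (λ p → β p * H p) ≡ c * Am + ω * bT + c * ω * bN + c * αm * BR
      rhs = trans (gsum-β+ (λ p → H₁ p + H₂ p + H₃ p) H₄) (cong₂ _+_ (trans (gsum-β+ (λ p → H₁ p + H₂ p) H₃)
        (cong₂ _+_ (trans (gsum-β+ H₁ H₂) (cong₂ _+_ (scale c a') (scale ω fT))) (scale (c * ω) fN))) (scale (c * αm) br))

    top : Vec ℕ d → ℕ
    top u = 𝟙d (loaded? u ×-dec ¬? (fed? u))

    -- A fed block can pay for a load of μ. What exceeds μ, and the whole load of a loaded block
    -- that is not fed, must be paid for elsewhere.
    ex : Vec ℕ d → ℕ
    ex u = (load u ∸ μ) + μ * top u

    FT FF : Vec ℕ d → ℕ
    FT u = 𝟙d (fed? u ×-dec inBox? u1 u3 u)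
    FF u = 𝟙d (fed? u)

    B E Y YT : ℕ
    B  = sumV d ρ (λ u → β⁰ u * load u)
    E  = sumV d ρ (λ u → β⁰ u * ex u)
    Y  = sumV d ρ (λ u → β⁰ u * FF u)
    YT = sumV d ρ (λ u → β⁰ u * FT u)

    Wm≤B : c * Wm ≤ suc c * B
    Wm≤B = ≤-trans (≤-reflexive (sym (sumV-*ˡ d ρ c _))) (≤-trans (sumV-mono d ρ (λ u _ → block u)) (≤-reflexive (sumV-*ˡ d ρ (suc c) _)))
      where
      w : Vec ℕ d → ℕ
      w p = sum< V (λ v → W v * 𝟙d (χ? v p))
      rearr : ∀ x b y → x * (b * y) ≡ x * b * y
      rearr = solve-∀
      pw : ∀ u j → j < m → c * (β (column u j) * w (column u j)) ≤ suc c * (β⁰ u * w (column u j))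
      pw u j lj with inBox? u1 u3 u
      ... | yes t = subst₂ _≤_ (sym (rearr c (β (column u j)) _)) (sym (rearr (suc c) (β⁰ u) _)) (*-monoˡ-≤ (w (column u j)) (β-near u _ t (lab< j lj)))
      ... | no  n = ≤-trans (≤-reflexive (trans (cong (λ z → c * (β (column u j) * z)) w0) (trans (cong (c *_) (*-zeroʳ (β (column u j)))) (*-zeroʳ c)))) z≤n
        where
        w0 : w (column u j) ≡ 0
        w0 = sum<-zero V (λ v _ → trans (cong (W v *_) (𝟙d-no (χ? v (column u j)) (λ x → n (box-col q u1 u3 u _ (lab< j lj) (proj₁ x))))) (*-zeroʳ (W v)))
      block : ∀ u → c * sum< m (λ j → β (column u j) * colsum (λ k p → 𝟙d (W? k p)) (column u j)) ≤ suc c * (β⁰ u * load u)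
      block u = ≤-trans (*-monoʳ-≤ c (sum<-mono m (λ j lj → *-monoʳ-≤ (β (column u j)) (column-load u j lj))))
        (≤-trans (≤-reflexive (sym (sum<-*ˡ m c _))) (≤-trans (sum<-mono m (λ j lj → pw u j lj))
          (≤-reflexive (trans (sum<-*ˡ m (suc c) _) (cong (suc c *_) (sum<-*ˡ m (β⁰ u) _))))))

    B≤ : B ≤ μ * YT + E
    B≤ = ≤-trans (sumV-mono d ρ (λ u _ → pw u)) (≤-reflexive (trans (sumV-+ d ρ _ _) (cong (_+ E) (sumV-*ˡ d ρ μ _))))
      where
      load≤ : ∀ u → load u ≤ μ * FT u + ex u
      load≤ u with loaded? u
      ... | no  e = ≤-trans (≤-reflexive (decidable-stable (load u ≟ 0) e)) z≤n
      ... | yes n with fed? u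
      ...   | yes f = ≤-trans (m≤n+m∸n (load u) μ) (+-mono-≤ (≤-reflexive (sym (trans (cong (μ *_) (𝟙d-yes (inBox? u1 u3 u) (proj₁ (load-typical u n)))) (*-identityʳ μ)))) (m≤m+n _ _))
      ...   | no  _ = ≤-trans (m≤n+m∸n (load u) μ) (≤-trans (≤-reflexive (trans (+-comm μ _) (cong (load u ∸ μ +_) (sym (*-identityʳ μ))))) (m≤n+m _ (μ * 0)))
      rearr : ∀ b x f e → b * (x * f + e) ≡ x * (b * f) + b * e
      rearr = solve-∀
      pw : ∀ u → β⁰ u * load u ≤ μ * (β⁰ u * FT u) + β⁰ u * ex u
      pw u = ≤-trans (*-monoʳ-≤ (β⁰ u) (load≤ u)) (≤-reflexive (rearr (β⁰ u) μ (FT u) (ex u)))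

    ex-zero : ∀ u → load u ≡ 0 → ex u ≡ 0
    ex-zero u e = cong₂ _+_ (trans (cong (_∸ μ) e) (0∸n≡0 μ)) (trans (cong (μ *_) (𝟙d-no (loaded? u ×-dec ¬? (fed? u)) (λ x → proj₁ x e))) (*-zeroʳ μ))

    ex-load : ∀ u → ex u ≢ 0 → load u ≢ 0
    ex-load u n e = n (ex-zero u e)

    -- Two loaded unfed blocks cannot occur in one stretch of length G, as the upper one would feed
    -- the lower; this adds one μ to `excess-sum`. If u is not fed, the stretch carries no load at
    -- all.
    diagonal : ∀ u → sum< G (λ i → ex (shift (suc i) u)) ≤ μ * (3 * P + 2) * FF u
    diagonal u with fed? u
    ... | no nf = ≤-trans (≤-reflexive (sum<-zero G (λ i l → ex-zero _ (zero-load i l)))) z≤n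
      where
      zero-load : ∀ i → i < G → load (shift (suc i) u) ≡ 0
      zero-load i l with load (shift (suc i) u) ≟ 0
      ... | yes e = e
      ... | no  n = ⊥-elim (nf (fed u i l n))
    ... | yes _ = ≤-trans (≤-reflexive (trans (sum<-+ G _ _) (cong (sum< G (λ i → load (shift (suc i) u) ∸ μ) +_) (sum<-*ˡ G μ _))))
        (≤-trans (+-mono-≤ (Diag.excess-sum u (Diag.compatible u) G) (*-monoʳ-≤ μ (sum<-single G (λ i → top (shift (suc i) u)) 1 (λ i _ → 𝟙≤1 _) uniq)))
          (≤-reflexive (lem μ P)))
      where
      lem : ∀ x p → x * (3 * p + 1) + x * 1 ≡ x * (3 * p + 2) * 1
      lem = solve-∀
      uniq : ∀ i j → i < j → j < G → top (shift (suc i) u) ≢ 0 → top (shift (suc j) u) ≢ 0 → Empty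
      uniq i j i<j j<G x y = proj₂ (𝟙d-≢0 (loaded? (shift (suc i) u) ×-dec ¬? (fed? (shift (suc i) u))) x)
        (fed (shift (suc i) u) (j ∸ suc i) (≤-<-trans (m∸n≤m j (suc i)) j<G)
          (subst (λ w → load w ≢ 0) (sym (trans (shift-+ (suc (j ∸ suc i)) (suc i) u) (cong (λ z → shift z u) (cong suc (m∸n+n≡m i<j)))))
            (proj₁ (𝟙d-≢0 (loaded? (shift (suc j) u) ×-dec ¬? (fed? (shift (suc j) u))) y))))

    -- Each translation by at most G steps changes block weights by a factor at most 2. Summing over
    -- all G of them spreads every excess over the G blocks below it, and since a stretch has
    -- bounded total excess, E becomes a small share of the fed weight in `cE≤`.
    E-shift : ∀ i → i < G → E ≤ 2 * sumV d ρ (λ u → β⁰ u * ex (shift (suc i) u))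
    E-shift i l = ≤-trans (sumV-mono d ρ (λ u _ → pw u)) (≤-trans (sumV-shift d ρ (suc i) f supp)
        (≤-reflexive (trans (sumV-cong d ρ (λ u _ → cong (λ w → 2 * (β⁰ w * ex (shift (suc i) u))) (shift-back-shift (suc i) u))) (sumV-*ˡ d ρ 2 _))))
      where
      f : Vec ℕ d → ℕ
      f u = 2 * (β⁰ (shift-back (suc i) u) * ex u)
      supp : ∀ u → f u ≢ 0 → InBox (suc i) ρ u
      supp u n = box-weaken u (≤-trans l G≤u1) (≤-trans u3≤u2 u2≤ρ) (proj₁ (load-typical u (ex-load u (*-≢0ʳ (β⁰ (shift-back (suc i) u)) (*-≢0ʳ 2 n)))))
      pw : ∀ u → β⁰ u * ex u ≤ f u
      pw u with ex u ≟ 0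
      ... | yes e = ≤-trans (≤-reflexive (trans (cong (β⁰ u *_) e) (*-zeroʳ (β⁰ u)))) z≤n
      ... | no  n = ≤-trans (*-monoˡ-≤ (ex u) (β-back u (suc i) (proj₁ (load-typical u (ex-load u n))) l)) (≤-reflexive (*-assoc 2 (β⁰ (shift-back (suc i) u)) (ex u)))

    GE≤ : G * E ≤ 2 * (μ * (3 * P + 2) * Y)
    GE≤ = ≤-trans (≤-reflexive (sym (sum<-const G E))) (≤-trans (sum<-mono G E-shift) (≤-trans (≤-reflexive (sum<-*ˡ G 2 _)) (*-monoʳ-≤ 2
      (≤-trans (≤-reflexive (sym (sumV-swap d ρ G _))) (≤-trans (sumV-mono d ρ (λ u _ → ≤-trans (≤-reflexive (sum<-*ˡ G (β⁰ u) _))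
        (≤-trans (*-monoʳ-≤ (β⁰ u) (diagonal u)) (≤-reflexive (rearr (β⁰ u) (μ * (3 * P + 2)) (FF u)))))) (≤-reflexive (sumV-*ˡ d ρ (μ * (3 * P + 2)) _)))))))
      where
      rearr : ∀ b x f → b * (x * f) ≡ x * (b * f)
      rearr = solve-∀

    cE≤ : c * E ≤ μ * Y
    cE≤ = *-cancelˡ-≤ (2 * (3 * P + 2)) {{m*n≢0 2 (3 * P + 2) {{_}} {{>-nonZero (≤-trans (s≤s z≤n) (m≤n+m 2 (3 * P)))}}}} (≤-trans (≤-reflexive (l1 (3 * P + 2) c E)) (≤-trans (*-monoˡ-≤ E G-large)
      (≤-trans GE≤ (≤-reflexive (l2 μ (3 * P + 2) Y)))))
      where
      l1 : ∀ x c e → 2 * x * (c * e) ≡ 2 * (c * x) * e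
      l1 = solve-∀
      l2 : ∀ μ x y → 2 * (μ * x * y) ≡ 2 * x * (μ * y)
      l2 = solve-∀

    cμ≤ : ∀ (S : Vec ℕ d → ℕ) → (∀ u → S u ≢ 0 → Fed u) → c * (μ * sumV d ρ (λ u → β⁰ u * S u)) ≤ suc c * ω * gsum (λ p → β p * S (blk p))
    cμ≤ S sf = ≤-trans (≤-reflexive (trans (l1 c m ω _) (sym (sumV-*ˡ d ρ (ω * (m * c)) _)))) (≤-trans (sumV-mono d ρ (λ u _ → pw u))
        (≤-reflexive (sumV-*ˡ d ρ (suc c * ω) _)))
      where
      l1 : ∀ c m w x → c * (m * w * x) ≡ w * (m * c) * x
      l1 = solve-∀
      l2 : ∀ c w b s → c * w * b * s ≡ w * (c * b * s)
      l2 = solve-∀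
      term : ∀ u j → j < m → c * β⁰ u * S u ≤ suc c * (β (column u j) * S (blk (column u j)))
      term u j lj with S u ≟ 0
      ... | yes e = ≤-trans (≤-reflexive (trans (cong (c * β⁰ u *_) e) (*-zeroʳ (c * β⁰ u)))) z≤n
      ... | no  n = ≤-trans (*-monoˡ-≤ (S u) (β-near' u (lab d j) (proj₁ (sf u n)) (lab< j lj)))
            (≤-reflexive (trans (*-assoc (suc c) (β (column u j)) (S u)) (cong (λ z → suc c * (β (column u j) * S z)) (sym (blk-col u (lab d j) (lab< j lj))))))
      pw : ∀ u → ω * (m * c) * (β⁰ u * S u) ≤ suc c * ω * sum< m (λ j → β (column u j) * S (blk (column u j)))
      pw u = ≤-trans (≤-reflexive (l3 ω m c (β⁰ u) (S u))) (≤-trans (*-monoʳ-≤ ω (≤-trans (≤-reflexive (sym (sum<-const m _)))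
          (≤-trans (sum<-mono m (term u)) (≤-reflexive (sum<-*ˡ m (suc c) _))))) (≤-reflexive (l4 ω (suc c) _)))
        where
        l3 : ∀ w m c b s → w * (m * c) * (b * s) ≡ w * (m * (c * b * s))
        l3 = solve-∀
        l4 : ∀ w c x → w * (c * x) ≡ c * w * x
        l4 = solve-∀

    window-bound : c * (c * (c * Wm)) ≤ suc c * (c * (suc c * ω * bT) + suc c * ω * bF)
    window-bound = ≤-trans (*-monoʳ-≤ c (*-monoʳ-≤ c Wm≤B)) (≤-trans (≤-reflexive (l1 c (suc c) B)) (*-monoʳ-≤ (suc c)
      (≤-trans (*-monoʳ-≤ c (*-monoʳ-≤ c B≤)) (≤-trans (≤-reflexive (l2 c (μ * YT) E)) (+-mono-≤
        (*-monoʳ-≤ c (cμ≤ FT (λ u n → proj₁ (𝟙d-≢0 (fed? u ×-dec inBox? u1 u3 u) n))))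
        (≤-trans (*-monoʳ-≤ c cE≤) (cμ≤ FF (λ u n → 𝟙d-≢0 (fed? u) n))))))))
      where
      l1 : ∀ c d b → c * (c * (d * b)) ≡ d * (c * (c * b))
      l1 = solve-∀
      l2 : ∀ c x e → c * (c * (x + e)) ≡ c * (c * x) + c * (c * e)
      l2 = solve-∀

    gsum-term : ∀ (F : Vec ℕ d → ℕ) u j → Below ρ u → j < m → F (column u j) ≤ gsum F
    gsum-term F u j b l = ≤-trans (term≤sum< (λ j → F (column u j)) l) (term≤sumV d ρ (λ u → sum< m (λ j → F (column u j))) u b)

    shift-1 : ∀ {n} lo hi (u : Vec ℕ n) → 1 ≤ lo → InBox lo hi u → shift 1 (shift-back 1 u) ≡ u
    shift-1 lo hi [] h _ = refl
    shift-1 lo hi (x ∷ u) h ((l , _) , bs) = cong₂ _∷_ (m+[n∸m]≡n (≤-trans h l)) (shift-1 lo hi u h bs)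

    below-back : ∀ {n} (u : Vec ℕ n) r → Below r u → Below r (shift-back 1 u)
    below-back [] r _ = tt
    below-back (x ∷ u) r (b , bs) = ≤-<-trans (m∸n≤m x 1) b , below-back u r bs

    -- A nonempty scheduled part yields a loaded block, hence a fed block one diagonal step below
    -- it; one near column of that block already pays for all unusual columns.
    unusual-bound : Wm ≢ 0 → c * (αm * BR) ≤ ω * bF
    unusual-bound Wm≢0 with sumV≢0 d ρ (λ u → β⁰ u * load u) B≢0
      where
      B≢0 : B ≢ 0
      B≢0 e = Wm≢0 (n≤0⇒n≡0 (*-cancelˡ-≤ c {{>-nonZero (≤-trans (s≤s z≤n) 2≤c)}} (≤-trans Wm≤B (≤-reflexive (trans (cong (suc c *_) e) (trans (*-zeroʳ (suc c)) (sym (*-zeroʳ c))))))))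
    ... | u , b , n = ≤-trans (unusual-small p (near-fed u' l bl fu)) (*-monoʳ-≤ ω
        (≤-trans (≤-reflexive (sym (trans (cong (β p *_) (𝟙d-yes (fed? (blk p)) (subst Fed (sym (blk-col u' l bl)) fu))) (*-identityʳ (β p)))))
          (gsum-term (λ p → β p * fF p) u' 0 (below-back u ρ b) m>0)))
      where
      m>0 : 0 < m
      m>0 = m^n>0 q d
      1≤G : 1 ≤ G
      1≤G = ≤-trans (*-mono-≤ {1} {2} {1} (s≤s z≤n) (*-mono-≤ {1} {c} {1} (≤-trans (s≤s z≤n) 2≤c) (≤-trans (s≤s z≤n) (m≤n+m 2 (3 * P))))) G-large
      ln : load u ≢ 0
      ln = *-≢0ʳ (β⁰ u) n
      u' l p : Vec ℕ d
      u' = shift-back 1 u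
      l = lab d 0
      p = col q u' l
      bl : Below q l
      bl = lab< 0 m>0
      fu : Fed u'
      fu = fed u' 0 1≤G (subst (λ w → load w ≢ 0) (sym (shift-1 u1 u3 u (≤-trans 1≤G G≤u1) (proj₁ (load-typical u ln)))) ln)

    R-only : Rm ≤ M
    R-only = antichain-mass (λ k p → does (R? k p)) (λ k p k' p' x y → R-true k p k' p' (does-sound (R? k p) x) (does-sound (R? k' p') y))

    A'-mass : Am ≤ M
    A'-mass = antichain-mass (λ k p → does (A'? k p)) (λ k p k' p' x y → A'-anti k p k' p' (does-sound (A'? k p) x) (does-sound (A'? k' p') y))

  grid-bound : mass (λ k p → 𝟙 (A k p)) ≤ M
  grid-bound with Wm ≟ 0
  -- With an empty scheduled part there may be no fed column to pay for the unusual ones, but then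
  -- the rank-timed antichain is everything.
  ... | yes e = ≤-trans (≤-reflexive (trans mass-split (trans (cong (Rm +_) e) (+-identityʳ Rm)))) R-only
  ... | no  n = ≤-trans (≤-reflexive mass-split) (≤-trans (combine 2≤c (ω * bT) (ω * bN) {Rm} {Wm} {Am}
      (trans (cong (ω *_) bF-split) (*-distribˡ-+ ω bT bN))
      (subst₂ _≤_ (cong (c * Rm +_) (*-assoc (c + 8) ω bF)) (cong₂ _+_ (cong (c * Am + ω * bT +_) (*-assoc c ω bN)) (*-assoc c αm BR)) rank-bound)
      (unusual-bound n)
      (≤-trans window-bound (≤-reflexive (cong (suc c *_) (cong₂ _+_ (cong (c *_) (*-assoc (suc c) ω bT)) (*-assoc (suc c) ω bF)))))) A'-mass)

-- Width of the clock order

subsets : ∀ n → List (Subset n)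
subsets zero    = [] ∷ []
subsets (suc n) = map (outside ∷_) (subsets n) ++L map (inside ∷_) (subsets n)

∈-subsets : ∀ {n} (x : Subset n) → x ∈ subsets n
∈-subsets []            = here refl
∈-subsets (outside ∷ x) = ∈-++⁺ˡ (∈-map⁺ (outside ∷_) (∈-subsets x))
∈-subsets {suc n} (inside ∷ x) = ∈-++⁺ʳ (map (outside ∷_) (subsets n)) (∈-map⁺ (inside ∷_) (∈-subsets x))

subsets-distinct : ∀ n → Distinct (subsets n)
subsets-distinct zero    = [] ∷ []
subsets-distinct (suc n) = AllPairs.++⁺ (map-distinct (outside ∷_) (subsets-distinct n) (λ x y _ _ n e → n (Vec.∷-injectiveʳ e)))
  (map-distinct (inside ∷_) (subsets-distinct n) (λ x y _ _ n e → n (Vec.∷-injectiveʳ e)))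
  (All.tabulate (λ p → All.tabulate (λ q e → absurd (∈-map⁻ _ p) (∈-map⁻ _ q) e)))
  where
  absurd : ∀ {x y : Subset (suc n)} → (∃ λ x' → x' ∈ subsets n × x ≡ outside ∷ x') → (∃ λ y' → y' ∈ subsets n × y ≡ inside ∷ y') → x ≡ y → Empty
  absurd (_ , _ , refl) (_ , _ , refl) ()

filter-map-length : ∀ {A B : Set} {Q : B → Set} (Q? : ∀ x → Dec (Q x)) (f : A → B) (xs : List A) →
  length (filter Q? (map f xs)) ≡ length (filter (Q? ∘ f) xs)
filter-map-length Q? f [] = refl
filter-map-length Q? f (x ∷ xs) with does (Q? (f x))
... | true  = cong suc (filter-map-length Q? f xs)
... | false = filter-map-length Q? f xs

count-subsets : ∀ n {Q : Subset n → Set} (Q? : ∀ x → Dec (Q x)) → length (filter Q? (subsets n)) ≡ sumS n (λ x → 𝟙d (Q? x))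
count-subsets zero Q? with does (Q? [])
... | true  = refl
... | false = refl
count-subsets (suc n) Q? = trans (cong length (filter-++ Q? (map (outside ∷_) (subsets n)) _))
  (trans (length-++ (filter Q? (map (outside ∷_) (subsets n))))
    (cong₂ _+_ (trans (filter-map-length Q? (outside ∷_) (subsets n)) (count-subsets n _))
               (trans (filter-map-length Q? (inside ∷_) (subsets n)) (count-subsets n _))))

count-injective : ∀ n {Q : Subset n → Set} (Q? : ∀ x → Dec (Q x)) (σ : Subset n → ℕ) lo r →
  (∀ x y → Q x → Q y → σ x ≡ σ y → x ≡ y) → (∀ x → Q x → lo ≤ σ x × σ x < lo + r) → sumS n (λ x → 𝟙d (Q? x)) ≤ r
count-injective n {Q} Q? σ lo r inj rng = ≤-trans (≤-reflexive (trans (sym (count-subsets n Q?)) (sym (length-map σ' xs))))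
  (distinct-bound r (map σ' xs) (map-distinct σ' (AllPairs.filter⁺ Q? (subsets-distinct n)) sep) bnd)
  where
  xs : List (Subset n)
  xs = filter Q? (subsets n)
  σ' : Subset n → ℕ
  σ' x = σ x ∸ lo
  Q-of : ∀ {x} → x ∈ xs → Q x
  Q-of p = proj₂ (∈-filter⁻ Q? {xs = subsets n} p)
  sep : ∀ x y → x ∈ xs → y ∈ xs → x ≢ y → σ' x ≢ σ' y
  sep x y p q n e = n (inj x y (Q-of p) (Q-of q) (trans (sym (m+[n∸m]≡n (proj₁ (rng x (Q-of p))))) (trans (cong (lo +_) e) (m+[n∸m]≡n (proj₁ (rng y (Q-of q)))))))
  bnd : ∀ z → z ∈ map σ' xs → z < r
  bnd z p with ∈-map⁻ σ' p
  ... | x , x∈ , refl = +-cancelˡ-< lo _ _ (subst (_< lo + r) (sym (m+[n∸m]≡n (proj₁ (rng x (Q-of x∈))))) (proj₂ (rng x (Q-of x∈))))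

_≟s_ : ∀ {n} (x y : Subset n) → Dec (x ≡ y)
_≟s_ = Vec.≡-dec Bool._≟_

⊆-card : ∀ {n} (x y : Subset n) → x ⊆s y → card x ≡ card y → x ≡ y
⊆-card [] [] _ _ = refl
⊆-card (inside  ∷ x) (inside  ∷ y) l e = cong (inside ∷_) (⊆-card x y (drop-∷-⊆ l) (suc-injective e))
⊆-card (outside ∷ x) (outside ∷ y) l e = cong (outside ∷_) (⊆-card x y (drop-∷-⊆ l) e)
⊆-card (outside ∷ x) (inside  ∷ y) l e = ⊥-elim (<⇒≢ (s≤s (p⊆q⇒∣p∣≤∣q∣ (drop-∷-⊆ l))) e)
⊆-card (inside  ∷ x) (outside ∷ y) l e with l vhere
... | ()

⊆-take : ∀ m {n} (x y : Subset (m + n)) → x ⊆s y → take m x ⊆s take m y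
⊆-take zero    x y l = λ ()
⊆-take (suc m) (outside ∷ x) (s ∷ y) l = out⊆ (⊆-take m x y (drop-∷-⊆ l))
⊆-take (suc m) (inside ∷ x) (inside ∷ y) l = s⊆s (⊆-take m x y (drop-∷-⊆ l))
⊆-take (suc m) (inside ∷ x) (outside ∷ y) l with l vhere
... | ()

⊆-drop : ∀ m {n} (x y : Subset (m + n)) → x ⊆s y → drop m x ⊆s drop m y
⊆-drop zero    x y l = l
⊆-drop (suc m) (s ∷ x) (t ∷ y) l = ⊆-drop m x y (drop-∷-⊆ l)

card-split : ∀ m {n} (x : Subset (m + n)) → card x ≡ card (take m x) + card (drop m x)
card-split zero    x = refl
card-split (suc m) (outside ∷ x) = card-split m x
card-split (suc m) (inside ∷ x)  = cong suc (card-split m x)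

cards-mono : ∀ d b (x y : Subset (d * b)) → x ⊆s y → cards d b x ≤v cards d b y
cards-mono zero    b x y l = tt
cards-mono (suc d) b x y l = p⊆q⇒∣p∣≤∣q∣ (⊆-take b x y l) , cards-mono d b (drop b x) (drop b y) (⊆-drop b x y l)

cards-total : ∀ d b (x : Subset (d * b)) → card x ≡ total (cards d b x)
cards-total zero    b [] = refl
cards-total (suc d) b x  = trans (card-split b x) (cong (card (take b x) +_) (cards-total d b (drop b x)))

below? : ∀ {d} r (p : Vec ℕ d) → Dec (Below r p)
below? r []      = yes tt
below? r (x ∷ p) = (x <? r) ×-dec below? r p

below-weaken : ∀ {d r s} (p : Vec ℕ d) → r ≤ s → Below r p → Below s p
below-weaken [] h _ = tt
below-weaken (x ∷ p) h (l , b) = <-≤-trans l h , below-weaken p h b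

weight-0 : ∀ {d} b (p : Vec ℕ d) → ¬ Below (suc b) p → weight b p ≡ 0
weight-0 b [] n = ⊥-elim (n tt)
weight-0 b (x ∷ p) n with x <? suc b
... | no  g = cong (_* weight b p) (binom-> b x (≰⇒> λ l → g (s≤s l)))
... | yes l = trans (cong (binom b x *_) (weight-0 b p (λ bp → n (l , bp)))) (*-zeroʳ (binom b x))

sum<-support : ∀ r s (f : ℕ → ℕ) → (∀ i → f i ≢ 0 → i < s) → sum< r f ≤ sum< s f
sum<-support r s f h = sum<-window r 0 s f (λ i n → z≤n , h i n)

sumV-support : ∀ d r s (f : Vec ℕ d → ℕ) → (∀ p → f p ≢ 0 → Below s p) → sumV d r f ≤ sumV d s f
sumV-support zero    r s f h = ≤-refl
sumV-support (suc d) r s f h = ≤-trans (sum<-mono r (λ i _ → sumV-support d r s (λ p → f (i ∷ p)) (λ p n → proj₂ (h (i ∷ p) n))))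
  (sum<-support r s _ (λ i n → proj₁ (h _ (proj₂ (proj₂ (sumV≢0 d s _ n))))))

*-≢0ˡ : ∀ a {b} → a * b ≢ 0 → a ≢ 0
*-≢0ˡ a h refl = h refl

module Types (sh : GridShape) (b : ℕ) (α≡ : GridShape.α sh ≡ binom (GridShape.a sh)) (β≡ : GridShape.β sh ≡ weight b) where
  open GridShape sh

  n : ℕ
  n = a + d * b

  level : Subset n → ℕ
  level x = card (take a x)

  place : Subset n → Vec ℕ d
  place x = cards d b (drop a x)

  time : Subset n → ℕ
  time x = τ (level x) (place x)

  rank-card : ∀ x → level x + total (place x) ≡ card x
  rank-card x = sym (trans (card-split a x) (cong (card (take a x) +_) (cards-total d b (drop a x))))

  count-types : ∀ (F : ℕ → Vec ℕ d → ℕ) → sumS n (λ x → F (level x) (place x)) ≡ sumV d (suc b) (λ p → β p * colsum F p)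
  count-types F = begin
    sumS n (λ x → F (level x) (place x)) ≡⟨ sumS-++ a (d * b) _ ⟩
    sumS a (λ y → sumS (d * b) (λ z → F (level (y ++ z)) (place (y ++ z))))
      ≡⟨ sumS-cong a (λ y → sumS-cong (d * b) (λ z → cong₂ (λ u v → F (card u) (cards d b v)) (take-++ y z) (drop-++ y z))) ⟩
    sumS a (λ y → sumS (d * b) (λ z → F (card y) (cards d b z))) ≡⟨ sumS-card a (λ k → sumS (d * b) (λ z → F k (cards d b z))) ⟩
    sum< (suc a) (λ k → binom a k * sumS (d * b) (λ z → F k (cards d b z)))
      ≡⟨ sum<-cong (suc a) (λ k _ → trans (sym (sumS-*ˡ (d * b) (binom a k) _)) (sumS-cards d b (λ p → binom a k * F k p))) ⟩
    sum< (suc a) (λ k → sumV d (suc b) (λ p → weight b p * (binom a k * F k p))) ≡⟨ sym (sumV-swap d (suc b) (suc a) _) ⟩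
    sumV d (suc b) (λ p → sum< (suc a) (λ k → weight b p * (binom a k * F k p)))
      ≡⟨ sumV-cong d (suc b) (λ p _ → trans (sum<-*ˡ (suc a) (weight b p) _) (cong₂ _*_ (cong (λ w → w p) (sym β≡)) (cong (λ w → sum< (suc a) (λ k → w k * F k p)) (sym α≡)))) ⟩
    sumV d (suc b) (λ p → β p * colsum F p) ∎
    where open ≡-Reasoning

  gsum-≡ : ∀ F → gsum F ≡ sumV d (ρ * q) F
  gsum-≡ F = sym (sum-columns d ρ F)

  mass≤ : ∀ F → mass F ≤ sumS n (λ x → F (level x) (place x))
  mass≤ F = ≤-trans (≤-reflexive (gsum-≡ _)) (≤-trans (sumV-support d (ρ * q) (suc b) _ supp) (≤-reflexive (sym (count-types F))))
    where
    supp : ∀ p → β p * colsum F p ≢ 0 → Below (suc b) p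
    supp p ne with below? (suc b) p
    ... | yes y = y
    ... | no  z = ⊥-elim (*-≢0ˡ (β p) ne (trans (cong (λ w → w p) β≡) (weight-0 b p z)))

  -- All sets whose type lies in an antichain of types form an antichain of the cube, and their
  -- number is at least the weighted sum. Grid columns beyond the range of cardinalities have weight
  -- 0.
  antichain-bound : ∀ (f : ℕ → Vec ℕ d → Bool) →
    (∀ k p k' p' → f k p ≡ true → f k' p' ≡ true → k ≤ k' → p ≤v p' → k ≡ k' × p ≡ p') → mass (λ k p → 𝟙 (f k p)) ≤ binom n ⌊ n /2⌋
  antichain-bound f anti = ≤-trans (mass≤ (λ k p → 𝟙 (f k p))) (sperner n (λ x → f (level x) (place x)) eq)
    where
    eq : ∀ x y → f (level x) (place x) ≡ true → f (level y) (place y) ≡ true → x ⊆s y → x ≡ y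
    eq x y fx fy l with anti _ _ _ _ fx fy (p⊆q⇒∣p∣≤∣q∣ (⊆-take a x y l)) (cards-mono d b (drop a x) (drop a y) (⊆-drop a x y l))
    ... | e₁ , e₂ = ⊆-card x y l (trans (sym (rank-card x)) (trans (cong₂ (λ k p → k + total p) e₁ e₂) (rank-card y)))

module Width (gr : Grid) (b : ℕ) (b< : suc b ≤ Grid.ρ gr * Grid.q gr)
  (α≡ : Grid.α gr ≡ binom (Grid.a gr)) (β≡ : Grid.β gr ≡ weight b) where
  open Grid gr
  open Types shape b α≡ β≡

  -- The family is pulled back along a product of flags. Its member at (k , p) has type (k , p), so
  -- clock and inclusions carry over to the grid.
  width : ∀ (A : Subset n → Bool) → (∀ x y → A x ≡ true → A y ≡ true → x ⊆s y → ¬ (time x < time y)) → sumS n (𝟙 ∘ A) ≤ M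
  width A anti with flag-product a (𝟙 ∘ A) (λ g → sumV d (suc b) (λ p → weight b p * g p)) (Flags d b) Flags.set (flags-exist d b)
  ... | c , e , h = ≤-trans h (≤-trans (≤-reflexive (sumV-cong d (suc b) eq)) (≤-trans (sumV-≤ d (λ p → β p * colsum (λ k p → 𝟙 (Ag k p)) p) b<) (≤-trans (≤-reflexive (sym (gsum-≡ (λ p → β p * colsum (λ k p → 𝟙 (Ag k p)) p))))
      (GridBound.grid-bound gr Ag Ag-range Ag-anti))))
    where
    at : ℕ → Vec ℕ d → Subset n
    at k p = Flag.set c k ++ Flags.set e p
    Ag? : ∀ k p → Dec ((k ≤ a × Below (suc b) p) × A (at k p) ≡ true)
    Ag? k p = ((k ≤? a) ×-dec below? (suc b) p) ×-dec (A (at k p) Bool.≟ true)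
    Ag : ℕ → Vec ℕ d → Bool
    Ag k p = does (Ag? k p)
    Ag-range : ∀ k p → Ag k p ≡ true → k ≤ a × Below (ρ * q) p
    Ag-range k p x with does-sound (Ag? k p) x
    ... | (l , bl) , _ = l , below-weaken p b< bl
    time-at : ∀ k p → k ≤ a → Below (suc b) p → time (at k p) ≡ τ k p
    time-at k p l bl = cong₂ τ (trans (cong card (take-++ (Flag.set c k) _)) (Flag.size c k l)) (trans (cong (cards d b) (drop-++ (Flag.set c k) _)) (Flags.size e p bl))
    Ag-anti : ∀ k p k' p' → Ag k p ≡ true → Ag k' p' ≡ true → k ≤ k' → p ≤v p' → ¬ (τ k p < τ k' p')
    Ag-anti k p k' p' x y l l' s with does-sound (Ag? k p) x | does-sound (Ag? k' p') y
    ... | (kl , bl) , ax | (kl' , bl') , ay = anti (at k p) (at k' p') ax ay (++-⊆ (Flag.set c k) (Flag.set c k') (Flag.mono c l) (Flags.mono e l'))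
      (subst₂ _<_ (sym (time-at k p kl bl)) (sym (time-at k' p' kl' bl')) s)
    same : ∀ k p → k < suc a → Below (suc b) p → 𝟙 (A (at k p)) ≡ 𝟙 (Ag k p)
    same k p l bl = cong 𝟙 (sym (cong₂ _∧_ (does-true ((k ≤? a) ×-dec below? (suc b) p) (s≤s⁻¹ l , bl)) (unfold (A (at k p)))))
      where
      unfold : ∀ x → does (x Bool.≟ true) ≡ x
      unfold true  = refl
      unfold false = refl
    eq : ∀ p → Below (suc b) p → weight b p * sum< (suc a) (λ k → binom a k * 𝟙 (A (at k p))) ≡ β p * colsum (λ k p → 𝟙 (Ag k p)) p
    eq p bl = cong₂ _*_ (cong (λ w → w p) (sym β≡)) (sum<-cong (suc a) (λ k l → cong₂ _*_ (cong (λ w → w k) (sym α≡)) (same k p l bl)))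

term≤sumS : ∀ n (f : Subset n → ℕ) x → f x ≤ sumS n f
term≤sumS zero    f []            = ≤-refl
term≤sumS (suc n) f (outside ∷ x) = ≤-trans (term≤sumS n _ x) (m≤m+n _ _)
term≤sumS (suc n) f (inside ∷ x)  = ≤-trans (term≤sumS n (λ x → f (inside ∷ x)) x) (m≤n+m _ _)

length≤count : ∀ n (xs : List (Subset n)) → Distinct xs → length xs ≤ sumS n (λ y → 𝟙d (any? (y ≟s_) xs))
length≤count n [] _ = z≤n
length≤count n (x ∷ xs) (p ∷ ps) = ≤-trans (+-mono-≤ one (length≤count n xs ps)) (≤-trans (≤-reflexive (sym (sumS-+ n _ _))) (sumS-mono n pw))
  where
  one : 1 ≤ sumS n (λ y → 𝟙d (y ≟s x))
  one = ≤-trans (≤-reflexive (sym (𝟙d-yes (x ≟s x) refl))) (term≤sumS n (λ y → 𝟙d (y ≟s x)) x)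
  pw : ∀ y → 𝟙d (y ≟s x) + 𝟙d (any? (y ≟s_) xs) ≤ 𝟙d (any? (y ≟s_) (x ∷ xs))
  pw y = by (y ≟s x) (any? (y ≟s_) xs) (any? (y ≟s_) (x ∷ xs)) (λ { refl q → All.lookup p q refl }) here there
    where
    by : ∀ {P Q R : Set} (d : Dec P) (e : Dec Q) (f : Dec R) → (P → Q → Empty) → (P → R) → (Q → R) → 𝟙d d + 𝟙d e ≤ 𝟙d f
    by (yes u) (yes v) f h g k = ⊥-elim (h u v)
    by (yes u) (no v)  f h g k = ≤-reflexive (sym (𝟙d-yes f (g u)))
    by (no u)  e       f h g k = 𝟙d-mono e f k

Earlier : ∀ {n} → (Subset n → ℕ) → Subset n → Subset n → Set
Earlier τ x y = x ⊆s y × τ x < τ y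

record TimedColouring (n M : ℕ) (τ : Subset n → ℕ) : Set where
  field
    colour : Subset n → ℕ
    bound  : ∀ x → colour x < M
    chain  : ∀ x y → colour x ≡ colour y → x ≡ y ⊎ Earlier τ x y ⊎ Earlier τ y x

timed-colouring : ∀ n M (τ : Subset n → ℕ) →
  (∀ (A : Subset n → Bool) → (∀ x y → A x ≡ true → A y ≡ true → x ⊆s y → ¬ (τ x < τ y)) → sumS n (𝟙 ∘ A) ≤ M) → TimedColouring n M τ
timed-colouring n M τ w = record { colour = colour ; bound = λ x → bound x (∈-subsets x) ; chain = λ x y → chain x y (∈-subsets x) (∈-subsets y) }
  where
  open Dilworth _≟s_ (Earlier {n} τ) (λ x y → (x ⊆? y) ×-dec (τ x <? τ y))
    (λ p q → ⊆s-trans (proj₁ p) (proj₁ q) , <-trans (proj₂ p) (proj₂ q)) (λ p → <-irrefl refl (proj₂ p))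
  small : ∀ k → AntichainOf (subsets n) k → k ≤ M
  small k a = ≤-trans (≤-reflexive (sym size)) (≤-trans (length≤count n elems (AllPairs.map proj₁ anti)) (w (λ y → does (any? (y ≟s_) elems)) anti'))
    where
    open AntichainOf a
    anti' : ∀ x y → does (any? (x ≟s_) elems) ≡ true → does (any? (y ≟s_) elems) ≡ true → x ⊆s y → ¬ (τ x < τ y)
    anti' x y p q l t = antichain-⊀ anti (does-sound (any? (x ≟s_) elems) p) (does-sound (any? (y ≟s_) elems) q) (l , t)
  open Colouring (dilworth (subsets n) M small)

-- Gluing and counting

binom-C : ∀ n k → binom n k ≡ choose n k
binom-C n zero = sym (trans (nCk≡nC[n∸k] {0} {n} z≤n) (nCn≡1 n))
binom-C zero (suc k) = sym (k>n⇒nCk≡0 {0} {suc k} (s≤s z≤n))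
binom-C (suc n) (suc k) = trans (cong₂ _+_ (binom-C n k) (binom-C n (suc k))) (nCk+nC[k+1]≡[n+1]C[k+1] n k)

⊆∧≢⇒⊂ : ∀ {n} (x y : Subset n) → x ⊆s y → x ≢ y → x ⊂ y
⊆∧≢⇒⊂ [] [] _ ne = ⊥-elim (ne refl)
⊆∧≢⇒⊂ (outside ∷ x) (outside ∷ y) l ne = out⊂ (⊆∧≢⇒⊂ x y (drop-∷-⊆ l) (λ e → ne (cong (outside ∷_) e)))
⊆∧≢⇒⊂ (inside ∷ x) (inside ∷ y) l ne = s⊂s (⊆∧≢⇒⊂ x y (drop-∷-⊆ l) (λ e → ne (cong (inside ∷_) e)))
⊆∧≢⇒⊂ (outside ∷ x) (inside ∷ y) l ne = out⊂in (drop-∷-⊆ l)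
⊆∧≢⇒⊂ (inside ∷ x) (outside ∷ y) l ne with l vhere
... | ()

∁-injective : ∀ {n} {x y : Subset n} → ∁ x ≡ ∁ y → x ≡ y
∁-injective e = ⊆s-antisym (∁p⊆∁q⇒p⊇q (⊆s-reflexive (sym e))) (∁p⊆∁q⇒p⊇q (⊆s-reflexive e))

-- The chains of a timed colouring above the middle level are glued, along the middle level,
-- to the complements of its chains.
module Glue (n : ℕ) (τ : Subset n → ℕ) (C : TimedColouring n (middle n) τ) where
  open TimedColouring C

  M h : ℕ
  M = middle n
  h = ⌊ n /2⌋

  colourᶜ : Subset n → ℕ
  colourᶜ x = colour (∁ x)

  card-∁ : ∀ x → card (∁ x) + card x ≡ n
  card-∁ x = trans (cong (_+ card x) (∣∁p∣≡n∸∣p∣ x)) (m∸n+n≡m (∣p∣≤n x))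

  level-injective : ∀ x y → card x ≡ h → card y ≡ h → colour x ≡ colour y → x ≡ y
  level-injective x y p q e with chain x y e
  ... | inj₁ e'               = e'
  ... | inj₂ (inj₁ (l , _)) = ⊆-card x y l (trans p (sym q))
  ... | inj₂ (inj₂ (l , _)) = sym (⊆-card y x l (trans q (sym p)))

  level-injectiveᶜ : ∀ x y → card x ≡ h → card y ≡ h → colourᶜ x ≡ colourᶜ y → x ≡ y
  level-injectiveᶜ x y p q e with chain (∁ x) (∁ y) e
  ... | inj₁ e'               = ∁-injective e'
  ... | inj₂ (inj₁ (l , _)) = sym (⊆-card y x (∁p⊆∁q⇒p⊇q l) (trans q (sym p)))
  ... | inj₂ (inj₂ (l , _)) = ⊆-card x y (∁p⊆∁q⇒p⊇q l) (trans p (sym q))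

  -- The middle level has M sets, and g maps it injectively into the numbers below M.
  level-onto : (g : Subset n → ℕ) → (∀ x → g x < M) → (∀ x y → card x ≡ h → card y ≡ h → g x ≡ g y → x ≡ y) →
    ∀ i → i < M → ∃ λ x → card x ≡ h × g x ≡ i
  level-onto g g< inj i i<M with ∈-map⁻ g (distinct-onto M (map g xs)
      (map-distinct g (AllPairs.filter⁺ mid? (subsets-distinct n)) (λ x y p q ne e → ne (inj x y (mid p) (mid q) e)))
      (λ z p → let (x , _ , e) = ∈-map⁻ g p in subst (_< M) (sym e) (g< x)) size i i<M)
    where
    mid? : ∀ x → Dec (card x ≡ h)
    mid? x = card x ≟ h
    xs : List (Subset n)
    xs = filter mid? (subsets n)
    mid : ∀ {x} → x ∈ xs → card x ≡ h
    mid p = proj₂ (∈-filter⁻ mid? {xs = subsets n} p)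
    size : M ≤ length (map g xs)
    size = ≤-trans (≤-reflexive (trans (sym (binom-C n h)) (trans (sym (*-identityʳ _)) (cong (binom n h *_) (sym (𝟙d-yes (h ≟ h) refl))))))
      (≤-trans (term≤sum< (λ k → binom n k * 𝟙d (k ≟ h)) {h} (s≤s (⌊n/2⌋≤n n)))
        (≤-reflexive (sym (trans (length-map g xs) (trans (count-subsets n mid?) (sumS-card n (λ k → 𝟙d (k ≟ h))))))))
  ... | x , x∈ , e = x , proj₂ (∈-filter⁻ (λ x → card x ≟ h) {xs = subsets n} x∈) , sym e

  -- The middle set at which the complemented chain through x meets the middle level. Its own colour
  -- names the upper chain to which that complemented chain is attached.
  anchor : ∀ x → ∃ λ e → card e ≡ h × colourᶜ e ≡ colourᶜ x
  anchor x = level-onto colourᶜ (λ x → bound (∁ x)) level-injectiveᶜ (colourᶜ x) (bound (∁ x))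

  Upper : Subset n → Set
  Upper x = h ≤ card x

  fullColour : Subset n → ℕ
  fullColour x with h ≤? card x
  ... | yes _ = colour x
  ... | no  _ = colour (proj₁ (anchor x))

  upper-colour : ∀ x → Upper x → fullColour x ≡ colour x
  upper-colour x u with h ≤? card x
  ... | yes _ = refl
  ... | no  n = ⊥-elim (n u)

  lower-colour : ∀ x → ¬ Upper x → fullColour x ≡ colour (proj₁ (anchor x))
  lower-colour x n with h ≤? card x
  ... | yes u = ⊥-elim (n u)
  ... | no  _ = refl

  fullColour< : ∀ x → fullColour x < M
  fullColour< x with h ≤? card x
  ... | yes _ = bound x
  ... | no  _ = bound _

  lower-same : ∀ x y → ¬ Upper x → ¬ Upper y → fullColour x ≡ fullColour y → colourᶜ x ≡ colourᶜ y
  lower-same x y nx ny e = trans (sym (proj₂ (proj₂ (anchor x)))) (trans (cong colourᶜ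
    (level-injective _ _ (proj₁ (proj₂ (anchor x))) (proj₁ (proj₂ (anchor y))) (trans (sym (lower-colour x nx)) (trans e (lower-colour y ny)))))
    (proj₂ (proj₂ (anchor y))))

  -- The inclusion passes through the anchor: x ⊆ e within a complemented chain and e ⊆ y within an
  -- upper one.
  lower⊂upper : ∀ x y → ¬ Upper x → Upper y → fullColour x ≡ fullColour y → x ⊂ y
  lower⊂upper x y nx uy eq with anchor x in ax
  ... | e , he , ce = ⊆∧≢⇒⊂ x y (⊆s-trans x⊆e e⊆y) (λ { refl → nx uy })
    where
    x⊆e : x ⊆s e
    x⊆e with chain (∁ x) (∁ e) (sym ce)
    ... | inj₁ p               = ⊆s-reflexive (∁-injective p)
    ... | inj₂ (inj₁ (l , _)) = ⊥-elim (nx (≤-trans (≤-reflexive (sym he)) (p⊆q⇒∣p∣≤∣q∣ (∁p⊆∁q⇒p⊇q l))))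
    ... | inj₂ (inj₂ (l , _)) = ∁p⊆∁q⇒p⊇q l
    e⊆y : e ⊆s y
    e⊆y with chain e y (trans (sym (trans (lower-colour x nx) (cong (colour ∘ proj₁) ax))) (trans eq (upper-colour y uy)))
    ... | inj₁ p               = ⊆s-reflexive p
    ... | inj₂ (inj₁ (l , _)) = l
    ... | inj₂ (inj₂ (l , _)) = ⊆s-reflexive (sym (⊆-card y e l (≤-antisym (p⊆q⇒∣p∣≤∣q∣ l) (≤-trans (≤-reflexive he) uy))))

  comparable : ∀ x y → x ≢ y → fullColour x ≡ fullColour y → x ⊂ y ⊎ y ⊂ x
  comparable x y ne e with h ≤? card x | h ≤? card y
  ... | no nx | yes uy = inj₁ (lower⊂upper x y nx uy (trans (lower-colour x nx) (trans e (sym (upper-colour y uy)))))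
  ... | yes ux | no ny = inj₂ (lower⊂upper y x ny ux (trans (lower-colour y ny) (trans (sym e) (sym (upper-colour x ux)))))
  ... | yes ux | yes uy with chain x y e
  ...   | inj₁ p               = ⊥-elim (ne p)
  ...   | inj₂ (inj₁ (l , _)) = inj₁ (⊆∧≢⇒⊂ x y l ne)
  ...   | inj₂ (inj₂ (l , _)) = inj₂ (⊆∧≢⇒⊂ y x l (ne ∘ sym))
  comparable x y ne e | no nx | no ny with chain (∁ x) (∁ y) (lower-same x y nx ny (trans (lower-colour x nx) (trans e (sym (lower-colour y ny)))))
  ...   | inj₁ p               = ⊥-elim (ne (∁-injective p))
  ...   | inj₂ (inj₁ (l , _)) = inj₂ (⊆∧≢⇒⊂ y x (∁p⊆∁q⇒p⊇q l) (ne ∘ sym))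
  ...   | inj₂ (inj₂ (l , _)) = inj₁ (⊆∧≢⇒⊂ x y (∁p⊆∁q⇒p⊇q l) ne)

  class : ℕ → List (Subset n)
  class i = filter (λ x → fullColour x ≟ i) (subsets n)

  class-chain : ∀ i → IsChain (class i)
  class-chain i = go (subsets n) (subsets-distinct n)
    where
    go : ∀ xs → Distinct xs → IsChain (filter (λ x → fullColour x ≟ i) xs)
    go xs d = relate (filter (λ x → fullColour x ≟ i) xs) (AllPairs.filter⁺ (λ x → fullColour x ≟ i) d)
      (λ p → proj₂ (∈-filter⁻ (λ x → fullColour x ≟ i) {xs = xs} p))
      where
      relate : ∀ ys → Distinct ys → (∀ {y} → y ∈ ys → fullColour y ≡ i) → IsChain ys
      relate [] [] _ = []
      relate (y ∷ ys) (p ∷ ps) k = All.tabulate (λ {z} q → comparable y z (All.lookup p q) (trans (k (here refl)) (sym (k (there q))))) ∷ relate ys ps (k ∘ there)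

  partition : ChainPartition n M
  partition = record
    { chain    = λ i → class (toℕ i)
    ; isChain  = λ i → class-chain (toℕ i)
    ; nonempty = λ i → nonempty (toℕ i) (toℕ<n i)
    ; covers   = λ x → fromℕ< (fullColour< x) , ∈-filter⁺ (λ y → fullColour y ≟ toℕ (fromℕ< (fullColour< x))) (∈-subsets x) (sym (toℕ-fromℕ< (fullColour< x)))
    ; disjoint = λ x i j p q → toℕ-injective (trans (sym (proj₂ (∈-filter⁻ (λ y → fullColour y ≟ toℕ i) {xs = subsets n} p)))
                   (proj₂ (∈-filter⁻ (λ y → fullColour y ≟ toℕ j) {xs = subsets n} q)))
    }
    where
    positive : ∀ {x : Subset n} {xs} → x ∈ xs → 1 ≤ length xs
    positive (here _)  = s≤s z≤n
    positive (there _) = s≤s z≤n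
    nonempty : ∀ i → i < M → 1 ≤ length (class i)
    nonempty i l with level-onto colour bound level-injective i l
    ... | x , cx , e = positive (∈-filter⁺ (λ y → fullColour y ≟ i) (∈-subsets x) (trans (upper-colour x (≤-reflexive (sym cx))) e))

  -- Only upper bounds on the number of wide sets per chain are available; chains falling short of
  -- them are few because these shortfalls add up to at most 2 δ₁.
  module Sizes (Wide Excess : Subset n → Set) (wide? : ∀ x → Dec (Wide x)) (excess? : ∀ x → Dec (Excess x))
    (T0 T D θ δ₁ δ₂ : ℕ)
    (wide-time : ∀ x → Wide x → T0 ≤ τ x × τ x < T0 + T)
    (wide-high : ∀ x → Wide x → n ∸ h < card x)
    (short-time : ∀ x → ¬ Wide x → ¬ Excess x → h ≤ card x → h ≤ τ x × τ x < h + D)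
    (supply : T * M ≤ sumS n (λ x → 𝟙d (wide? x)) + δ₁)
    (excess-few : sumS n (λ x → 𝟙d (excess? x)) ≤ δ₂) where

    h≤n∸h : h ≤ n ∸ h
    h≤n∸h = ≤-trans (≤-reflexive (sym (m+n∸m≡n h h))) (∸-monoˡ-≤ h (half-lower n))

    Short : Subset n → Set
    Short x = ¬ Wide x × ¬ Excess x

    short? : ∀ x → Dec (Short x)
    short? x = ¬? (wide? x) ×-dec ¬? (excess? x)

    -- The lower part of a glued chain takes its clock from the complements, where it is again
    -- injective.
    side : Subset n → Subset n
    side x with h ≤? card x
    ... | yes _ = x
    ... | no  _ = ∁ x

    side-upper : ∀ x → Upper x → side x ≡ x
    side-upper x u with h ≤? card x
    ... | yes _ = refl
    ... | no  n = ⊥-elim (n u)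

    side-lower : ∀ x → ¬ Upper x → side x ≡ ∁ x
    side-lower x n with h ≤? card x
    ... | yes u = ⊥-elim (n u)
    ... | no  _ = refl

    lower-card : ∀ x → ¬ Upper x → n ∸ h < card (∁ x)
    lower-card x nu = +-cancelʳ-< (card x) _ _ (<-≤-trans (+-monoʳ-< (n ∸ h) (≰⇒> nu)) (≤-reflexive (trans (m∸n+n≡m (⌊n/2⌋≤n n)) (sym (card-∁ x)))))

    side-card : ∀ x → h ≤ card (side x)
    side-card x with h ≤? card x
    ... | yes u = u
    ... | no  nu = ≤-trans h≤n∸h (<⇒≤ (lower-card x nu))

    module _ {Q : Subset n → Set} (Q? : ∀ x → Dec (Q x)) where
      weigh : Subset n → ℕ
      weigh x = 𝟙d (Q? (side x))

      amount : ℕ → ℕ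
      amount i = sumS n (λ x → 𝟙d (fullColour x ≟ i) * weigh x)

      -- Each half of a glued chain maps injectively into r times, whence the factor 2.
      amount-bound : ∀ lo r → (∀ x → Q x → h ≤ card x → lo ≤ τ x × τ x < lo + r) → ∀ i → amount i ≤ r + r
      amount-bound lo r rng i = ≤-trans (sumS-mono n pw) (≤-trans (≤-reflexive (sumS-+ n _ _)) (+-mono-≤
          (count-injective n U? (τ ∘ side) lo r injU (λ x q → rng (side x) (proj₂ (proj₂ q)) (side-card x)))
          (count-injective n D? (τ ∘ side) lo r injD (λ x q → rng (side x) (proj₂ (proj₂ q)) (side-card x)))))
        where
        U? : ∀ x → Dec (fullColour x ≡ i × Upper x × Q (side x))
        U? x = (fullColour x ≟ i) ×-dec (h ≤? card x) ×-dec Q? (side x)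
        D? : ∀ x → Dec (fullColour x ≡ i × ¬ Upper x × Q (side x))
        D? x = (fullColour x ≟ i) ×-dec ¬? (h ≤? card x) ×-dec Q? (side x)
        bool : ∀ a b c → 𝟙 a * 𝟙 c ≤ 𝟙 (a ∧ b ∧ c) + 𝟙 (a ∧ not b ∧ c)
        bool false b     c     = z≤n
        bool true  true  true  = ≤-refl
        bool true  true  false = ≤-refl
        bool true  false true  = ≤-refl
        bool true  false false = ≤-refl
        pw : ∀ x → 𝟙d (fullColour x ≟ i) * weigh x ≤ 𝟙d (U? x) + 𝟙d (D? x)
        pw x = bool (does (fullColour x ≟ i)) (does (h ≤? card x)) (does (Q? (side x)))
        injU : ∀ x y → fullColour x ≡ i × Upper x × Q (side x) → fullColour y ≡ i × Upper y × Q (side y) → τ (side x) ≡ τ (side y) → x ≡ y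
        injU x y (e , u , _) (e' , u' , _) t with chain x y (trans (sym (upper-colour x u)) (trans e (trans (sym e') (upper-colour y u'))))
        ... | inj₁ p               = p
        ... | inj₂ (inj₁ (_ , l)) = ⊥-elim (<⇒≢ l (subst₂ (λ a b → τ a ≡ τ b) (side-upper x u) (side-upper y u') t))
        ... | inj₂ (inj₂ (_ , l)) = ⊥-elim (<⇒≢ l (sym (subst₂ (λ a b → τ a ≡ τ b) (side-upper x u) (side-upper y u') t)))
        injD : ∀ x y → fullColour x ≡ i × ¬ Upper x × Q (side x) → fullColour y ≡ i × ¬ Upper y × Q (side y) → τ (side x) ≡ τ (side y) → x ≡ y
        injD x y (e , u , _) (e' , u' , _) t with chain (∁ x) (∁ y) (lower-same x y u u' (trans e (sym e')))
        ... | inj₁ p               = ∁-injective p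
        ... | inj₂ (inj₁ (_ , l)) = ⊥-elim (<⇒≢ l (subst₂ (λ a b → τ a ≡ τ b) (side-lower x u) (side-lower y u') t))
        ... | inj₂ (inj₂ (_ , l)) = ⊥-elim (<⇒≢ l (sym (subst₂ (λ a b → τ a ≡ τ b) (side-lower x u) (side-lower y u') t)))

      amount-total : sum< M amount ≡ sumS n weigh
      amount-total = trans (sym (sumS-swap n M _)) (sumS-cong n (λ x → trans (sum<-cong M (λ i _ → *-comm (𝟙d (fullColour x ≟ i)) (weigh x)))
        (trans (sum<-*ˡ M (weigh x) _) (trans (cong (weigh x *_) (one x)) (*-identityʳ (weigh x))))))
        where
        one : ∀ x → sum< M (λ i → 𝟙d (fullColour x ≟ i)) ≡ 1
        one x = ≤-antisym (sum<-single M _ 1 (λ i _ → 𝟙≤1 _) (λ i j l _ a b → <⇒≢ l (trans (sym (𝟙d-≢0 (fullColour x ≟ i) a)) (𝟙d-≢0 (fullColour x ≟ j) b))))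
          (≤-trans (≤-reflexive (sym (𝟙d-yes (fullColour x ≟ fullColour x) refl))) (term≤sum< (λ i → 𝟙d (fullColour x ≟ i)) (fullColour< x)))

      weigh-≤ : sumS n weigh ≤ 2 * sumS n (λ x → 𝟙d (Q? x))
      weigh-≤ = ≤-trans (sumS-mono n pw) (≤-reflexive (trans (sumS-+ n _ _) (cong (sumS n (λ x → 𝟙d (Q? x)) +_) (trans (sumS-∁ n (λ x → 𝟙d (Q? x))) (sym (+-identityʳ _))))))
        where
        pw : ∀ x → weigh x ≤ 𝟙d (Q? x) + 𝟙d (Q? (∁ x))
        pw x with h ≤? card x
        ... | yes _ = m≤m+n _ _
        ... | no  _ = m≤n+m _ _

    -- Wide sets have more than n ∸ h elements, so a set and its complement are never both wide, and
    -- wide sets and their complements are counted separately.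
    2W≤ : 2 * sumS n (λ x → 𝟙d (wide? x)) ≤ sumS n (weigh wide?)
    2W≤ = ≤-trans (≤-reflexive (trans (cong (sumS n (λ x → 𝟙d (wide? x)) +_) (trans (+-identityʳ _) (sym (sumS-∁ n (λ x → 𝟙d (wide? x)))))) (sym (sumS-+ n _ _)))) (sumS-mono n pw)
      where
      pw : ∀ x → 𝟙d (wide? x) + 𝟙d (wide? (∁ x)) ≤ weigh wide? x
      pw x with h ≤? card x
      ... | yes u = ≤-trans (≤-reflexive (cong (𝟙d (wide? x) +_) (𝟙d-no (wide? (∁ x)) (λ w → <⇒≱ (wide-high (∁ x) w)
              (+-cancelʳ-≤ (card x) _ _ (≤-trans (≤-reflexive (card-∁ x)) (≤-trans (≤-reflexive (sym (m∸n+n≡m (⌊n/2⌋≤n n)))) (+-monoʳ-≤ (n ∸ h) u)))))))) (≤-reflexive (+-identityʳ _))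
      ... | no nu = ≤-trans (≤-reflexive (cong (_+ 𝟙d (wide? (∁ x))) (𝟙d-no (wide? x) (λ w → nu (≤-trans h≤n∸h (<⇒≤ (wide-high x w))))))) ≤-refl

    wide excess short : ℕ → ℕ
    wide   = amount wide?
    excess = amount excess?
    short  = amount short?

    wide≤ : ∀ i → wide i ≤ 2 * T
    wide≤ i = ≤-trans (amount-bound wide? T0 T (λ x w _ → wide-time x w) i) (≤-reflexive (cong (T +_) (sym (+-identityʳ T))))

    short≤ : ∀ i → short i ≤ 2 * D
    short≤ i = ≤-trans (amount-bound short? h D (λ x s u → short-time x (proj₁ s) (proj₂ s) u) i) (≤-reflexive (cong (D +_) (sym (+-identityʳ D))))

    size : ℕ → ℕ
    size i = length (class i)

    size-≡ : ∀ i → size i ≡ sumS n (λ x → 𝟙d (fullColour x ≟ i))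
    size-≡ i = count-subsets n (λ x → fullColour x ≟ i)

    wide≤size : ∀ i → wide i ≤ size i
    wide≤size i = ≤-trans (sumS-mono n (λ x → *-𝟙≤ (𝟙d (fullColour x ≟ i)) _)) (≤-reflexive (sym (size-≡ i)))

    size≤ : ∀ i → size i ≤ wide i + excess i + short i
    size≤ i = ≤-trans (≤-reflexive (size-≡ i)) (≤-trans (sumS-mono n pw) (≤-reflexive (trans (sumS-+ n _ _) (cong (_+ short i) (sumS-+ n _ _)))))
      where
      bool : ∀ c a b → 𝟙 c ≤ 𝟙 c * 𝟙 a + 𝟙 c * 𝟙 b + 𝟙 c * 𝟙 (not a ∧ not b)
      bool false a     b     = z≤n
      bool true  true  b     = s≤s z≤n
      bool true  false true  = s≤s z≤n
      bool true  false false = s≤s z≤n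
      pw : ∀ x → 𝟙d (fullColour x ≟ i) ≤ 𝟙d (fullColour x ≟ i) * weigh wide? x + 𝟙d (fullColour x ≟ i) * weigh excess? x + 𝟙d (fullColour x ≟ i) * weigh short? x
      pw x = bool (does (fullColour x ≟ i)) (does (wide? (side x))) (does (excess? (side x)))

    -- No chain has more than 2 T wide members, so the shortfall is never negative and its sum over
    -- all chains is controlled by `supply`. With the excess added, Markov's inequality handles both
    -- defects at once.
    potential : ℕ → ℕ
    potential i = (2 * T ∸ wide i) + excess i

    sum-wide : sum< M wide ≡ sumS n (weigh wide?)
    sum-wide = amount-total wide?

    2TM : M * (2 * T) ≤ sumS n (weigh wide?) + 2 * δ₁
    2TM = ≤-trans (≤-reflexive (lem M T)) (≤-trans (*-monoʳ-≤ 2 supply) (≤-trans (≤-reflexive (*-distribˡ-+ 2 (sumS n (λ x → 𝟙d (wide? x))) δ₁)) (+-monoˡ-≤ (2 * δ₁) 2W≤)))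
      where
      lem : ∀ m t → m * (2 * t) ≡ 2 * (t * m)
      lem = solve-∀

    sum-excess : sum< M excess ≤ 2 * δ₂
    sum-excess = ≤-trans (≤-reflexive (amount-total excess?)) (≤-trans (weigh-≤ excess?) (*-monoʳ-≤ 2 excess-few))

    sum-potential : sum< M potential ≤ 2 * δ₁ + 2 * δ₂
    sum-potential = ≤-trans (≤-reflexive (sum<-+ M _ _)) (+-mono-≤ (+-cancelˡ-≤ (sum< M wide) _ _ (begin
      sum< M wide + sum< M (λ i → 2 * T ∸ wide i) ≡⟨ sym (sum<-+ M _ _) ⟩
      sum< M (λ i → wide i + (2 * T ∸ wide i)) ≡⟨ sum<-cong M (λ i _ → m+[n∸m]≡n (wide≤ i)) ⟩
      sum< M (λ _ → 2 * T) ≡⟨ sum<-const M (2 * T) ⟩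
      M * (2 * T) ≤⟨ 2TM ⟩
      sumS n (weigh wide?) + 2 * δ₁ ≡⟨ cong (_+ 2 * δ₁) (sym sum-wide) ⟩
      sum< M wide + 2 * δ₁ ∎)) sum-excess)
      where open ≤-Reasoning

    bad? : ∀ (i : Fin M) → Dec (θ < potential (toℕ i))
    bad? i = θ <? potential (toℕ i)

    bad : List (Fin M)
    bad = filter bad? (allFin M)

    bad-few : length bad * θ ≤ 2 * δ₁ + 2 * δ₂
    bad-few = ≤-trans (count M id potential (λ i → pw i (bad? i))) sum-potential
      where
      pw : ∀ i (d : Dec (θ < potential (toℕ i))) → 𝟙d d * θ ≤ potential (toℕ i)
      pw i (yes p) = ≤-trans (≤-reflexive (+-identityʳ θ)) (<⇒≤ p)
      pw i (no _)  = z≤n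
      count : ∀ k (f : Fin k → Fin M) (g : ℕ → ℕ) → (∀ i → 𝟙d (bad? (f i)) * θ ≤ g (toℕ i)) → length (filter bad? (tabulate f)) * θ ≤ sum< k g
      count zero    f g hyp = z≤n
      count (suc k) f g hyp = ≤-trans (split (bad? (f fzero)) (hyp fzero)) (≤-reflexive (sym (sum<-suc k g)))
        where
        rec : length (filter bad? (tabulate (f ∘ fsuc))) * θ ≤ sum< k (g ∘ suc)
        rec = count k (f ∘ fsuc) (g ∘ suc) (hyp ∘ fsuc)
        split : ∀ (d : Dec (θ < potential (toℕ (f fzero)))) → 𝟙 (does (bad? (f fzero))) * θ ≤ g 0 →
          length (filter bad? (tabulate f)) * θ ≤ g 0 + sum< k (g ∘ suc)
        split _ l with does (bad? (f fzero))
        ... | true  = +-mono-≤ (≤-trans (≤-reflexive (sym (+-identityʳ θ))) l) rec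
        ... | false = ≤-trans rec (m≤n+m _ (g 0))

    good-potential : ∀ i → i ∉ bad → potential (toℕ i) ≤ θ
    good-potential i ni = ≮⇒≥ (λ p → ni (∈-filter⁺ bad? (∈-allFin i) p))

    Δ : ℕ
    Δ = 2 * δ₁ + 2 * δ₂ + (2 * D + θ) * M

    size-upper : ∀ i → potential i ≤ θ → size i * M ≤ 2 ^ n + Δ
    size-upper i p = ≤-trans (*-monoˡ-≤ M (≤-trans (size≤ i) (+-mono-≤ (+-mono-≤ (wide≤ i) (≤-trans (m≤n+m _ _) p)) (short≤ i))))
      (≤-trans (≤-reflexive (lem T θ D M)) (≤-trans (+-monoˡ-≤ _ (≤-trans 2TM (+-monoˡ-≤ (2 * δ₁) all))) (≤-trans (≤-reflexive (+-assoc (2 ^ n) _ _))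
        (+-monoʳ-≤ (2 ^ n) (+-monoˡ-≤ ((2 * D + θ) * M) (m≤m+n (2 * δ₁) (2 * δ₂)))))))
      where
      lem : ∀ t θ d m → (2 * t + θ + 2 * d) * m ≡ m * (2 * t) + (2 * d + θ) * m
      lem = solve-∀
      all : sumS n (weigh wide?) ≤ 2 ^ n
      all = ≤-trans (sumS-mono n (λ x → 𝟙≤1 (does (wide? (side x))))) (≤-reflexive (trans (sumS-const n 1) (*-identityʳ (2 ^ n))))

    sum-size : sum< M size ≡ 2 ^ n
    sum-size = trans (sum<-cong M (λ i _ → trans (size-≡ i) (sumS-cong n (λ x → sym (*-identityʳ _)))))
      (trans (amount-total {λ _ → ⊤} (λ _ → yes tt)) (trans (sumS-const n 1) (*-identityʳ (2 ^ n))))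

    -- The 2^n sets are spread over M chains, none with more than 2 T wide members, so 2 T M is
    -- nearly 2^n; and a chain of small potential has nearly 2 T members.
    size-lower : ∀ i → potential i ≤ θ → 2 ^ n ≤ size i * M + Δ
    size-lower i p = begin
      2 ^ n ≡⟨ sym sum-size ⟩
      sum< M size ≤⟨ sum<-mono M (λ j _ → size≤ j) ⟩
      sum< M (λ j → wide j + excess j + short j) ≡⟨ trans (sum<-+ M _ _) (cong (_+ sum< M short) (sum<-+ M _ _)) ⟩
      sum< M wide + sum< M excess + sum< M short ≤⟨ +-mono-≤ (+-mono-≤ (sum<-mono M (λ j _ → wide≤ j)) sum-excess) (sum<-mono M (λ j _ → short≤ j)) ⟩
      sum< M (λ _ → 2 * T) + 2 * δ₂ + sum< M (λ _ → 2 * D) ≡⟨ cong₂ (λ a b → a + 2 * δ₂ + b) (sum<-const M (2 * T)) (sum<-const M (2 * D)) ⟩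
      M * (2 * T) + 2 * δ₂ + M * (2 * D) ≤⟨ +-monoˡ-≤ _ (+-monoˡ-≤ _ (*-monoʳ-≤ M T≤)) ⟩
      M * (size i + θ) + 2 * δ₂ + M * (2 * D) ≡⟨ lem M (size i) θ (2 * δ₂) D ⟩
      size i * M + (2 * δ₂ + (2 * D + θ) * M) ≤⟨ +-monoʳ-≤ (size i * M) (+-monoˡ-≤ _ (m≤n+m (2 * δ₂) (2 * δ₁))) ⟩
      size i * M + Δ ∎
      where
      open ≤-Reasoning
      T≤ : 2 * T ≤ size i + θ
      T≤ = ≤-trans (m≤n+m∸n (2 * T) (wide i)) (+-mono-≤ (wide≤size i) (≤-trans (m≤m+n _ _) p))
      lem : ∀ m s θ e d → m * (s + θ) + e + m * (2 * d) ≡ s * m + (e + (2 * d + θ) * m)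
      lem = solve-∀

    good-size : ∀ i → i ∉ bad → ∣ length (ChainPartition.chain partition i) * M - 2 ^ n ∣ ≤ Δ
    good-size i ni = dist (size (toℕ i) * M) (2 ^ n) (size-upper (toℕ i) (good-potential i ni)) (size-lower (toℕ i) (good-potential i ni))
      where
      dist : ∀ x y → x ≤ y + Δ → y ≤ x + Δ → ∣ x - y ∣ ≤ Δ
      dist x y p q with ≤-total x y
      ... | inj₁ l = ≤-trans (≤-reflexive (m≤n⇒∣m-n∣≡n∸m l)) (m≤n+o⇒m∸n≤o y x q)
      ... | inj₂ l = ≤-trans (≤-reflexive (m≤n⇒∣n-m∣≡n∸m l)) (m≤n+o⇒m∸n≤o x y p)

-- The clock

box-total : ∀ {d} lo hi (p : Vec ℕ d) → InBox lo hi p → d * lo ≤ total p × total p ≤ d * hi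
box-total lo hi [] _ = z≤n , z≤n
box-total lo hi (x ∷ p) ((l , u) , bs) = +-mono-≤ l (proj₁ (box-total lo hi p bs)) , +-mono-≤ (<⇒≤ u) (proj₂ (box-total lo hi p bs))

-- Cutting a sequence of weights at most ω at the multiples of B of its partial sums.
module Cut (w : ℕ → ℕ) (ω B : ℕ) .{{_ : NonZero B}} (w≤ω : ∀ e → w e ≤ ω) where
  partial : ℕ → ℕ
  partial e = sum< e w

  group : ℕ → ℕ → ℕ
  group π E = sum< E (λ e → w e * 𝟙 (partial e / B ≡ᵇ π))

  -- The first bound is the invariant behind the second: when a member joins group π, the partial
  -- sum before it is still below (π + 1) B, so the earlier members total at most B and the new one
  -- adds at most ω.
  group≤ : ∀ π E → group π E ≤ partial E ∸ π * B × group π E ≤ B + ω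
  group≤ π zero = z≤n , z≤n
  group≤ π (suc E) with partial E / B ≡ᵇ π in e
  ... | false = ≤-trans (≤-reflexive drop0) (≤-trans (proj₁ (group≤ π E)) (∸-monoˡ-≤ (π * B) (m≤m+n (partial E) (w E)))) ,
                ≤-trans (≤-reflexive drop0) (proj₂ (group≤ π E))
    where
    drop0 : group π E + w E * 0 ≡ group π E
    drop0 = trans (cong (group π E +_) (*-zeroʳ (w E))) (+-identityʳ _)
  ... | true = ≤-trans (≤-reflexive (cong (group π E +_) (*-identityʳ (w E)))) (≤-trans (+-monoˡ-≤ (w E) (proj₁ (group≤ π E)))
                 (≤-reflexive (sym (+-∸-comm (w E) low)))) ,
               +-mono-≤ (≤-trans (proj₁ (group≤ π E)) (<⇒≤ high)) (≤-trans (≤-reflexive (*-identityʳ (w E))) (w≤ω E))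
    where
    eq : partial E / B ≡ π
    eq = ≡ᵇ-sound _ π e
    low : π * B ≤ partial E
    low = ≤-trans (*-monoˡ-≤ B (≤-reflexive (sym eq))) (m/n*n≤m (partial E) B)
    high : partial E ∸ π * B < B
    high = ≤-<-trans (≤-reflexive (trans (cong (λ x → partial E ∸ x * B) (sym eq)) (sym (m%n≡m∸m/n*n (partial E) B)))) (m%n<n (partial E) B)

-- Bernoulli's inequality for 1 - 1/(z+1), cleared of denominators; truncated subtraction covers s >
-- z + 1.
bernoulli-lower : ∀ z s → suc z ^ s * (suc z ∸ s) ≤ z ^ s * suc z
bernoulli-lower z zero    = ≤-refl
bernoulli-lower z (suc s) with s ≤? z
... | no  n = ≤-trans (≤-reflexive (trans (cong (suc z ^ suc s *_) (m≤n⇒m∸n≡0 (<⇒≤ (≰⇒> n)))) (*-zeroʳ (suc z ^ suc s)))) z≤n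
... | yes p = ≤-trans (≤-reflexive (lem (suc z) (suc z ^ s) (z ∸ s))) (≤-trans (*-monoʳ-≤ (suc z ^ s) step)
    (≤-trans (≤-reflexive (lem2 (suc z ^ s) z (suc z ∸ s))) (≤-trans (*-monoʳ-≤ z (bernoulli-lower z s)) (≤-reflexive (sym (*-assoc z (z ^ s) (suc z)))))))
  where
  lem : ∀ a b c → a * b * c ≡ b * (a * c)
  lem = solve-∀
  lem2 : ∀ b z c → b * (z * c) ≡ z * (b * c)
  lem2 = solve-∀
  x = z ∸ s
  step : suc z * x ≤ z * (suc z ∸ s)
  step = ≤-trans (+-monoˡ-≤ (z * x) (m∸n≤m z s)) (≤-reflexive (trans (sym (*-suc z x)) (cong (z *_) (sym (+-∸-assoc 1 p)))))

power-ratio : ∀ c z s → s * suc c ≤ suc z → c * suc z ^ s ≤ suc c * z ^ s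
power-ratio c z s h = *-cancelʳ-≤ _ _ (suc z) (begin
  c * suc z ^ s * suc z ≡⟨ lem c (suc z ^ s) (suc z) ⟩
  suc z ^ s * (c * suc z) ≤⟨ *-monoʳ-≤ (suc z ^ s) base ⟩
  suc z ^ s * (suc c * (suc z ∸ s)) ≡⟨ lem2 (suc z ^ s) (suc c) (suc z ∸ s) ⟩
  suc c * (suc z ^ s * (suc z ∸ s)) ≤⟨ *-monoʳ-≤ (suc c) (bernoulli-lower z s) ⟩
  suc c * (z ^ s * suc z) ≡⟨ sym (*-assoc (suc c) (z ^ s) (suc z)) ⟩
  suc c * z ^ s * suc z ∎)
  where
  open ≤-Reasoning
  lem : ∀ a b c → a * b * c ≡ b * (a * c)
  lem = solve-∀
  lem2 : ∀ b z c → b * (z * c) ≡ z * (b * c)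
  lem2 = solve-∀
  base : c * suc z ≤ suc c * (suc z ∸ s)
  base = ≤-trans (≤-trans (≤-reflexive (sym (m+n∸m≡n (suc z) (c * suc z)))) (∸-monoʳ-≤ (suc c * suc z) h))
    (≤-reflexive (trans (cong (suc c * suc z ∸_) (*-comm s (suc c))) (sym (*-distribˡ-∸ (suc c) (suc z) s))))

-- Relative variation at most 1/z per step, in both directions, without division.
Close : ℕ → ℕ → ℕ → (ℕ → ℕ) → Set
Close z lo hi f = ∀ x → lo ≤ x → suc x ≤ hi → z * f (suc x) ≤ suc z * f x × z * f x ≤ suc z * f (suc x)

close-steps : ∀ {z lo hi f} → Close z lo hi f → ∀ x s → lo ≤ x → x + s ≤ hi →
  z ^ s * f (x + s) ≤ suc z ^ s * f x × z ^ s * f x ≤ suc z ^ s * f (x + s)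
close-steps {f = f} h x zero l u = ≤-reflexive (cong (λ y → 1 * f y) (+-identityʳ x)) , ≤-reflexive (cong (λ y → 1 * f y) (sym (+-identityʳ x)))
close-steps {z} {lo} {hi} {f} h x (suc s) l u with h (x + s) (≤-trans l (m≤m+n x s)) (≤-trans (≤-reflexive (sym (+-suc x s))) u)
  | close-steps h x s l (≤-trans (+-monoʳ-≤ x (n≤1+n s)) u)
... | p , p' | r , r' = subst (λ y → z * z ^ s * f y ≤ suc z * suc z ^ s * f x) (sym (+-suc x s))
      (≤-trans (≤-reflexive (lem z (z ^ s) _)) (≤-trans (*-monoʳ-≤ (z ^ s) p) (≤-trans (≤-reflexive (lem2 (z ^ s) (suc z) _)) (≤-trans (*-monoʳ-≤ (suc z) r) (≤-reflexive (sym (*-assoc (suc z) (suc z ^ s) _)))))))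
  , subst (λ y → z * z ^ s * f x ≤ suc z * suc z ^ s * f y) (sym (+-suc x s))
      (≤-trans (≤-reflexive (*-assoc z (z ^ s) _)) (≤-trans (*-monoʳ-≤ z r') (≤-trans (≤-reflexive (lem2 z (suc z ^ s) _)) (≤-trans (*-monoʳ-≤ (suc z ^ s) p') (≤-reflexive (sym (lem (suc z) (suc z ^ s) _)))))))
  where
  lem : ∀ a b c → a * b * c ≡ b * (a * c)
  lem = solve-∀
  lem2 : ∀ b z c → b * (z * c) ≡ z * (b * c)
  lem2 = solve-∀

close-pair : ∀ {z lo hi f} → Close z lo hi f → ∀ x y s → lo ≤ x → lo ≤ y → x ≤ hi → y ≤ hi → x ≤ y + s → y ≤ x + s → z ^ s * f x ≤ suc z ^ s * f y
close-pair {z} {f = f} h x y s lx ly ux uy p q with ≤-total x y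
... | inj₁ l = extend (y ∸ x) (m≤n+o⇒m∸n≤o y x q) (subst (λ w → z ^ (y ∸ x) * f x ≤ suc z ^ (y ∸ x) * f w) (m+[n∸m]≡n l)
      (proj₂ (close-steps h x (y ∸ x) lx (≤-trans (≤-reflexive (m+[n∸m]≡n l)) uy))))
  where
  extend : ∀ r → r ≤ s → z ^ r * f x ≤ suc z ^ r * f y → z ^ s * f x ≤ suc z ^ s * f y
  extend r r≤s k = subst (λ w → z ^ w * f x ≤ suc z ^ w * f y) (m∸n+n≡m r≤s)
    (≤-trans (≤-reflexive (trans (cong (_* f x) (^-distribˡ-+-* z (s ∸ r) r)) (*-assoc (z ^ (s ∸ r)) (z ^ r) (f x)))) (≤-trans (*-mono-≤ (^-monoˡ-≤ (s ∸ r) (n≤1+n z)) k)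
      (≤-reflexive (sym (trans (cong (_* f y) (^-distribˡ-+-* (suc z) (s ∸ r) r)) (*-assoc (suc z ^ (s ∸ r)) (suc z ^ r) (f y)))))))
... | inj₂ l = extend (x ∸ y) (m≤n+o⇒m∸n≤o x y p) (subst (λ w → z ^ (x ∸ y) * f w ≤ suc z ^ (x ∸ y) * f y) (m+[n∸m]≡n l)
      (proj₁ (close-steps h y (x ∸ y) ly (≤-trans (≤-reflexive (m+[n∸m]≡n l)) ux))))
  where
  extend : ∀ r → r ≤ s → z ^ r * f x ≤ suc z ^ r * f y → z ^ s * f x ≤ suc z ^ s * f y
  extend r r≤s k = subst (λ w → z ^ w * f x ≤ suc z ^ w * f y) (m∸n+n≡m r≤s)
    (≤-trans (≤-reflexive (trans (cong (_* f x) (^-distribˡ-+-* z (s ∸ r) r)) (*-assoc (z ^ (s ∸ r)) (z ^ r) (f x)))) (≤-trans (*-mono-≤ (^-monoˡ-≤ (s ∸ r) (n≤1+n z)) k)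
      (≤-reflexive (sym (trans (cong (_* f y) (^-distribˡ-+-* (suc z) (s ∸ r) r)) (*-assoc (suc z ^ (s ∸ r)) (suc z ^ r) (f y)))))))

Within : ∀ {d} → ℕ → Vec ℕ d → Vec ℕ d → Set
Within s []      []      = ⊤
Within s (x ∷ p) (y ∷ r) = (x ≤ y + s × y ≤ x + s) × Within s p r

weight-close : ∀ {d} {z lo hi b} → Close z lo hi (binom b) → ∀ s (p r : Vec ℕ d) → InBox lo hi p → InBox lo hi r → Within s p r →
  z ^ (d * s) * weight b p ≤ suc z ^ (d * s) * weight b r
weight-close h s [] [] _ _ _ = ≤-refl
weight-close {suc d} {z} {b = b} h s (x ∷ p) (y ∷ r) ((lx , ux) , bp) ((ly , uy) , br) ((u , v) , w) = begin
  z ^ (s + d * s) * (binom b x * weight b p) ≡⟨ cong (_* (binom b x * weight b p)) (^-distribˡ-+-* z s (d * s)) ⟩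
  z ^ s * z ^ (d * s) * (binom b x * weight b p) ≡⟨ lem (z ^ s) (z ^ (d * s)) (binom b x) (weight b p) ⟩
  z ^ s * binom b x * (z ^ (d * s) * weight b p) ≤⟨ *-mono-≤ (close-pair h x y s lx ly (<⇒≤ ux) (<⇒≤ uy) u v) (weight-close h s p r bp br w) ⟩
  suc z ^ s * binom b y * (suc z ^ (d * s) * weight b r) ≡⟨ sym (lem (suc z ^ s) (suc z ^ (d * s)) (binom b y) (weight b r)) ⟩
  suc z ^ s * suc z ^ (d * s) * (binom b y * weight b r) ≡⟨ cong (_* (binom b y * weight b r)) (sym (^-distribˡ-+-* (suc z) s (d * s))) ⟩
  suc z ^ (s + d * s) * (binom b y * weight b r) ∎
  where
  open ≤-Reasoning
  lem : ∀ a b c e → a * b * (c * e) ≡ a * c * (b * e)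
  lem = solve-∀

weight-near : ∀ {d} {z lo hi b} → Close z lo hi (binom b) → 1 ≤ z → ∀ c s (p r : Vec ℕ d) → InBox lo hi p → InBox lo hi r → Within s p r →
  d * s * suc c ≤ suc z → c * weight b p ≤ suc c * weight b r
weight-near {d} {z} {b = b} h 1≤z c s p r bp br w l = *-cancelˡ-≤ (z ^ (d * s)) {{m^n≢0 z (d * s) {{>-nonZero 1≤z}}}} (begin
  z ^ (d * s) * (c * weight b p) ≡⟨ lem (z ^ (d * s)) c (weight b p) ⟩
  c * (z ^ (d * s) * weight b p) ≤⟨ *-monoʳ-≤ c (weight-close h s p r bp br w) ⟩
  c * (suc z ^ (d * s) * weight b r) ≡⟨ sym (*-assoc c (suc z ^ (d * s)) (weight b r)) ⟩
  c * suc z ^ (d * s) * weight b r ≤⟨ *-monoˡ-≤ (weight b r) (power-ratio c z (d * s) l) ⟩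
  suc c * z ^ (d * s) * weight b r ≡⟨ lem2 (suc c) (z ^ (d * s)) (weight b r) ⟩
  z ^ (d * s) * (suc c * weight b r) ∎)
  where
  open ≤-Reasoning
  lem : ∀ a b c → a * (b * c) ≡ b * (a * c)
  lem = solve-∀
  lem2 : ∀ a b c → a * b * c ≡ b * (a * c)
  lem2 = solve-∀

zeros-below : ∀ d q → Below (suc q) (zeros d)
zeros-below zero    q = tt
zeros-below (suc d) q = s≤s z≤n , zeros-below d q

within-col : ∀ {d} q (u l l' : Vec ℕ d) → Below q l → Below q l' → Within q (col q u l) (col q u l')
within-col q [] [] [] _ _ = tt
within-col q (x ∷ u) (y ∷ l) (y' ∷ l') (b , bs) (b' , bs') = (near y y' b , near y' y b') , within-col q u l l' bs bs'
  where
  near : ∀ y y' → y < q → x * q + y ≤ x * q + y' + q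
  near y y' b = ≤-trans (+-monoʳ-≤ (x * q) (<⇒≤ b)) (+-monoˡ-≤ q (m≤m+n (x * q) y'))

within-back : ∀ {d} q i g (u l : Vec ℕ d) → i ≤ g → Within (g * q) (col q u l) (col q (shift-back i u) l)
within-back q i g [] [] _ = tt
within-back q i g (x ∷ u) (y ∷ l) h = (≤-trans (+-monoˡ-≤ y (≤-trans (*-monoˡ-≤ q (≤-trans (m≤n+m∸n x i) (+-monoˡ-≤ (x ∸ i) h))) (≤-reflexive (lem g (x ∸ i) q))))
      (≤-reflexive (lem2 ((x ∸ i) * q) (g * q) y)) , ≤-trans (+-monoˡ-≤ y (*-monoˡ-≤ q (m∸n≤m x i))) (m≤m+n _ _)) , within-back q i g u l h
  where
  lem : ∀ g w q → (g + w) * q ≡ w * q + g * q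
  lem = solve-∀
  lem2 : ∀ a b y → a + b + y ≡ a + y + b
  lem2 = solve-∀

box-back : ∀ {d} i {lo hi} (u : Vec ℕ d) → InBox lo hi u → InBox (lo ∸ i) hi (shift-back i u)
box-back i [] _ = tt
box-back i (x ∷ u) ((l , h) , bs) = (∸-monoˡ-≤ i l , ≤-<-trans (m∸n≤m x i) h) , box-back i u bs

sumS-exchange : ∀ m n (f : Subset m → Subset n → ℕ) → sumS m (λ x → sumS n (f x)) ≡ sumS n (λ y → sumS m (λ x → f x y))
sumS-exchange zero    n f = refl
sumS-exchange (suc m) n f = trans (cong₂ _+_ (sumS-exchange m n _) (sumS-exchange m n _)) (sym (sumS-+ n _ _))

sumS-first : ∀ m n (f : Subset m → ℕ) → sumS (m + n) (λ x → f (take m x)) ≡ 2 ^ n * sumS m f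
sumS-first m n f = trans (sumS-++ m n _) (trans (sumS-cong m (λ x → trans (sumS-cong n (λ y → cong f (take-++ x y))) (sumS-const n (f x)))) (sumS-*ˡ m (2 ^ n) f))

sumS-second : ∀ m n (f : Subset n → ℕ) → sumS (m + n) (λ x → f (drop m x)) ≡ 2 ^ m * sumS n f
sumS-second m n f = trans (sumS-++ m n _) (trans (sumS-cong m (λ x → sumS-cong n (λ y → cong f (drop-++ x y)))) (sumS-const m _))

-- Fixing the part of a k-set in the last r coordinates fixes the cardinality of the rest, so each
-- of the 2^r parts contributes one coefficient of a.
binom-split≤ : ∀ a r k → binom (a + r) k ≤ 2 ^ r * binom a ⌊ a /2⌋
binom-split≤ a r k with k ≤? a + r
... | no  k> = ≤-trans (≤-reflexive (binom-> (a + r) k (≰⇒> k>))) z≤n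
... | yes k≤ = begin
  binom (a + r) k ≡⟨ sym (trans (cong (binom (a + r) k *_) (𝟙d-yes (k ≟ k) refl)) (*-identityʳ _)) ⟩
  binom (a + r) k * 𝟙d (k ≟ k) ≤⟨ term≤sum< (λ j → binom (a + r) j * 𝟙d (j ≟ k)) (s≤s k≤) ⟩
  sum< (suc (a + r)) (λ j → binom (a + r) j * 𝟙d (j ≟ k)) ≡⟨ sym (sumS-card (a + r) (λ j → 𝟙d (j ≟ k))) ⟩
  sumS (a + r) (λ x → 𝟙d (card x ≟ k)) ≡⟨ sumS-++ a r _ ⟩
  sumS a (λ x → sumS r (λ y → 𝟙d (card (x ++ y) ≟ k)))
    ≡⟨ sumS-cong a (λ x → sumS-cong r (λ y → cong (λ j → 𝟙d (j ≟ k)) (trans (card-split a (x ++ y)) (cong₂ (λ u v → card u + card v) (take-++ x y) (drop-++ x y))))) ⟩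
  sumS a (λ x → sumS r (λ y → 𝟙d (card x + card y ≟ k))) ≡⟨ sumS-exchange a r _ ⟩
  sumS r (λ y → sumS a (λ x → 𝟙d (card x + card y ≟ k))) ≤⟨ sumS-mono r (λ y → ≤-trans (≤-reflexive (sumS-card a (λ j → 𝟙d (j + card y ≟ k)))) (one (card y))) ⟩
  sumS r (λ _ → binom a ⌊ a /2⌋) ≡⟨ sumS-const r _ ⟩
  2 ^ r * binom a ⌊ a /2⌋ ∎
  where
  open ≤-Reasoning
  one : ∀ c → sum< (suc a) (λ j → binom a j * 𝟙d (j + c ≟ k)) ≤ binom a ⌊ a /2⌋
  one c = sum<-single (suc a) _ _ (λ j _ → ≤-trans (*-𝟙≤ (binom a j) (does (j + c ≟ k))) (binom≤middle a j))
    (λ i j l _ p r → <⇒≢ l (+-cancelʳ-≡ c i j (trans (𝟙d-≢0 (i + c ≟ k) (*-≢0ʳ (binom a i) p)) (sym (𝟙d-≢0 (j + c ≟ k) (*-≢0ʳ (binom a j) r))))))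

𝟙d-⊎ : ∀ {P Q R : Set} (d : Dec P) (e : Dec Q) (f : Dec R) → (P → Q ⊎ R) → 𝟙d d ≤ 𝟙d e + 𝟙d f
𝟙d-⊎ (no _)  e f h = z≤n
𝟙d-⊎ (yes p) e f h with h p
... | inj₁ q = ≤-trans (≤-reflexive (sym (𝟙d-yes e q))) (m≤m+n (𝟙d e) (𝟙d f))
... | inj₂ r = ≤-trans (≤-reflexive (sym (𝟙d-yes f r))) (m≤n+m (𝟙d f) (𝟙d e))

record Sides : Set where
  field
    a b d q' ρ G V L' c k1 u1 u2 u3 z : ℕ
  q L m ω αm y0 lo hi : ℕ
  q  = suc q'
  L  = suc L'
  m  = q ^ d
  ω  = binom a k1
  y0 = ⌊ a /2⌋
  αm = binom a y0
  lo = (u1 ∸ G) * q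
  hi = u3 * q
-- The numerical inequalities to which the construction reduces; `Large` verifies them for large n.
record Params : Set where
  field
    sides : Sides
  open Sides sides public
  field
    G≤u1   : G ≤ u1
    u1≤u3  : u1 ≤ u3
    u3≤u2  : u3 ≤ u2
    u2≤ρ   : u2 ≤ ρ
    b<     : suc b ≤ ρ * q
    k1≤a   : k1 ≤ a
    reach  : y0 + d * (u2 * q) ≤ k1 + d * lo
    gap    : ∀ k → y0 ≤ k → k + d * lo ≤ y0 + d * (u2 * q) → (c + 8) * ω ≤ c * binom a k
    tail   : c * binom a (k1 + V * L) ≤ ω
    close  : Close z lo hi (binom b)
    near₁  : d * q * suc c ≤ suc z
    near₂  : d * (G * q) * 2 ≤ suc z
    1≤z    : 1 ≤ z
    diag   : 2 * (c * (3 * (2 * V + 1) + 2)) ≤ G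
    unusual : ∀ (p : Vec ℕ d) → InBox lo hi p → c * (αm * sumS (d * b) (λ x → 𝟙d (¬? (inBox? 0 (u2 * q) (cards d b x))))) ≤ ω * weight b p
    2≤c    : 2 ≤ c
    2≤m    : 2 ≤ m
    1≤ω    : 1 ≤ ω

module Scheme (Pr : Params) where
  open Params Pr
  open Digits q

  n h m₁ B κ T0 : ℕ
  n  = a + d * b
  h  = ⌊ n /2⌋
  m₁ = m ∸ 1
  -- One weight less than m ω, so that a period which overshoots by its last piece still totals at
  -- most m ω.
  B  = ω * m₁
  κ  = y0 + d * (u2 * q)
  T0 = suc (a + d * (ρ * q))

  m≡ : suc m₁ ≡ m
  m≡ = m+[n∸m]≡n (≤-trans (s≤s z≤n) 2≤m)

  1≤m₁ : 1 ≤ m₁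
  1≤m₁ = ∸-monoˡ-≤ 1 2≤m

  instance
    B≢0 : NonZero B
    B≢0 = m*n≢0 ω m₁ {{>-nonZero 1≤ω}} {{>-nonZero 1≤m₁}}
    m≢0 : NonZero m
    m≢0 = m^n≢0 q d

  W : ℕ → ℕ
  W v = binom a (k1 + v * L)

  y0≤k1 : y0 ≤ k1
  y0≤k1 = +-cancelʳ-≤ (d * (u2 * q)) _ _ (≤-trans reach (+-monoʳ-≤ k1 (*-monoʳ-≤ d (*-monoˡ-≤ q (≤-trans (m∸n≤m u1 G) (≤-trans u1≤u3 u3≤u2))))))

  α-anti : ∀ i j → y0 ≤ i → i ≤ j → binom a j ≤ binom a i
  α-anti i j l = binom-anti a i j (≤-trans (half-upper a) (s≤s (+-mono-≤ l l)))

  W≤ω : ∀ v → W v ≤ ω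
  W≤ω v = α-anti _ _ y0≤k1 (m≤m+n k1 _)

  open Cut (λ e → W (e / m)) ω B (λ e → W≤ω (e / m)) public

  per : ℕ → ℕ → ℕ
  per v j = partial (v * m + j) / B

  P : ℕ
  -- The extra one accounts for the last period, which may be incomplete.
  P = suc (partial (V * m) / B)

  job< : ∀ {v v'} j → v < v' → j < m → v * m + j < v' * m
  job< {v} {v'} j l lj = <-≤-trans (+-monoʳ-< (v * m) lj) (≤-trans (≤-reflexive (+-comm (v * m) m)) (*-monoˡ-≤ m l))

  per-< : ∀ v j → v < V → j < m → per v j < P
  per-< v j lv lj = s≤s (/-monoˡ-≤ B (sum<-≤ _ (<⇒≤ (job< j lv lj))))

  per-mono : ∀ v v' j j' → v < v' → v' < V → j < m → j' < m → per v j ≤ per v' j'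
  per-mono v v' j j' l _ lj _ = /-monoˡ-≤ B (sum<-≤ _ (≤-trans (<⇒≤ (job< j l lj)) (m≤m+n (v' * m) j')))

  B+ω : B + ω ≡ m * ω
  B+ω = trans (trans (cong (_+ ω) (*-comm ω m₁)) (+-comm (m₁ * ω) ω)) (cong (_* ω) m≡)

  period-sum : ∀ π → sum< m (λ j → sum< V (λ v → W v * 𝟙 (per v j ≡ᵇ π))) ≤ m * ω
  period-sum π = ≤-trans (≤-reflexive (trans (sum<-swap m V _) (trans (sum<-cong V (λ v _ → sum<-cong m (λ j lj →
      cong (λ w → W w * 𝟙 (per v j ≡ᵇ π)) (sym (div-block m v j lj))))) (sum<-blocks V m (λ e → W (e / m) * 𝟙 (partial e / B ≡ᵇ π))))))
    (≤-trans (proj₂ (group≤ π (V * m))) (≤-reflexive B+ω))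

  InW : ℕ → Vec ℕ d → Set
  InW k p = InBox (u1 * q) (u3 * q) p × k1 ≤ k × k < k1 + V * L

  inW? : ∀ k p → Dec (InW k p)
  inW? k p = inBox? (u1 * q) (u3 * q) p ×-dec (k1 ≤? k) ×-dec (k <? k1 + V * L)

  -- All pieces of one period are traversed simultaneously in the same L times: the period gives the
  -- multiple of L, the level within the layer the remainder.
  windowTime : ℕ → Vec ℕ d → ℕ
  windowTime k p = T0 + (per ((k ∸ k1) / L) (idx (residue p)) * L + (k ∸ k1) % L)

  τ : ℕ → Vec ℕ d → ℕ
  τ k p with inW? k p
  ... | yes _ = windowTime k p
  ... | no  _ = k + total p

  τ-in : ∀ k p → InW k p → τ k p ≡ windowTime k p
  τ-in k p w with inW? k p
  ... | yes _ = refl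
  ... | no  n = ⊥-elim (n w)

  τ-out : ∀ k p → ¬ InW k p → τ k p ≡ k + total p
  τ-out k p w with inW? k p
  ... | yes y = ⊥-elim (w y)
  ... | no  _ = refl

  shape : GridShape
  shape = record { d = d ; q' = q' ; ρ = ρ ; a = a ; G = G ; V = V ; L = L ; P = P ; c = c ; u1 = u1 ; u2 = u2 ; u3 = u3
    ; k1 = k1 ; κ = κ ; y0 = y0 ; T0 = T0 ; αm = αm ; M = binom n ⌊ n /2⌋ ; α = binom a ; β = weight b ; τ = τ ; per = per }

  open Types shape b refl refl using (level; place; time; rank-card; antichain-bound; gsum-≡)

  τ-window : ∀ u j v o → InBox u1 u3 u → j < m → v < V → o < L → τ (k1 + (v * L + o)) (col q u (lab d j)) ≡ T0 + (per v j * L + o)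
  τ-window u j v o t lj lv lo = trans (τ-in _ _ (col-box q u1 u3 u (lab d j) bl t , m≤m+n k1 _ ,
      +-monoʳ-< k1 (<-≤-trans (+-monoʳ-< (v * L) lo) (≤-trans (≤-reflexive (+-comm (v * L) L)) (*-monoˡ-≤ L lv)))))
    (cong (T0 +_) (cong₂ _+_ (cong (_* L) (cong₂ per (trans (cong (_/ L) (m+n∸m≡n k1 _)) (div-block L v o lo))
        (trans (cong idx (residue-col u (lab d j) bl)) (idx-lab d j lj)))) (trans (cong (_% L) (m+n∸m≡n k1 _)) (mod-block L v o lo))))
    where bl = lab-below d j lj

  P≤ : P ≤ 2 * V + 1
  P≤ = ≤-trans (s≤s (m<1+n⇒m≤n (m<n*o⇒m/o<n {partial (V * m)} {suc (2 * V)} {B} (≤-<-trans S≤ (m<n+m (2 * V * B) (>-nonZero⁻¹ B)))))) (≤-reflexive (+-comm 1 (2 * V)))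
    where
    S≤ : partial (V * m) ≤ 2 * V * B
    S≤ = ≤-trans (sum<-mono (V * m) (λ e _ → W≤ω (e / m))) (≤-trans (≤-reflexive (sum<-const (V * m) ω))
      (≤-trans (*-monoˡ-≤ ω (*-monoʳ-≤ V (≤-trans (≤-reflexive (sym m≡)) (≤-trans (+-monoˡ-≤ m₁ 1≤m₁) (≤-reflexive (cong (m₁ +_) (sym (+-identityʳ m₁)))))))) (≤-reflexive (lem V m₁ ω))))
      where
      lem : ∀ v m w → v * (2 * m) * w ≡ 2 * v * (w * m)
      lem = solve-∀

  grid : Grid
  grid = record
    { shape = shape ; G≤u1 = G≤u1 ; u3≤u2 = u3≤u2 ; u2≤ρ = u2≤ρ
    ; κ-usual = λ p us → +-monoʳ-≤ y0 (proj₂ (box-total 0 (u2 * q) p us))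
    ; κ-near = λ p nr → ≤-trans reach (+-monoʳ-≤ k1 (proj₁ (box-total lo hi p nr)))
    ; k1≤a = k1≤a ; y0≤k1 = y0≤k1 ; α-anti = α-anti ; α-max = binom≤middle a
    ; α-base = base
    ; α-tail = λ k l → ≤-trans (*-monoʳ-≤ c (α-anti _ k (≤-trans y0≤k1 (m≤m+n k1 _)) l)) tail
    ; rank-T0 = λ k p l bl → s≤s (+-mono-≤ l (below-total p bl))
    ; τ-window = τ-window ; τ-rank = τ-out ; per-< = per-< ; per-mono = per-mono ; period-sum = period-sum
    ; β-near = λ u l t bl → weight-near close 1≤z c q (col q u l) (col q u (zeros d)) (near-box u l t bl) (near-box u (zeros d) t (zeros-below d q'))
        (within-col q u l (zeros d) bl (zeros-below d q')) near₁
    ; β-near' = λ u l t bl → weight-near close 1≤z c q (col q u (zeros d)) (col q u l) (col-box q (u1 ∸ G) u3 u (zeros d) (zeros-below d q') t) (col-box q (u1 ∸ G) u3 u l bl t)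
        (within-col q u (zeros d) l (zeros-below d q') bl) near₁
    ; β-back = λ u i t i≤G → ≤-trans (≤-reflexive (sym (*-identityˡ _))) (weight-near close 1≤z 1 (G * q) (col q u (zeros d)) (col q (shift-back i u) (zeros d)) (near-box u (zeros d) t (zeros-below d q'))
        (col-box q (u1 ∸ G) u3 _ (zeros d) (zeros-below d q') (box-weaken _ (∸-monoʳ-≤ u1 i≤G) ≤-refl (box-back i u t))) (within-back q i G u (zeros d) i≤G) near₂)
    ; G-large = ≤-trans (*-monoʳ-≤ 2 (*-monoʳ-≤ c (+-monoˡ-≤ 2 (*-monoʳ-≤ 3 P≤)))) diag
    ; unusual-small = λ p nr → ≤-trans (*-monoʳ-≤ c (*-monoʳ-≤ αm unusual-mass)) (unusual p nr)
    ; 2≤c = 2≤c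
    ; antichain-mass = antichain-bound
    }
    where
    near-box : ∀ u l → InBox u1 u3 u → Below q l → InBox lo hi (col q u l)
    near-box u l t bl = col-box q (u1 ∸ G) u3 u l bl (box-weaken u (m∸n≤m u1 G) ≤-refl t)
    below-total : ∀ {d} (p : Vec ℕ d) {r} → Below r p → total p ≤ d * r
    below-total [] _ = z≤n
    below-total (x ∷ p) (l , bl) = +-mono-≤ (<⇒≤ l) (below-total p bl)
    base : ∀ p → InBox lo hi p → (c + 8) * ω ≤ c * binom a (κ ∸ total p)
    base p nr = gap (κ ∸ total p) (≤-trans (≤-reflexive (sym (m+n∸n≡m y0 (total p)))) (∸-monoˡ-≤ (total p) y0+p≤κ))
      (≤-trans (+-monoʳ-≤ (κ ∸ total p) (proj₁ (box-total lo hi p nr))) (≤-reflexive (m∸n+n≡m (≤-trans (m≤n+m (total p) y0) y0+p≤κ))))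
      where
      y0+p≤κ : y0 + total p ≤ κ
      y0+p≤κ = +-monoʳ-≤ y0 (≤-trans (proj₂ (box-total lo hi p nr)) (*-monoʳ-≤ d (*-monoˡ-≤ q u3≤u2)))
    unusual-mass : GridShape.gsum shape (λ p → weight b p * 𝟙d (¬? (inBox? 0 (u2 * q) p))) ≤ sumS (d * b) (λ x → 𝟙d (¬? (inBox? 0 (u2 * q) (cards d b x))))
    unusual-mass = ≤-trans (≤-reflexive (gsum-≡ _)) (≤-trans (sumV-support d (ρ * q) (suc b) _ supp) (≤-reflexive (sym (sumS-cards d b (λ p → 𝟙d (¬? (inBox? 0 (u2 * q) p)))))))
      where
      supp : ∀ p → weight b p * 𝟙d (¬? (inBox? 0 (u2 * q) p)) ≢ 0 → Below (suc b) p
      supp p ne with below? (suc b) p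
      ... | yes y = y
      ... | no  x = ⊥-elim (*-≢0ˡ (weight b p) ne (weight-0 b p x))

  colouring : TimedColouring n (middle n) time
  colouring = timed-colouring n (middle n) time (λ A anti → ≤-trans (Width.width grid b b< refl refl A anti) (≤-reflexive (binom-C n ⌊ n /2⌋)))

  module Output (D θ c₁ : ℕ) (high : n ∸ h < k1 + d * (u1 * q)) (low : k1 + d * (u3 * q) ≤ h + D)
    (c₁≤m₁ : c₁ ≤ m₁) (flat : c₁ * αm ≤ suc c₁ * ω) where

    Wide : Subset n → Set
    Wide x = InW (level x) (place x)

    wide? : ∀ x → Dec (Wide x)
    wide? x = inW? (level x) (place x)

    -- Sets controlled neither by the window nor by the D ranks from h on. They are few because such
    -- a set has an atypical column or a level beyond the window (`|E|≤`).
    Excess : Subset n → Set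
    Excess x = ¬ Wide x × h + D ≤ card x

    excess? : ∀ x → Dec (Excess x)
    excess? x = ¬? (wide? x) ×-dec (h + D ≤? card x)

    T M |W| |E| δ : ℕ
    T   = P * L
    M   = middle n
    |W| = sumS n (λ x → 𝟙d (wide? x))
    |E| = sumS n (λ x → 𝟙d (excess? x))
    δ   = T * M ∸ |W|

    wide-time : ∀ x → Wide x → T0 ≤ time x × time x < T0 + T
    wide-time x w = ≤-trans (m≤m+n T0 _) (≤-reflexive (sym eq)) , ≤-<-trans (≤-reflexive eq) (+-monoʳ-< T0 (<-≤-trans (+-monoʳ-< (π * L) (m%n<n (level x ∸ k1) L))
        (≤-trans (≤-reflexive (+-comm (π * L) L)) (*-monoˡ-≤ L (per-< _ _ v<V (idx-below (residue (place x)) (residue-below (place x))))))))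
      where
      π : ℕ
      π = per ((level x ∸ k1) / L) (idx (residue (place x)))
      eq : time x ≡ T0 + (π * L + (level x ∸ k1) % L)
      eq = τ-in (level x) (place x) w
      v<V : (level x ∸ k1) / L < V
      v<V = m<n*o⇒m/o<n {level x ∸ k1} {V} {L} (+-cancelˡ-< k1 _ _ (≤-<-trans (≤-reflexive (m+[n∸m]≡n (proj₁ (proj₂ w)))) (proj₂ (proj₂ w))))

    wide-high : ∀ x → Wide x → n ∸ h < card x
    wide-high x (t , l , _) = <-≤-trans high (≤-trans (+-mono-≤ l (proj₁ (box-total (u1 * q) (u3 * q) (place x) t))) (≤-reflexive (rank-card x)))

    short-time : ∀ x → ¬ Wide x → ¬ Excess x → h ≤ card x → h ≤ time x × time x < h + D
    short-time x nw ne u = subst (λ y → h ≤ y × y < h + D) (sym (trans (τ-out (level x) (place x) nw) (rank-card x))) (u , ≰⇒> (λ l → ne (nw , l)))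

    open Glue n time colouring using (partition)
    open Glue.Sizes n time colouring Wide Excess wide? excess? T0 T D θ δ |E| wide-time wide-high short-time
      (≤-trans (m≤n+m∸n (T * M) |W|) ≤-refl) ≤-refl using (bad; bad-few; good-size) public

    parts : ChainPartition n M
    parts = partition

    window? : ∀ k → Dec (k1 ≤ k × k < k1 + V * L)
    window? k = (k1 ≤? k) ×-dec (k <? k1 + V * L)

    N X Y Σα Σα' : ℕ
    N   = 2 ^ (d * b)
    X   = sumS (d * b) (λ x → 𝟙d (¬? (inBox? (u1 * q) (u3 * q) (cards d b x))))
    Y   = sumS a (λ x → 𝟙d (k1 + V * L ≤? card x))
    Σα  = sum< (V * L) (λ j → binom a (k1 + j))
    Σα' = sumS a (λ x → 𝟙d (window? (card x)))

    Σα≤ : Σα ≤ Σα'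
    Σα≤ = ≤-trans (sum<-mono (V * L) (λ j l → ≤-reflexive (sym (trans (cong (binom a (k1 + j) *_) (𝟙d-yes (window? (k1 + j)) (m≤m+n k1 j , +-monoʳ-< k1 l))) (*-identityʳ _)))))
      (≤-trans (≤-trans (m≤n+m _ (sum< k1 f)) (≤-reflexive (sym (sum<-split k1 (V * L) f)))) (≤-trans (sum<-support (k1 + V * L) (suc a) f supp) (≤-reflexive (sym (sumS-card a (λ k → 𝟙d (window? k)))))))
      where
      f : ℕ → ℕ
      f k = binom a k * 𝟙d (window? k)
      supp : ∀ k → f k ≢ 0 → k < suc a
      supp k ne with k ≤? a
      ... | yes l = s≤s l
      ... | no  g = ⊥-elim (*-≢0ˡ (binom a k) ne (binom-> a k (≰⇒> g)))

    Σα'≤ : Σα' ≤ 2 ^ a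
    Σα'≤ = ≤-trans (sumS-mono a (λ x → 𝟙≤1 (does (window? (card x))))) (≤-reflexive (trans (sumS-const a 1) (*-identityʳ (2 ^ a))))

    NΣα≤ : N * Σα ≤ |W| + 2 ^ a * X
    NΣα≤ = ≤-trans (*-monoʳ-≤ N Σα≤) (≤-trans (≤-reflexive (sym (sumS-first a (d * b) (λ x → 𝟙d (window? (card x))))))
      (≤-trans (sumS-mono n pw) (≤-reflexive (trans (sumS-+ n _ _) (cong (|W| +_) (sumS-second a (d * b) (λ x → 𝟙d (¬? (inBox? (u1 * q) (u3 * q) (cards d b x))))))))))
      where
      bool : ∀ w t → 𝟙 w ≤ 𝟙 (t ∧ w) + 𝟙 (not t)
      bool false t     = z≤n
      bool true  true  = s≤s z≤n
      bool true  false = s≤s z≤n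
      pw : ∀ x → 𝟙d (window? (level x)) ≤ 𝟙d (wide? x) + 𝟙d (¬? (inBox? (u1 * q) (u3 * q) (place x)))
      pw x = bool (does (window? (level x))) (does (inBox? (u1 * q) (u3 * q) (place x)))

    |E|≤ : |E| ≤ 2 ^ a * X + N * Y
    |E|≤ = ≤-trans (sumS-mono n pw) (≤-reflexive (trans (sumS-+ n _ _) (cong₂ _+_ (sumS-second a (d * b) (λ x → 𝟙d (¬? (inBox? (u1 * q) (u3 * q) (cards d b x)))))
        (sumS-first a (d * b) (λ x → 𝟙d (k1 + V * L ≤? card x))))))
      where
      pw : ∀ x → 𝟙d (excess? x) ≤ 𝟙d (¬? (inBox? (u1 * q) (u3 * q) (place x))) + 𝟙d (k1 + V * L ≤? level x)
      pw x = 𝟙d-⊎ (excess? x) (¬? (inBox? (u1 * q) (u3 * q) (place x))) (k1 + V * L ≤? level x) cases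
        where
        cases : Excess x → ¬ InBox (u1 * q) (u3 * q) (place x) ⊎ k1 + V * L ≤ level x
        cases (nw , l) with inBox? (u1 * q) (u3 * q) (place x)
        ... | no  nt = inj₁ nt
        ... | yes t  = inj₂ (≮⇒≥ λ s → nw (t , +-cancelʳ-≤ (total (place x)) _ _ (≤-trans (+-monoʳ-≤ k1 (proj₂ (box-total (u1 * q) (u3 * q) (place x) t)))
          (≤-trans low (≤-trans l (≤-reflexive (sym (rank-card x)))))) , s))

    ΣW : ℕ
    ΣW = sum< V W

    -- A layer is weighed by its heaviest, lowest level. The lowest level of layer v + 1 is no
    -- heavier than any level of layer v, so comparison with the previous layer costs only the first
    -- one, L ω.
    LΣW≤ : L * ΣW ≤ L * ω + Σα
    LΣW≤ = go V
      where
      step : ∀ v → L * W (suc v) ≤ sum< L (λ o → binom a (k1 + (v * L + o)))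
      step v = ≤-trans (≤-reflexive (sym (sum<-const L (W (suc v))))) (sum<-mono L (λ o l → α-anti _ _ (≤-trans y0≤k1 (m≤m+n k1 _))
        (+-monoʳ-≤ k1 (≤-trans (+-monoʳ-≤ (v * L) (<⇒≤ l)) (≤-reflexive (+-comm (v * L) L))))))
      go : ∀ U → L * sum< U W ≤ L * ω + sum< (U * L) (λ j → binom a (k1 + j))
      go zero    = ≤-trans (≤-reflexive (*-zeroʳ L)) z≤n
      go (suc U) = ≤-trans (≤-reflexive (trans (cong (L *_) (sum<-suc U W)) (*-distribˡ-+ L (W 0) _))) (+-mono-≤ (*-monoʳ-≤ L (W≤ω 0))
        (≤-trans (≤-reflexive (sym (sum<-*ˡ U L _))) (≤-trans (sum<-mono U (λ v _ → step v)) (≤-trans (≤-reflexive (sum<-blocks U L _)) (sum<-≤ _ (m≤n+m (U * L) L))))))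

    Z : ℕ
    Z = Σα + 2 * (L * ω)

    TB≤ : T * B ≤ m * Z
    TB≤ = begin
      P * L * B ≡⟨ lem P L B ⟩
      L * (P * B) ≤⟨ *-monoʳ-≤ L PB≤ ⟩
      L * (m * ΣW + m * ω) ≡⟨ lem2 L m ΣW ω ⟩
      m * (L * ΣW) + m * (L * ω) ≤⟨ +-monoˡ-≤ (m * (L * ω)) (*-monoʳ-≤ m LΣW≤) ⟩
      m * (L * ω + Σα) + m * (L * ω) ≡⟨ lem3 m (L * ω) Σα ⟩
      m * Z ∎
      where
      open ≤-Reasoning
      lem : ∀ p l b → p * l * b ≡ l * (p * b)
      lem = solve-∀
      lem2 : ∀ l m s w → l * (m * s + m * w) ≡ m * (l * s) + m * (l * w)
      lem2 = solve-∀
      lem3 : ∀ m x s → m * (x + s) + m * x ≡ m * (s + 2 * x)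
      lem3 = solve-∀
      S≡ : partial (V * m) ≡ m * ΣW
      S≡ = trans (sym (sum<-blocks V m _)) (trans (sum<-cong V (λ v _ → trans (sum<-cong m (λ j l → cong W (div-block m v j l))) (sum<-const m (W v)))) (sum<-*ˡ V m W))
      PB≤ : P * B ≤ m * ΣW + m * ω
      PB≤ = ≤-trans (+-mono-≤ (≤-trans (m≤m+n B ω) (≤-reflexive B+ω)) (≤-trans (m/n*n≤m (partial (V * m)) B) (≤-reflexive S≡))) (≤-reflexive (+-comm (m * ω) _))

    -- M is at most N `αm`. Passing from `αm` to ω costs a factor 1 + 1/c₁, and the waste in each
    -- period a factor m/(m - 1); as c₁ ≤ m - 1, together they stay below 1 + 3/c₁.
    c₁TM≤ : c₁ * (T * M) ≤ (c₁ + 3) * (N * Z)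
    c₁TM≤ = *-cancelˡ-≤ B (begin
      B * (c₁ * (T * M)) ≡⟨ lem B c₁ T M ⟩
      c₁ * (T * B) * M ≤⟨ *-mono-≤ (*-monoʳ-≤ c₁ TB≤) (≤-trans (≤-reflexive (sym (binom-C n ⌊ n /2⌋))) (binom-split≤ a (d * b) ⌊ n /2⌋)) ⟩
      c₁ * (m * Z) * (N * αm) ≡⟨ lem2 c₁ (m * Z) N αm ⟩
      m * Z * N * (c₁ * αm) ≤⟨ *-monoʳ-≤ (m * Z * N) flat ⟩
      m * Z * N * (suc c₁ * ω) ≡⟨ lem3 m Z N (suc c₁) ω ⟩
      (m * suc c₁) * (ω * (N * Z)) ≤⟨ *-monoˡ-≤ (ω * (N * Z)) count ⟩
      (m₁ * (c₁ + 3)) * (ω * (N * Z)) ≡⟨ lem4 m₁ (c₁ + 3) ω (N * Z) ⟩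
      B * ((c₁ + 3) * (N * Z)) ∎)
      where
      open ≤-Reasoning
      lem : ∀ b c t m → b * (c * (t * m)) ≡ c * (t * b) * m
      lem = solve-∀
      lem2 : ∀ c x n a → c * x * (n * a) ≡ x * n * (c * a)
      lem2 = solve-∀
      lem3 : ∀ m z n s w → m * z * n * (s * w) ≡ (m * s) * (w * (n * z))
      lem3 = solve-∀
      lem4 : ∀ m c w y → (m * c) * (w * y) ≡ w * m * (c * y)
      lem4 = solve-∀
      lem5 : ∀ c m → suc m * suc c ≡ m * c + m + (c + 1)
      lem5 = solve-∀
      lem6 : ∀ c m → m * c + m + (m + m) ≡ m * (c + 3)
      lem6 = solve-∀
      count : m * suc c₁ ≤ m₁ * (c₁ + 3)
      count = ≤-trans (≤-reflexive (trans (cong (_* suc c₁) (sym m≡)) (lem5 c₁ m₁))) (≤-trans (+-monoʳ-≤ (m₁ * c₁ + m₁) (+-mono-≤ c₁≤m₁ 1≤m₁)) (≤-reflexive (lem6 c₁ m₁)))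

    c₁δ≤ : c₁ * δ ≤ c₁ * (2 ^ a * X) + (c₁ + 3) * (N * (2 * (L * ω))) + 3 * (N * 2 ^ a)
    c₁δ≤ = ≤-trans (≤-reflexive (*-distribˡ-∸ c₁ (T * M) |W|)) (m≤n+o⇒m∸n≤o (c₁ * (T * M)) (c₁ * |W|) (begin
      c₁ * (T * M) ≤⟨ c₁TM≤ ⟩
      (c₁ + 3) * (N * (Σα + 2 * (L * ω))) ≡⟨ lem c₁ N Σα (2 * (L * ω)) ⟩
      c₁ * (N * Σα) + ((c₁ + 3) * (N * (2 * (L * ω))) + 3 * (N * Σα)) ≤⟨ +-mono-≤ (*-monoʳ-≤ c₁ NΣα≤) (+-monoʳ-≤ ((c₁ + 3) * (N * (2 * (L * ω)))) (*-monoʳ-≤ 3 (*-monoʳ-≤ N (≤-trans Σα≤ Σα'≤)))) ⟩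
      c₁ * (|W| + 2 ^ a * X) + ((c₁ + 3) * (N * (2 * (L * ω))) + 3 * (N * 2 ^ a)) ≡⟨ lem2 c₁ |W| (2 ^ a * X) ((c₁ + 3) * (N * (2 * (L * ω)))) (3 * (N * 2 ^ a)) ⟩
      c₁ * |W| + (c₁ * (2 ^ a * X) + (c₁ + 3) * (N * (2 * (L * ω))) + 3 * (N * 2 ^ a)) ∎))
      where
      open ≤-Reasoning
      lem : ∀ c n s x → (c + 3) * (n * (s + x)) ≡ c * (n * s) + ((c + 3) * (n * x) + 3 * (n * s))
      lem = solve-∀
      lem2 : ∀ c w x y z → c * (w + x) + (y + z) ≡ c * w + (c * x + y + z)
      lem2 = solve-∀

-- Estimates of binomial coefficients

central : ℕ → ℕ
central m = binom (m + m) m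

central-odd : ∀ m → binom (suc (m + m)) m * suc m ≡ suc (m + m) * central m
central-odd m = trans (cong (binom (suc (m + m)) m *_) (sym (trans (cong (_∸ m) (sym (+-suc m m))) (m+n∸m≡n m (suc m))))) (binom-sucˡ (m + m) m (m≤m+n m m))

central-suc : ∀ m → central (suc m) ≡ 2 * binom (suc (m + m)) m
central-suc m = *-cancelʳ-≡ _ _ (suc m) (trans (cong (λ x → binom x (suc m) * suc m) (cong suc (+-suc m m)))
  (trans (binom-absorb (suc (m + m)) m) (lem m (binom (suc (m + m)) m))))
  where
  lem : ∀ m x → suc (suc (m + m)) * x ≡ 2 * x * suc m
  lem = solve-∀

central-step : ∀ m → central (suc m) * suc m ≡ 2 * suc (m + m) * central m
central-step m = trans (cong (_* suc m) (central-suc m)) (trans (*-assoc 2 (binom (suc (m + m)) m) (suc m)) (trans (cong (2 *_) (central-odd m)) (sym (*-assoc 2 (suc (m + m)) (central m)))))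

central-square : ∀ m → central (suc m) * central (suc m) * (suc m * suc m) ≡ 4 * (suc (m + m) * suc (m + m)) * (central m * central m)
central-square m = trans (lem (central (suc m)) (suc m)) (trans (cong₂ _*_ (central-step m) (central-step m)) (lem2 (suc (m + m)) (central m)))
  where
  lem : ∀ c s → c * c * (s * s) ≡ c * s * (c * s)
  lem = solve-∀
  lem2 : ∀ s c → 2 * s * c * (2 * s * c) ≡ 4 * (s * s) * (c * c)
  lem2 = solve-∀

-- The inductive step rests on (2m + 1)(2m + 3) < (2m + 2)².
central-upper : ∀ m → central m * central m * suc (m + m) ≤ 16 ^ m
central-upper zero    = ≤-refl
central-upper (suc m) = *-cancelʳ-≤ _ _ (suc m * suc m) (begin
  C' * C' * suc (suc m + suc m) * (suc m * suc m) ≡⟨ lem (C' * C') (suc (suc m + suc m)) (suc m * suc m) ⟩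
  C' * C' * (suc m * suc m) * suc (suc m + suc m) ≡⟨ cong (_* suc (suc m + suc m)) (central-square m) ⟩
  4 * (suc (m + m) * suc (m + m)) * (C * C) * suc (suc m + suc m) ≡⟨ lem2 m (C * C) ⟩
  C * C * suc (m + m) * (4 * (suc (m + m) * (3 + (m + m)))) ≤⟨ *-mono-≤ (central-upper m) (≤-trans (m≤n+m _ 4) (≤-reflexive (lem3 m))) ⟩
  16 ^ m * (16 * (suc m * suc m)) ≡⟨ lem4 (16 ^ m) (suc m * suc m) ⟩
  16 * 16 ^ m * (suc m * suc m) ∎)
  where
  open ≤-Reasoning
  C C' : ℕ
  C = central m
  C' = central (suc m)
  lem : ∀ a b c → a * b * c ≡ a * c * b
  lem = solve-∀
  lem2 : ∀ m x → 4 * (suc (m + m) * suc (m + m)) * x * suc (suc m + suc m) ≡ x * suc (m + m) * (4 * (suc (m + m) * (3 + (m + m))))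
  lem2 = solve-∀
  lem3 : ∀ m → 4 + 4 * (suc (m + m) * (3 + (m + m))) ≡ 16 * (suc m * suc m)
  lem3 = solve-∀
  lem4 : ∀ a b → a * (16 * b) ≡ 16 * a * b
  lem4 = solve-∀

-- The inductive step rests on 4 (m + 1)² (4m + 1) < (2m + 1)² (4m + 5), where the two sides differ
-- by 1.
central-lower : ∀ m → 16 ^ m ≤ central m * central m * suc (4 * m)
central-lower zero    = ≤-refl
central-lower (suc m) = *-cancelʳ-≤ _ _ (suc m * suc m) (*-cancelʳ-≤ _ _ (suc (4 * m)) (begin
  16 * 16 ^ m * (suc m * suc m) * suc (4 * m) ≤⟨ *-monoˡ-≤ (suc (4 * m)) (*-monoˡ-≤ (suc m * suc m) (*-monoʳ-≤ 16 (central-lower m))) ⟩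
  16 * (C * C * suc (4 * m)) * (suc m * suc m) * suc (4 * m) ≡⟨ lem m (C * C) ⟩
  C * C * suc (4 * m) * (4 * (4 * (suc m * suc m) * suc (4 * m))) ≤⟨ *-monoʳ-≤ (C * C * suc (4 * m)) (*-monoʳ-≤ 4 (≤-trans (m≤n+m _ 1) (≤-reflexive (lem2 m)))) ⟩
  C * C * suc (4 * m) * (4 * (suc (m + m) * suc (m + m) * suc (4 * suc m))) ≡⟨ lem3 m (C * C) ⟩
  4 * (suc (m + m) * suc (m + m)) * (C * C) * suc (4 * suc m) * suc (4 * m) ≡⟨ cong (λ x → x * suc (4 * suc m) * suc (4 * m)) (sym (central-square m)) ⟩
  C' * C' * (suc m * suc m) * suc (4 * suc m) * suc (4 * m) ≡⟨ cong (_* suc (4 * m)) (lem4 (C' * C') (suc m * suc m) (suc (4 * suc m))) ⟩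
  C' * C' * suc (4 * suc m) * (suc m * suc m) * suc (4 * m) ∎))
  where
  open ≤-Reasoning
  C C' : ℕ
  C = central m
  C' = central (suc m)
  lem : ∀ m x → 16 * (x * suc (4 * m)) * (suc m * suc m) * suc (4 * m) ≡ x * suc (4 * m) * (4 * (4 * (suc m * suc m) * suc (4 * m)))
  lem = solve-∀
  lem2 : ∀ m → 1 + 4 * (suc m * suc m) * suc (4 * m) ≡ suc (m + m) * suc (m + m) * suc (4 * suc m)
  lem2 = solve-∀
  lem3 : ∀ m x → x * suc (4 * m) * (4 * (suc (m + m) * suc (m + m) * suc (4 * suc m))) ≡ 4 * (suc (m + m) * suc (m + m)) * x * suc (4 * suc m) * suc (4 * m)
  lem3 = solve-∀
  lem4 : ∀ a b c → a * b * c ≡ a * c * b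
  lem4 = solve-∀

16^ : ∀ m → 16 ^ m ≡ 4 ^ (m + m)
16^ m = trans (^-distribʳ-* m 4 4) (sym (^-distribˡ-+-* 4 m m))
  where
  ^-distribʳ-* : ∀ k x y → (x * y) ^ k ≡ x ^ k * y ^ k
  ^-distribʳ-* zero    x y = refl
  ^-distribʳ-* (suc k) x y = trans (cong (x * y *_) (^-distribʳ-* k x y)) (lem x y (x ^ k) (y ^ k))
    where
    lem : ∀ x y u v → x * y * (u * v) ≡ x * u * (y * v)
    lem = solve-∀

data Halves (n : ℕ) : Set where
  even : ∀ m → n ≡ m + m → ⌊ n /2⌋ ≡ m → Halves n
  odd  : ∀ m → n ≡ suc (m + m) → ⌊ n /2⌋ ≡ m → Halves n

halves : ∀ n → Halves n
halves zero          = even 0 refl refl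
halves (suc zero)    = odd 0 refl refl
halves (suc (suc n)) with halves n
... | even m e f = even (suc m) (trans (cong (suc ∘ suc) e) (cong suc (sym (+-suc m m)))) (cong suc f)
... | odd  m e f = odd (suc m) (trans (cong (suc ∘ suc) e) (cong (suc ∘ suc) (sym (+-suc m m)))) (cong suc f)

middle-upper : ∀ n → binom n ⌊ n /2⌋ * binom n ⌊ n /2⌋ * suc n ≤ 4 ^ n
middle-upper n with halves n
... | even m e f = subst₂ (λ k l → binom k l * binom k l * suc k ≤ 4 ^ k) (sym e) (sym f) (≤-trans (central-upper m) (≤-reflexive (16^ m)))
... | odd m e f = subst₂ (λ k l → binom k l * binom k l * suc k ≤ 4 ^ k) (sym e) (sym f) (*-cancelˡ-≤ 4 (begin
    4 * (x * x * suc (suc (m + m))) ≡⟨ lem x (suc (suc (m + m))) ⟩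
    2 * x * (2 * x) * suc (suc (m + m)) ≡⟨ cong (λ c → c * c * suc (suc (m + m))) (sym (central-suc m)) ⟩
    central (suc m) * central (suc m) * suc (suc (m + m)) ≤⟨ *-monoʳ-≤ (central (suc m) * central (suc m)) (s≤s (s≤s (+-monoʳ-≤ m (n≤1+n m)))) ⟩
    central (suc m) * central (suc m) * suc (suc m + suc m) ≤⟨ central-upper (suc m) ⟩
    16 ^ suc m ≡⟨ trans (16^ (suc m)) (cong (λ k → 4 ^ suc k) (+-suc m m)) ⟩
    4 * 4 ^ suc (m + m) ∎))
  where
  open ≤-Reasoning
  x = binom (suc (m + m)) m
  lem : ∀ x y → 4 * (x * x * y) ≡ 2 * x * (2 * x) * y
  lem = solve-∀

middle-lower : ∀ n → 4 ^ n ≤ binom n ⌊ n /2⌋ * binom n ⌊ n /2⌋ * (2 * n + 3)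
middle-lower n with halves n
... | even m e f = subst₂ (λ k l → 4 ^ k ≤ binom k l * binom k l * (2 * k + 3)) (sym e) (sym f) (≤-trans (≤-reflexive (sym (16^ m)))
      (≤-trans (central-lower m) (*-monoʳ-≤ (central m * central m) (≤-trans (m≤n+m _ 2) (≤-reflexive (lem m))))))
  where
  lem : ∀ m → 2 + suc (4 * m) ≡ 2 * (m + m) + 3
  lem = solve-∀
... | odd m e f = subst₂ (λ k l → 4 ^ k ≤ binom k l * binom k l * (2 * k + 3)) (sym e) (sym f) (*-cancelˡ-≤ 4 (begin
    4 * 4 ^ suc (m + m) ≡⟨ sym (trans (16^ (suc m)) (cong (λ k → 4 ^ suc k) (+-suc m m))) ⟩
    16 ^ suc m ≤⟨ central-lower (suc m) ⟩
    central (suc m) * central (suc m) * suc (4 * suc m) ≡⟨ cong (λ c → c * c * suc (4 * suc m)) (central-suc m) ⟩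
    2 * x * (2 * x) * suc (4 * suc m) ≡⟨ lem x m ⟩
    4 * (x * x * (2 * suc (m + m) + 3)) ∎))
  where
  open ≤-Reasoning
  x = binom (suc (m + m)) m
  lem : ∀ x m → 2 * x * (2 * x) * suc (4 * suc m) ≡ 4 * (x * x * (2 * suc (m + m) + 3))
  lem = solve-∀

square-root : ∀ x → ∃ λ s → s * s ≤ x × x < suc s * suc s
square-root zero = 0 , z≤n , s≤s z≤n
square-root (suc x) with square-root x
... | s , l , u with suc s * suc s ≤? suc x
...   | yes p = suc s , p , ≤-<-trans u (*-mono-< (n<1+n (suc s)) (n<1+n (suc s)))
...   | no  p = s , m≤n⇒m≤1+n l , ≰⇒> p

suc≤2^ : ∀ s → suc s ≤ 2 ^ s
suc≤2^ zero    = ≤-refl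
suc≤2^ (suc s) = ≤-trans (+-mono-≤ {1} {2 ^ s} (≤-trans (s≤s z≤n) (suc≤2^ s)) (≤-trans (suc≤2^ s) (≤-reflexive (sym (+-identityʳ (2 ^ s)))))) ≤-refl

-- With s the integer square root of t one has t < (s + 1)² ≤ 4^s, hence t^k ≤ 2^(2ks), and 2 k ≤ s
-- with s² ≤ t finishes.
power≤exp : ∀ k t → 2 * k * (2 * k) ≤ t → t ^ k ≤ 2 ^ t
power≤exp k t h with square-root t
... | s , l , u = begin
  t ^ k ≤⟨ ^-monoˡ-≤ k (≤-trans (<⇒≤ u) (*-mono-≤ (suc≤2^ s) (suc≤2^ s))) ⟩
  (2 ^ s * 2 ^ s) ^ k ≡⟨ cong (_^ k) (sym (^-distribˡ-+-* 2 s s)) ⟩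
  (2 ^ (s + s)) ^ k ≡⟨ ^-*-assoc 2 (s + s) k ⟩
  2 ^ ((s + s) * k) ≤⟨ ^-monoʳ-≤ 2 (≤-trans (≤-trans (≤-reflexive (lem s k)) (*-monoʳ-≤ s 2k≤s)) l) ⟩
  2 ^ t ∎
  where
  open ≤-Reasoning
  lem : ∀ s k → (s + s) * k ≡ s * (2 * k)
  lem = solve-∀
  2k≤s : 2 * k ≤ s
  2k≤s = ≮⇒≥ λ p → <⇒≱ (≤-<-trans h u) (*-mono-≤ p p)

decay : ∀ b z X → (b ∸ X) * suc z ≤ z * suc X → ∀ x → X ≤ x → binom b (suc x) * suc z ≤ z * binom b x
decay b z X h x l = *-cancelʳ-≤ _ _ (suc x) (begin
  binom b (suc x) * suc z * suc x ≡⟨ lem (binom b (suc x)) (suc z) (suc x) ⟩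
  binom b (suc x) * suc x * suc z ≡⟨ cong (_* suc z) (binom-ratio b x) ⟩
  binom b x * (b ∸ x) * suc z ≡⟨ *-assoc (binom b x) (b ∸ x) (suc z) ⟩
  binom b x * ((b ∸ x) * suc z) ≤⟨ *-monoʳ-≤ (binom b x) (≤-trans (*-monoˡ-≤ (suc z) (∸-monoʳ-≤ b l)) (≤-trans h (*-monoʳ-≤ z (s≤s l)))) ⟩
  binom b x * (z * suc x) ≡⟨ lem2 (binom b x) z (suc x) ⟩
  z * binom b x * suc x ∎)
  where
  open ≤-Reasoning
  lem : ∀ a b c → a * b * c ≡ a * c * b
  lem = solve-∀
  lem2 : ∀ a b c → a * (b * c) ≡ b * a * c
  lem2 = solve-∀

decay-steps : ∀ b z X → (b ∸ X) * suc z ≤ z * suc X → ∀ s → binom b (X + s) * suc z ^ s ≤ z ^ s * binom b X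
decay-steps b z X h zero    = ≤-reflexive (trans (*-identityʳ _) (trans (cong (binom b) (+-identityʳ X)) (sym (*-identityˡ _))))
decay-steps b z X h (suc s) = begin
  binom b (X + suc s) * (suc z * suc z ^ s) ≡⟨ cong (λ y → binom b y * (suc z * suc z ^ s)) (+-suc X s) ⟩
  binom b (suc (X + s)) * (suc z * suc z ^ s) ≡⟨ sym (*-assoc (binom b (suc (X + s))) (suc z) (suc z ^ s)) ⟩
  binom b (suc (X + s)) * suc z * suc z ^ s ≤⟨ *-monoˡ-≤ (suc z ^ s) (decay b z X h (X + s) (m≤m+n X s)) ⟩
  z * binom b (X + s) * suc z ^ s ≡⟨ *-assoc z (binom b (X + s)) (suc z ^ s) ⟩
  z * (binom b (X + s) * suc z ^ s) ≤⟨ *-monoʳ-≤ z (decay-steps b z X h s) ⟩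
  z * (z ^ s * binom b X) ≡⟨ sym (*-assoc z (z ^ s) (binom b X)) ⟩
  z * z ^ s * binom b X ∎
  where open ≤-Reasoning

bernoulli : ∀ z s → (z + s) * z ^ s ≤ z * suc z ^ s
bernoulli z zero    = ≤-reflexive (cong (_* 1) (+-identityʳ z))
bernoulli z (suc s) = begin
  (z + suc s) * (z * z ^ s) ≤⟨ m≤m+n _ (s * z ^ s) ⟩
  (z + suc s) * (z * z ^ s) + s * z ^ s ≡⟨ lem z s (z ^ s) ⟩
  suc z * ((z + s) * z ^ s) ≤⟨ *-monoʳ-≤ (suc z) (bernoulli z s) ⟩
  suc z * (z * suc z ^ s) ≡⟨ lem2 (suc z) z (suc z ^ s) ⟩
  z * (suc z * suc z ^ s) ∎
  where
  open ≤-Reasoning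
  lem : ∀ z s x → (z + suc s) * (z * x) + s * x ≡ suc z * ((z + s) * x)
  lem = solve-∀
  lem2 : ∀ a b c → a * (b * c) ≡ b * (a * c)
  lem2 = solve-∀

-- Bernoulli's inequality weakens geometric decay to the linear factor z/(z + s), which suffices for
-- gains of order 1/c.
decay-gain : ∀ b z X → 1 ≤ z → (b ∸ X) * suc z ≤ z * suc X → ∀ s → binom b (X + s) * (z + s) ≤ z * binom b X
decay-gain b z X 1≤z h s = *-cancelʳ-≤ _ _ (z ^ s) {{m^n≢0 z s {{>-nonZero 1≤z}}}} (begin
  binom b (X + s) * (z + s) * z ^ s ≡⟨ *-assoc (binom b (X + s)) (z + s) (z ^ s) ⟩
  binom b (X + s) * ((z + s) * z ^ s) ≤⟨ *-monoʳ-≤ (binom b (X + s)) (bernoulli z s) ⟩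
  binom b (X + s) * (z * suc z ^ s) ≡⟨ lem (binom b (X + s)) z (suc z ^ s) ⟩
  z * (binom b (X + s) * suc z ^ s) ≤⟨ *-monoʳ-≤ z (decay-steps b z X h s) ⟩
  z * (z ^ s * binom b X) ≡⟨ lem2 z (z ^ s) (binom b X) ⟩
  z * binom b X * z ^ s ∎)
  where
  open ≤-Reasoning
  lem : ∀ a b c → a * (b * c) ≡ b * (a * c)
  lem = solve-∀
  lem2 : ∀ a b c → a * (b * c) ≡ a * c * b
  lem2 = solve-∀

-- By `decay-gain` with s = z, every run of z steps halves the coefficient; the decay condition
-- persists further out.
halving : ∀ b z X → 1 ≤ z → (b ∸ X) * suc z ≤ z * suc X → ∀ j → binom b (X + j * z) * 2 ^ j ≤ binom b X
halving b z X 1≤z h zero    = ≤-reflexive (trans (*-identityʳ _) (cong (binom b) (+-identityʳ X)))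
halving b z X 1≤z h (suc j) = begin
  binom b (X + suc j * z) * (2 * 2 ^ j) ≡⟨ cong (λ y → binom b y * (2 * 2 ^ j)) (lem X j z) ⟩
  binom b (X + j * z + z) * (2 * 2 ^ j) ≡⟨ sym (*-assoc (binom b (X + j * z + z)) 2 (2 ^ j)) ⟩
  binom b (X + j * z + z) * 2 * 2 ^ j ≤⟨ *-monoˡ-≤ (2 ^ j) (*-cancelʳ-≤ (binom b (X + j * z + z) * 2) (binom b (X + j * z)) z {{>-nonZero 1≤z}} (≤-trans (≤-reflexive (lem2 (binom b (X + j * z + z)) z))
      (≤-trans (decay-gain b z (X + j * z) 1≤z h' z) (≤-reflexive (*-comm z _))))) ⟩
  binom b (X + j * z) * 2 ^ j ≤⟨ halving b z X 1≤z h j ⟩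
  binom b X ∎
  where
  open ≤-Reasoning
  lem : ∀ x j z → x + (z + j * z) ≡ x + j * z + z
  lem = solve-∀
  lem2 : ∀ x z → x * 2 * z ≡ x * (z + z)
  lem2 = solve-∀
  h' : (b ∸ (X + j * z)) * suc z ≤ z * suc (X + j * z)
  h' = ≤-trans (*-monoˡ-≤ (suc z) (∸-monoʳ-≤ b (m≤m+n X (j * z)))) (≤-trans h (*-monoʳ-≤ z (s≤s (m≤m+n X (j * z)))))

binom-close : ∀ b z lo hi → hi ≤ b → z * (b ∸ lo) ≤ suc z * suc lo → z * hi ≤ suc z * suc (b ∸ hi) → Close z lo hi (binom b)
binom-close b z lo hi hi≤b h₁ h₂ x l u =
  *-cancelʳ-≤ _ _ (suc x) (≤-trans (≤-reflexive (trans (*-assoc z _ (suc x)) (trans (cong (z *_) (binom-ratio b x)) (lem z (binom b x) (b ∸ x)))))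
    (≤-trans (*-monoʳ-≤ (binom b x) (≤-trans (*-monoʳ-≤ z (∸-monoʳ-≤ b l)) (≤-trans h₁ (*-monoʳ-≤ (suc z) (s≤s l))))) (≤-reflexive (lem2 (binom b x) (suc z) (suc x))))) ,
  *-cancelʳ-≤ _ _ (suc x) (≤-trans (≤-reflexive (trans (lem3 z (binom b x) (suc x)) refl))
    (≤-trans (*-monoʳ-≤ (binom b x) (≤-trans (*-monoʳ-≤ z u) (≤-trans h₂ (*-monoʳ-≤ (suc z) sucb))))
      (≤-reflexive (trans (lem4 (binom b x) (suc z) (b ∸ x)) (trans (cong (suc z *_) (sym (binom-ratio b x))) (sym (*-assoc (suc z) (binom b (suc x)) (suc x))))))))
  where
  sucb : suc (b ∸ hi) ≤ b ∸ x
  sucb = ∸-monoʳ-< u hi≤b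
  lem : ∀ z a c → z * (a * c) ≡ a * (z * c)
  lem = solve-∀
  lem2 : ∀ a b c → a * (b * c) ≡ b * a * c
  lem2 = solve-∀
  lem3 : ∀ z a c → z * a * c ≡ a * (z * c)
  lem3 = solve-∀
  lem4 : ∀ a b c → a * (b * c) ≡ b * (a * c)
  lem4 = solve-∀

double-power : ∀ z r J → r * 2 ≤ suc z → suc z ^ (r * J) ≤ 2 ^ J * z ^ (r * J)
double-power z r J h = begin
  suc z ^ (r * J) ≡⟨ sym (^-*-assoc (suc z) r J) ⟩
  (suc z ^ r) ^ J ≤⟨ ^-monoˡ-≤ J (≤-trans (≤-reflexive (sym (*-identityˡ _))) (power-ratio 1 z r h)) ⟩
  (2 * z ^ r) ^ J ≡⟨ distrib J 2 (z ^ r) ⟩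
  2 ^ J * (z ^ r) ^ J ≡⟨ cong (2 ^ J *_) (^-*-assoc z r J) ⟩
  2 ^ J * z ^ (r * J) ∎
  where
  open ≤-Reasoning
  distrib : ∀ k x y → (x * y) ^ k ≡ x ^ k * y ^ k
  distrib zero    x y = refl
  distrib (suc k) x y = trans (cong (x * y *_) (distrib k x y)) (lem x y (x ^ k) (y ^ k))
    where
    lem : ∀ x y u v → x * y * (u * v) ≡ x * u * (y * v)
    lem = solve-∀

2^≤middle : ∀ b → 2 ^ b ≤ suc b * binom b ⌊ b /2⌋
2^≤middle b = ≤-trans (≤-reflexive (sym (binom-sum b))) (≤-trans (sum<-mono (suc b) (λ k _ → binom≤middle b k)) (≤-reflexive (sum<-const (suc b) _)))

-- The central coefficient is at least 2^b/(b + 1), and by closeness every r steps away from it lose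
-- at most a factor 2.
binom-large : ∀ b z lo hi r J → Close z lo hi (binom b) → 1 ≤ z → r * 2 ≤ suc z → lo ≤ ⌊ b /2⌋ → ⌊ b /2⌋ ≤ hi →
  ⌊ b /2⌋ ≤ lo + r * J → hi ≤ ⌊ b /2⌋ + r * J → ∀ x → lo ≤ x → x < hi → 2 ^ b ≤ suc b * 2 ^ J * binom b x
binom-large b z lo hi r J cl 1≤z h l₁ l₂ l₃ l₄ x lx xu = ≤-trans (2^≤middle b) (≤-trans (*-monoʳ-≤ (suc b) (*-cancelˡ-≤ (z ^ s) {{m^n≢0 z s {{>-nonZero 1≤z}}}} (begin
  z ^ s * binom b mid ≤⟨ close-pair cl mid x s l₁ lx l₂ (<⇒≤ xu) (≤-trans l₃ (+-monoˡ-≤ s lx)) (≤-trans (<⇒≤ xu) l₄) ⟩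
  suc z ^ s * binom b x ≤⟨ *-monoˡ-≤ (binom b x) (double-power z r J h) ⟩
  2 ^ J * z ^ s * binom b x ≡⟨ lem (2 ^ J) (z ^ s) (binom b x) ⟩
  z ^ s * (2 ^ J * binom b x) ∎))) (≤-reflexive (sym (*-assoc (suc b) (2 ^ J) (binom b x)))))
  where
  open ≤-Reasoning
  s mid : ℕ
  s = r * J
  mid = ⌊ b /2⌋
  lem : ∀ a b c → a * b * c ≡ b * (a * c)
  lem = solve-∀

weight-large : ∀ {d} b lo hi A → (∀ x → lo ≤ x → x < hi → 2 ^ b ≤ A * binom b x) → ∀ (p : Vec ℕ d) → InBox lo hi p → 2 ^ (d * b) ≤ A ^ d * weight b p
weight-large b lo hi A h [] _ = ≤-refl
weight-large {suc d} b lo hi A h (x ∷ p) ((l , u) , bp) = ≤-trans (≤-reflexive (^-distribˡ-+-* 2 b (d * b)))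
  (≤-trans (*-mono-≤ (h x l u) (weight-large b lo hi A h p bp)) (≤-reflexive (lem A (binom b x) (A ^ d) (weight b p))))
  where
  lem : ∀ a x y w → a * x * (y * w) ≡ a * y * (x * w)
  lem = solve-∀

upper-tail : ∀ b X → b ≤ suc (X + X) → sumS b (λ x → 𝟙d (X ≤? card x)) ≤ suc b * binom b X
upper-tail b X h = ≤-trans (≤-reflexive (sumS-card b (λ k → 𝟙d (X ≤? k)))) (≤-trans (sum<-mono (suc b) (λ k _ → pw k)) (≤-reflexive (sum<-const (suc b) _)))
  where
  pw : ∀ k → binom b k * 𝟙d (X ≤? k) ≤ binom b X
  pw k = by (X ≤? k)
    where
    by : (e : Dec (X ≤ k)) → binom b k * 𝟙d e ≤ binom b X
    by (yes l) = ≤-trans (≤-reflexive (*-identityʳ _)) (binom-anti b X k h l)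
    by (no _)  = ≤-trans (≤-reflexive (*-zeroʳ (binom b k))) z≤n

-- A union bound over the d groups, multiplied by 2^b to avoid probabilities.
outside-box : ∀ d b lo hi A → sumS b (λ x → 𝟙d (¬? ((lo ≤? card x) ×-dec (card x <? hi)))) ≤ A →
  sumS (d * b) (λ x → 𝟙d (¬? (inBox? lo hi (cards d b x)))) * 2 ^ b ≤ d * (2 ^ (d * b) * A)
outside-box zero    b lo hi A h = z≤n
outside-box (suc d) b lo hi A h = begin
  sumS (b + d * b) (λ x → 𝟙d (¬? (inBox? lo hi (cards (suc d) b x)))) * 2 ^ b
    ≤⟨ *-monoˡ-≤ (2 ^ b) (≤-trans (sumS-mono (b + d * b) pw) (≤-reflexive (trans (sumS-+ (b + d * b) _ _) (cong₂ _+_ (sumS-first b (d * b) _) (sumS-second b (d * b) _))))) ⟩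
  (2 ^ (d * b) * sumS b (λ x → 𝟙d (¬? ((lo ≤? card x) ×-dec (card x <? hi)))) + 2 ^ b * R) * 2 ^ b
    ≡⟨ lem (2 ^ (d * b)) _ (2 ^ b) R ⟩
  2 ^ b * 2 ^ (d * b) * sumS b (λ x → 𝟙d (¬? ((lo ≤? card x) ×-dec (card x <? hi)))) + 2 ^ b * (R * 2 ^ b)
    ≤⟨ +-mono-≤ (*-monoʳ-≤ (2 ^ b * 2 ^ (d * b)) h) (*-monoʳ-≤ (2 ^ b) (outside-box d b lo hi A h)) ⟩
  2 ^ b * 2 ^ (d * b) * A + 2 ^ b * (d * (2 ^ (d * b) * A)) ≡⟨ lem2 (2 ^ b) (2 ^ (d * b)) A d ⟩
  suc d * (2 ^ b * 2 ^ (d * b) * A) ≡⟨ cong (λ w → suc d * (w * A)) (sym (^-distribˡ-+-* 2 b (d * b))) ⟩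
  suc d * (2 ^ (b + d * b) * A) ∎
  where
  open ≤-Reasoning
  R = sumS (d * b) (λ x → 𝟙d (¬? (inBox? lo hi (cards d b x))))
  lem : ∀ n t b r → (n * t + b * r) * b ≡ b * n * t + b * (r * b)
  lem = solve-∀
  lem2 : ∀ b n a d → b * n * a + b * (d * (n * a)) ≡ suc d * (b * n * a)
  lem2 = solve-∀
  pw : ∀ x → 𝟙d (¬? (inBox? lo hi (cards (suc d) b x))) ≤ 𝟙d (¬? ((lo ≤? card (take b x)) ×-dec (card (take b x) <? hi))) + 𝟙d (¬? (inBox? lo hi (cards d b (drop b x))))
  pw x = 𝟙d-⊎ (¬? (inBox? lo hi (cards (suc d) b x))) (¬? ((lo ≤? card (take b x)) ×-dec (card (take b x) <? hi))) (¬? (inBox? lo hi (cards d b (drop b x)))) cases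
    where
    cases : ¬ InBox lo hi (cards (suc d) b x) → ¬ (lo ≤ card (take b x) × card (take b x) < hi) ⊎ ¬ InBox lo hi (cards d b (drop b x))
    cases n with inBox? lo hi (cards d b (drop b x))
    ... | no  m = inj₂ m
    ... | yes m = inj₁ (λ l → n (l , m))

two-tails : ∀ b lo hi X → X ≤ b ∸ lo → X ≤ hi → sumS b (λ x → 𝟙d (¬? ((lo ≤? card x) ×-dec (card x <? hi)))) ≤ 2 * sumS b (λ x → 𝟙d (X ≤? card x))
two-tails b lo hi X h₁ h₂ = ≤-trans (sumS-mono b pw) (≤-reflexive (trans (sumS-+ b _ _) (cong (tl +_) (trans (sumS-∁ b (λ x → 𝟙d (X ≤? card x))) (sym (+-identityʳ tl))))))
  where
  tl = sumS b (λ x → 𝟙d (X ≤? card x))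
  pw : ∀ x → 𝟙d (¬? ((lo ≤? card x) ×-dec (card x <? hi))) ≤ 𝟙d (X ≤? card x) + 𝟙d (X ≤? card (∁ x))
  pw x = 𝟙d-⊎ (¬? ((lo ≤? card x) ×-dec (card x <? hi))) (X ≤? card x) (X ≤? card (∁ x)) cases
    where
    cases : ¬ (lo ≤ card x × card x < hi) → X ≤ card x ⊎ X ≤ card (∁ x)
    cases n with lo ≤? card x
    ... | yes l = inj₁ (≤-trans h₂ (≮⇒≥ λ u → n (l , u)))
    ... | no  l = inj₂ (≤-trans h₁ (≤-trans (∸-monoʳ-≤ b (<⇒≤ (≰⇒> l))) (≤-reflexive (sym (∣∁p∣≡n∸∣p∣ x)))))

outside-small : ∀ d b lo hi X F → X ≤ b ∸ lo → X ≤ hi → b ≤ suc (X + X) → binom b X * F ≤ 2 ^ b →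
  sumS (d * b) (λ x → 𝟙d (¬? (inBox? lo hi (cards d b x)))) * F ≤ 2 * d * suc b * 2 ^ (d * b)
outside-small d b lo hi X F h₁ h₂ h₃ h₄ = *-cancelʳ-≤ _ _ (2 ^ b) {{m^n≢0 2 b}} (begin
  S * F * 2 ^ b ≡⟨ lem S F (2 ^ b) ⟩
  S * 2 ^ b * F ≤⟨ *-monoˡ-≤ F (outside-box d b lo hi (2 * (suc b * binom b X)) (≤-trans (two-tails b lo hi X h₁ h₂) (*-monoʳ-≤ 2 (upper-tail b X h₃)))) ⟩
  d * (2 ^ (d * b) * (2 * (suc b * binom b X))) * F ≡⟨ lem2 d (2 ^ (d * b)) (suc b) (binom b X) F ⟩
  2 * d * suc b * 2 ^ (d * b) * (binom b X * F) ≤⟨ *-monoʳ-≤ (2 * d * suc b * 2 ^ (d * b)) h₄ ⟩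
  2 * d * suc b * 2 ^ (d * b) * 2 ^ b ∎)
  where
  open ≤-Reasoning
  S = sumS (d * b) (λ x → 𝟙d (¬? (inBox? lo hi (cards d b x))))
  lem : ∀ a b c → a * b * c ≡ a * c * b
  lem = solve-∀
  lem2 : ∀ d n s x f → d * (n * (2 * (s * x))) * f ≡ 2 * d * s * n * (x * f)
  lem2 = solve-∀

binom≤2^ : ∀ b X → binom b X ≤ 2 ^ b
binom≤2^ b X with X ≤? b
... | yes l = ≤-trans (term≤sum< (binom b) (s≤s l)) (≤-reflexive (binom-sum b))
... | no  n = ≤-trans (≤-reflexive (binom-> b X (≰⇒> n))) z≤n

nth-root : ∀ N → 1 ≤ N → ∀ n → ∃ λ t → t ^ N ≤ n × n < suc t ^ N
nth-root (suc N) _ zero = 0 , z≤n , m^n>0 1 (suc N)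
nth-root N 1≤N (suc n) with nth-root N 1≤N n
... | t , l , u with suc t ^ N ≤? suc n
...   | no  p = t , m≤n⇒m≤1+n l , ≰⇒> p
...   | yes p = suc t , p , ≤-<-trans u (^-monoˡ-< N {{>-nonZero 1≤N}} ≤-refl)

-- Choice of parameters

-- Powers with literal exponents are kept abstract, as they would be unfolded during type checking.
abstract
  pw : ℕ → ℕ → ℕ
  pw t i = t ^ i

  dims : ℕ
  dims = 312

  dims≡ : dims ≡ 312
  dims≡ = refl

  pw-mul : ∀ t i j → pw t i * pw t j ≡ pw t (i + j)
  pw-mul t i j = sym (^-distribˡ-+-* t i j)

  pw-suc : ∀ t i → pw t i * t ≡ pw t (suc i)
  pw-suc t i = *-comm (t ^ i) t

  pw-one : ∀ t → pw t 1 ≡ t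
  pw-one t = *-identityʳ t

  pw-mono : ∀ t {i j} → 1 ≤ t → i ≤ j → pw t i ≤ pw t j
  pw-mono t 1≤t = ^-monoʳ-≤ t {{>-nonZero 1≤t}}

  pw-monoˡ : ∀ {s t} i → s ≤ t → pw s i ≤ pw t i
  pw-monoˡ i = ^-monoˡ-≤ i

  pw-exp : ∀ t k → 2 * k * (2 * k) ≤ t → pw t k ≤ 2 ^ t
  pw-exp t k = power≤exp k t

  pw-pow : ∀ t i k → pw t (i * k) ≡ pw t i ^ k
  pw-pow t i k = sym (^-*-assoc t i k)

  pw-def : ∀ t i → t ^ i ≡ pw t i
  pw-def t i = refl

  pw-pos : ∀ t i → 1 ≤ t → 1 ≤ pw t i
  pw-pos t i h = m^n>0 t {{>-nonZero h}} i

  pw-root : ∀ N n → 1 ≤ N → ∃ λ t → pw t N ≤ n × n < pw (suc t) N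
  pw-root N n h = nth-root N h n

  pw-next : ∀ N t → N * 2 ≤ suc t → pw (suc t) N ≤ 2 * pw t N
  pw-next N t h = ≤-trans (≤-reflexive (sym (*-identityˡ _))) (power-ratio 1 t N h)

-- It only has to exceed the numerals compared with it by evaluation, of which (2 · 1907)² in
-- `exp≤ 1907` is the largest.
threshold : ℕ
threshold = 1000000000000

binom-positive : ∀ n k → k ≤ n → 1 ≤ binom n k
binom-positive n       zero    _       = s≤s z≤n
binom-positive (suc n) (suc k) (s≤s l) = ≤-trans (binom-positive n k l) (m≤m+n _ _)

square-cancel : ∀ x y → x * x ≤ y * y → x ≤ y
square-cancel x y h = ≮⇒≥ λ l → <⇒≱ (*-mono-< l l) h

4^≡ : ∀ x → 4 ^ x ≡ 2 ^ x * 2 ^ x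
4^≡ x = trans (^-*-assoc 2 2 x) (trans (cong (2 ^_) (cong (x +_) (+-identityʳ x))) (^-distribˡ-+-* 2 x x))

half-+ : ∀ a x → ⌊ a + (x + x) /2⌋ ≡ ⌊ a /2⌋ + x
half-+ a zero    = trans (cong ⌊_/2⌋ (+-identityʳ a)) (sym (+-identityʳ _))
half-+ a (suc x) = trans (cong ⌊_/2⌋ (lem a x)) (trans (cong suc (half-+ a x)) (sym (+-suc _ x)))
  where
  lem : ∀ a x → a + (suc x + suc x) ≡ suc (suc (a + (x + x)))
  lem = solve-∀

-- At distance e beyond the middle y the ratio of neighbouring coefficients is about (y - e)/(y +
-- e), which is at most z/(z + 1) once y is about 2 e z or less.
decay-cond : ∀ N y e z X → N ≤ suc (y + y) → y + e ≤ X → suc y ≤ 2 * (e * z) → (N ∸ X) * suc z ≤ z * suc X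
decay-cond N y e z X h₁ h₂ h₃ = ≤-trans (*-monoˡ-≤ (suc z) w≤) (go (e ≤? suc y))
  where
  w : ℕ
  w = suc y ∸ e
  w≤ : N ∸ X ≤ w
  w≤ = ≤-trans (∸-mono h₁ h₂) (≤-reflexive (trans (cong (_∸ (y + e)) (sym (+-suc y y))) ([m+n]∸[m+o]≡n∸o y (suc y) e)))
  lem : ∀ w z e → w * z + 2 * (e * z) ≡ z * (w + e + e)
  lem = solve-∀
  go : Dec (e ≤ suc y) → w * suc z ≤ z * suc X
  go (no n)  = ≤-trans (≤-reflexive (cong (_* suc z) (m≤n⇒m∸n≡0 (<⇒≤ (≰⇒> n))))) z≤n
  go (yes l) = begin
    w * suc z ≡⟨ trans (*-suc w z) (+-comm w (w * z)) ⟩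
    w * z + w ≤⟨ +-monoʳ-≤ (w * z) (≤-trans (m∸n≤m (suc y) e) h₃) ⟩
    w * z + 2 * (e * z) ≡⟨ lem w z e ⟩
    z * (w + e + e) ≡⟨ cong (λ v → z * (v + e)) (m∸n+n≡m l) ⟩
    z * (suc y + e) ≤⟨ *-monoʳ-≤ z (s≤s h₂) ⟩
    z * suc X ∎
    where open ≤-Reasoning

-- On the scale of t the root of n is t^800, and the target errors n^(-1/16) and n^(-1/8) are
-- t^(-100) and t^(-200). Neighbouring exponents leave factors of t to absorb numerical constants
-- and d, which is itself a constant.
module Large (q' n : ℕ) (t-large : threshold ≤ suc q') (n-lower : pw (suc q') 1600 ≤ n) (n-upper : n ≤ 2 * pw (suc q') 1600) where
  t : ℕ
  t = suc q'

  p : ℕ → ℕ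
  p = pw t

  lit : ∀ k → {So (k ≤ᵇ threshold)} → k ≤ t
  lit k {s} = ≤-trans (≤ᵇ⇒≤ k threshold s) t-large

  le : ∀ i j → {So (i ≤ᵇ j)} → p i ≤ p j
  le i j {s} = pw-mono t (s≤s z≤n) (≤ᵇ⇒≤ i j s)

  raise : ∀ {k} i → k ≤ t → k * p i ≤ p (suc i)
  raise i h = ≤-trans (*-monoˡ-≤ (p i) h) (≤-reflexive (trans (*-comm t (p i)) (pw-suc t i)))

  lec : ∀ k i j → {So (k ≤ᵇ threshold)} → {So (suc i ≤ᵇ j)} → k * p i ≤ p j
  lec k i j {s} {s'} = ≤-trans (raise i (lit k {s})) (le (suc i) j {s'})

  p⁺ : ∀ i → 1 ≤ p i
  p⁺ i = pw-pos t i (s≤s z≤n)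

  d b half D₁ a y0 k1 : ℕ
  d    = dims
  half = p 1282
  b    = half + half
  D₁   = p 646
  a    = n ∸ d * b
  y0   = ⌊ a /2⌋
  k1   = y0 + D₁

  d-times : ∀ k → {So (k * 312 ≤ᵇ threshold)} → k * d ≤ t
  d-times k {s} = ≤-trans (≤-reflexive (cong (k *_) dims≡)) (lit (k * 312) {s})

  db≡ : d * b ≡ d * half + d * half
  db≡ = *-distribˡ-+ d half half

  db≤ : d * b ≤ p 1283
  db≤ = ≤-trans (≤-reflexive (trans db≡ (lem d half))) (raise 1282 (d-times 2))
    where
    lem : ∀ d h → d * h + d * h ≡ 2 * d * h
    lem = solve-∀

  split : a + d * b ≡ n
  split = m∸n+n≡m (≤-trans db≤ (≤-trans (le 1283 1600) n-lower))

  a-large : p 1600 ≤ 2 * a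
  a-large = +-cancelʳ-≤ (2 * (d * b)) _ _ (≤-trans (+-monoʳ-≤ (p 1600) (≤-trans (*-monoʳ-≤ 2 db≤) (lec 2 1283 1600)))
    (≤-trans (≤-reflexive (lem (p 1600))) (≤-trans (*-monoʳ-≤ 2 n-lower) (≤-reflexive (trans (cong (2 *_) (sym split)) (*-distribˡ-+ 2 a (d * b)))))))
    where
    lem : ∀ x → x + x ≡ 2 * x
    lem = solve-∀

  a≤ : a ≤ suc (y0 + y0)
  a≤ = half-upper a

  ≤a : y0 + y0 ≤ a
  ≤a = half-lower a

  y0-upper : y0 ≤ p 1600
  y0-upper = *-cancelˡ-≤ 2 (≤-trans (≤-reflexive (cong (y0 +_) (+-identityʳ y0))) (≤-trans ≤a (≤-trans (m∸n≤m n (d * b)) n-upper)))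

  y0-lower : 4 * p 1599 ≤ y0
  y0-lower = *-cancelˡ-≤ 4 (+-cancelʳ-≤ 2 _ _ (≤-trans (≤-trans (+-monoʳ-≤ (4 * (4 * p 1599)) (≤-trans (s≤s (s≤s z≤n)) (*-monoʳ-≤ 2 (p⁺ 1599)))) (≤-reflexive (lem (p 1599))))
    (≤-trans (lec 18 1599 1600) (≤-trans a-large (≤-trans (*-monoʳ-≤ 2 a≤) (≤-reflexive (lem2 y0)))))))
    where
    lem : ∀ x → 4 * (4 * x) + 2 * x ≡ 18 * x
    lem = solve-∀
    lem2 : ∀ x → 2 * suc (x + x) ≡ 4 * x + 2
    lem2 = solve-∀

  suc-y0 : suc y0 ≤ 2 * p 1600
  suc-y0 = ≤-trans (+-mono-≤ (p⁺ 1600) y0-upper) (≤-reflexive (cong (p 1600 +_) (sym (+-identityʳ (p 1600)))))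

  small≤y0 : ∀ i → {So (i ≤ᵇ 1599)} → p i ≤ y0
  small≤y0 i {s} = ≤-trans (le i 1599 {s}) (≤-trans (m≤m+n (p 1599) _) y0-lower)

  k1≤a : k1 ≤ a
  k1≤a = ≤-trans (+-monoʳ-≤ y0 (small≤y0 646)) ≤a

  u1 u2 u3 G V L' c z : ℕ
  -- Multiplied by q = t these become deviations t^642, and for `u2` t^644, from the middle t^1282
  -- of a group, whose standard deviation has order t^641.
  u1 = p 1281 ∸ p 641
  u2 = p 1281 + p 643
  u3 = p 1281 + p 641
  -- `diag` asks for a multiple of c V = t^626, while the resulting shift G q = t^628 of
  -- cardinalities still changes column weights by a factor less than 2.
  G  = p 627
  -- V L = t^802 exceeds the spread t^800 of the levels enough to make the tail negligible, while c₁
  -- L = t^794 keeps the waste of a few layers small against 2^a/ω.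
  V  = p 314
  L' = p 488 ∸ 1
  c  = p 312
  z  = p 639

  sides : Sides
  sides = record { a = a ; b = b ; d = d ; q' = q' ; ρ = b ; G = G ; V = V ; L' = L' ; c = c ; k1 = k1 ; u1 = u1 ; u2 = u2 ; u3 = u3 ; z = z }

  open Sides sides using (q; L; m; ω; αm; lo; hi)

  L≡ : L ≡ p 488
  L≡ = m+[n∸m]≡n (p⁺ 488)

  m≡p : m ≡ p 312
  m≡p = trans (pw-def t d) (cong p dims≡)

  u1q : u1 * q ≡ p 1282 ∸ p 642
  u1q = trans (*-distribʳ-∸ t (p 1281) (p 641)) (cong₂ _∸_ (pw-suc t 1281) (pw-suc t 641))

  u2q : u2 * q ≡ p 1282 + p 644
  u2q = trans (*-distribʳ-+ t (p 1281) (p 643)) (cong₂ _+_ (pw-suc t 1281) (pw-suc t 643))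

  u3q : u3 * q ≡ p 1282 + p 642
  u3q = trans (*-distribʳ-+ t (p 1281) (p 641)) (cong₂ _+_ (pw-suc t 1281) (pw-suc t 641))

  lo≡ : lo ≡ p 1282 ∸ p 642 ∸ p 628
  lo≡ = trans (*-distribʳ-∸ t u1 G) (cong₂ _∸_ u1q (pw-suc t 627))

  two : ∀ i j k → {So (i ≤ᵇ j)} → {So (suc j ≤ᵇ k)} → p i + p j ≤ p k
  two i j k {s} {s'} = ≤-trans (+-monoˡ-≤ (p j) (le i j {s})) (≤-trans (≤-reflexive (cong (p j +_) (sym (+-identityʳ (p j))))) (lec 2 j k {_} {s'}))

  radius : ℕ
  radius = p 642 + p 628

  lo+ : lo + radius ≡ half
  lo+ = trans (cong (_+ radius) lo≡) (trans (cong (_+ radius) (∸-+-assoc half (p 642) (p 628))) (m∸n+n≡m (≤-trans (≤-reflexive (+-comm (p 642) _)) (two 628 642 1282))))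

  radius≤ : radius ≤ 2 * p 642
  radius≤ = +-monoʳ-≤ (p 642) (≤-trans (le 628 642) (≤-reflexive (sym (+-identityʳ (p 642)))))

  u2q-lo : u2 * q ≡ lo + (radius + p 644)
  u2q-lo = trans u2q (trans (cong (_+ p 644) (sym lo+)) (+-assoc lo radius (p 644)))

  spread : d * (radius + p 644) ≤ p 645
  spread = ≤-trans (*-monoʳ-≤ d (≤-trans (+-monoˡ-≤ (p 644) (≤-trans radius≤ (*-monoʳ-≤ 2 (le 642 644)))) (≤-reflexive (lem (p 644)))))
    (≤-trans (≤-reflexive (lem2 d (p 644))) (raise 644 (d-times 3)))
    where
    lem : ∀ x → 2 * x + x ≡ 3 * x
    lem = solve-∀
    lem2 : ∀ d x → d * (3 * x) ≡ 3 * d * x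
    lem2 = solve-∀

  u2-reach : y0 + d * (u2 * q) ≤ y0 + p 645 + d * lo
  u2-reach = ≤-trans (≤-reflexive (trans (cong (λ x → y0 + d * x) u2q-lo) (lem y0 d lo (radius + p 644)))) (+-monoˡ-≤ (d * lo) (+-monoʳ-≤ y0 spread))
    where
    lem : ∀ y d l r → y + d * (l + r) ≡ y + d * r + d * l
    lem = solve-∀

  reach : y0 + d * (u2 * q) ≤ k1 + d * lo
  reach = ≤-trans u2-reach (+-monoˡ-≤ (d * lo) (+-monoʳ-≤ y0 (le 645 646)))

  α-anti : ∀ i j → y0 ≤ i → i ≤ j → binom a j ≤ binom a i
  α-anti i j l = binom-anti a i j (≤-trans a≤ (s≤s (+-mono-≤ l l)))

  -- Rank κ meets near columns within t^645 of y0, about t^646 levels below `k1`. In between every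
  -- step gains a share t^(-955), altogether t^(-309), which exceeds 8/c = 8 t^(-312).
  gap : ∀ k → y0 ≤ k → k + d * lo ≤ y0 + d * (u2 * q) → (c + 8) * ω ≤ c * binom a k
  gap k l h = *-cancelˡ-≤ (p 955) {{>-nonZero (p⁺ 955)}} (begin
    p 955 * ((c + 8) * ω) ≡⟨ lem (p 955) c ω ⟩
    c * (ω * p 955) + ω * (8 * p 955) ≤⟨ +-monoʳ-≤ (c * (ω * p 955)) (*-monoʳ-≤ ω gain) ⟩
    c * (ω * p 955) + ω * (c * s) ≡⟨ lem2 c ω (p 955) s ⟩
    c * (ω * (p 955 + s)) ≤⟨ *-monoʳ-≤ c (subst (λ x → binom a x * (p 955 + s) ≤ p 955 * binom a X) X+s
        (decay-gain a (p 955) X (p⁺ 955) (decay-cond a y0 (p 645) (p 955) X a≤ ≤-refl (≤-trans suc-y0 (≤-reflexive (cong (2 *_) (sym (pw-mul t 645 955)))))) s)) ⟩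
    c * (p 955 * binom a X) ≤⟨ *-monoʳ-≤ c (*-monoʳ-≤ (p 955) (α-anti k X l k≤X)) ⟩
    c * (p 955 * binom a k) ≡⟨ lem3 c (p 955) (binom a k) ⟩
    p 955 * (c * binom a k) ∎)
    where
    open ≤-Reasoning
    X s : ℕ
    X = y0 + p 645
    s = p 646 ∸ p 645
    k≤X : k ≤ X
    k≤X = +-cancelʳ-≤ (d * lo) _ _ (≤-trans h u2-reach)
    X+s : X + s ≡ k1
    X+s = trans (+-assoc y0 (p 645) s) (cong (y0 +_) (m+[n∸m]≡n (le 645 646)))
    s-large : 8 * p 643 ≤ s
    s-large = m+n≤o⇒m≤o∸n (8 * p 643) (≤-trans (+-monoˡ-≤ (p 645) (lec 8 643 645)) (two 645 645 646))
    gain : 8 * p 955 ≤ c * s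
    gain = ≤-trans (≤-reflexive (trans (cong (8 *_) (sym (pw-mul t 312 643))) (lem4 (p 312) (p 643)))) (*-monoʳ-≤ c s-large)
      where
      lem4 : ∀ x y → 8 * (x * y) ≡ x * (8 * y)
      lem4 = solve-∀
    lem : ∀ z c w → z * ((c + 8) * w) ≡ c * (w * z) + w * (8 * z)
    lem = solve-∀
    lem2 : ∀ c w z s → c * (w * z) + w * (c * s) ≡ c * (w * (z + s))
    lem2 = solve-∀
    lem3 : ∀ c z x → c * (z * x) ≡ z * (c * x)
    lem3 = solve-∀

  VL≡ : V * L ≡ p 802
  VL≡ = trans (cong (V *_) L≡) (pw-mul t 314 488)

  -- number of halvings between k1 + t^801 and k1 + V L
  J₁ : ℕ
  J₁ = p 2 ∸ p 1

  t≤J₁ : t ≤ J₁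
  t≤J₁ = m+n≤o⇒m≤o∸n t (≤-trans (+-monoˡ-≤ (p 1) (≤-reflexive (sym (pw-one t)))) (two 1 1 2))

  X₁ : ℕ
  X₁ = k1 + p 801

  X₁≥ : k1 ≤ X₁
  X₁≥ = m≤m+n k1 (p 801)

  tail-steps : X₁ + J₁ * p 800 ≡ k1 + V * L
  tail-steps = trans (cong (X₁ +_) (trans (*-distribʳ-∸ (p 800) (p 2) (p 1)) (cong₂ _∸_ (pw-mul t 2 800) (pw-mul t 1 800))))
    (trans (+-assoc k1 (p 801) _) (cong (k1 +_) (trans (m+[n∸m]≡n (le 801 802)) (sym VL≡))))

  α-halving : binom a (k1 + V * L) * 2 ^ J₁ ≤ binom a X₁
  α-halving = subst (λ x → binom a x * 2 ^ J₁ ≤ binom a X₁) tail-steps (halving a (p 800) X₁ (p⁺ 800)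
    (decay-cond a y0 (p 801) (p 800) X₁ a≤ (+-monoˡ-≤ (p 801) (m≤m+n y0 D₁)) (≤-trans suc-y0 (*-monoʳ-≤ 2 (≤-trans (le 1600 1601) (≤-reflexive (sym (pw-mul t 801 800))))))) J₁)

  exp≤ : ∀ k → {So (2 * k * (2 * k) ≤ᵇ threshold)} → p k ≤ 2 ^ t
  exp≤ k {s} = pw-exp t k (lit (2 * k * (2 * k)) {s})

  2^-mono : ∀ {i j} → i ≤ j → 2 ^ i ≤ 2 ^ j
  2^-mono = ^-monoʳ-≤ 2

  tail : c * binom a (k1 + V * L) ≤ ω
  tail = ≤-trans (*-monoˡ-≤ _ (≤-trans (exp≤ 312) (2^-mono t≤J₁))) (≤-trans (≤-reflexive (*-comm (2 ^ J₁) _)) (≤-trans α-halving (α-anti k1 X₁ (m≤m+n y0 D₁) X₁≥)))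

  close : Close z lo hi (binom b)
  close = binom-close b z lo hi (≤-trans (≤-reflexive u3q) (+-monoʳ-≤ half (le 642 1282))) low high
    where
    2zr : 2 * (z * radius) ≤ lo
    2zr = +-cancelʳ-≤ radius _ _ (begin
      2 * (z * radius) + radius ≤⟨ +-mono-≤ (*-monoʳ-≤ 2 (*-monoʳ-≤ z radius≤)) radius≤ ⟩
      2 * (z * (2 * p 642)) + 2 * p 642 ≡⟨ cong (_+ 2 * p 642) (trans (lem z (p 642)) (cong (4 *_) (pw-mul t 639 642))) ⟩
      4 * p 1281 + 2 * p 642 ≤⟨ +-monoʳ-≤ (4 * p 1281) (*-monoʳ-≤ 2 (le 642 1281)) ⟩
      4 * p 1281 + 2 * p 1281 ≡⟨ lem2 (p 1281) ⟩
      6 * p 1281 ≤⟨ lec 6 1281 1282 ⟩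
      half ≡⟨ sym lo+ ⟩
      lo + radius ∎)
      where
      open ≤-Reasoning
      lem : ∀ z x → 2 * (z * (2 * x)) ≡ 4 * (z * x)
      lem = solve-∀
      lem2 : ∀ x → 4 * x + 2 * x ≡ 6 * x
      lem2 = solve-∀
    low : z * (b ∸ lo) ≤ suc z * suc lo
    low = ≤-trans (≤-reflexive (cong (z *_) b∸lo)) (≤-trans (≤-reflexive (lem z lo radius)) (≤-trans (+-monoʳ-≤ (z * lo) 2zr)
      (≤-trans (≤-reflexive (+-comm (z * lo) lo)) (*-monoʳ-≤ (suc z) (n≤1+n lo)))))
      where
      b∸lo : b ∸ lo ≡ lo + 2 * radius
      b∸lo = trans (cong (λ x → x + x ∸ lo) (sym lo+)) (trans (cong (_∸ lo) (lem' lo radius)) (m+n∸m≡n lo _))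
        where
        lem' : ∀ l r → l + r + (l + r) ≡ l + (l + 2 * r)
        lem' = solve-∀
      lem : ∀ z l r → z * (l + 2 * r) ≡ z * l + 2 * (z * r)
      lem = solve-∀
    high : z * hi ≤ suc z * suc (b ∸ hi)
    high = ≤-trans (≤-reflexive (trans (cong (z *_) hi≡) (lem z w (p 642)))) (≤-trans (+-monoʳ-≤ (z * w) 2zp) (≤-trans (≤-reflexive (+-comm (z * w) w))
      (≤-trans (*-monoʳ-≤ (suc z) (n≤1+n w)) (≤-reflexive (cong (λ x → suc z * suc x) (sym b∸hi))))))
      where
      w : ℕ
      w = half ∸ p 642
      w+ : w + p 642 ≡ half
      w+ = m∸n+n≡m (le 642 1282)
      hi≡ : hi ≡ w + 2 * p 642
      hi≡ = trans u3q (trans (cong (_+ p 642) (sym w+)) (lem' w (p 642)))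
        where
        lem' : ∀ w x → w + x + x ≡ w + 2 * x
        lem' = solve-∀
      b∸hi : b ∸ hi ≡ w
      b∸hi = trans (cong (b ∸_) u3q) ([m+n]∸[m+o]≡n∸o half half (p 642))
      lem : ∀ z w x → z * (w + 2 * x) ≡ z * w + 2 * (z * x)
      lem = solve-∀
      2zp : 2 * (z * p 642) ≤ w
      2zp = ≤-trans (≤-reflexive (cong (2 *_) (pw-mul t 639 642))) (m+n≤o⇒m≤o∸n (2 * p 1281) (≤-trans (+-monoʳ-≤ (2 * p 1281) (le 642 1281))
        (≤-trans (≤-reflexive (lem'' (p 1281))) (lec 3 1281 1282))))
        where
        lem'' : ∀ x → 2 * x + x ≡ 3 * x
        lem'' = solve-∀

  near₁ : d * q * suc c ≤ suc z
  near₁ = ≤-trans (*-monoʳ-≤ (d * q) (+-monoˡ-≤ c (p⁺ 312))) (≤-trans (≤-reflexive (lem d t (p 312))) (≤-trans (*-monoʳ-≤ (2 * d) (≤-reflexive (pw-suc t 312)))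
    (≤-trans (raise 313 (d-times 2)) (≤-trans (le 314 639) (n≤1+n z)))))
    where
    lem : ∀ d t x → d * t * (x + x) ≡ 2 * d * (x * t)
    lem = solve-∀

  near₂ : d * (G * q) * 2 ≤ suc z
  near₂ = ≤-trans (≤-reflexive (trans (cong (λ x → d * x * 2) (pw-suc t 627)) (lem d (p 628)))) (≤-trans (raise 628 (d-times 2)) (≤-trans (le 629 639) (n≤1+n z)))
    where
    lem : ∀ d x → d * x * 2 ≡ 2 * d * x
    lem = solve-∀

  diag : 2 * (c * (3 * (2 * V + 1) + 2)) ≤ G
  diag = ≤-trans (*-monoʳ-≤ 2 (*-monoʳ-≤ c (≤-trans (≤-reflexive (lem V)) (+-monoʳ-≤ (6 * V) (*-monoʳ-≤ 5 (p⁺ 314))))))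
    (≤-trans (≤-reflexive (trans (lem2 c V) (cong (22 *_) (pw-mul t 312 314)))) (lec 22 626 627))
    where
    lem : ∀ v → 3 * (2 * v + 1) + 2 ≡ 6 * v + 5 * 1
    lem = solve-∀
    lem2 : ∀ c v → 2 * (c * (6 * v + 5 * v)) ≡ 22 * (c * v)
    lem2 = solve-∀

  1≤ω : 1 ≤ ω
  1≤ω = binom-positive a k1 k1≤a

  c₁ z₃ : ℕ
  c₁ = p 306
  z₃ = p 953

  -- Up to `k1` each of the t^646 steps changes the coefficient by a share at most t^(-953), in
  -- total t^(-307) and so less than 1/c₁ = t^(-306).
  flat : c₁ * αm ≤ suc c₁ * ω
  flat = *-cancelˡ-≤ (z₃ ^ D₁) {{m^n≢0 z₃ D₁ {{>-nonZero (p⁺ 953)}}}} (begin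
    z₃ ^ D₁ * (c₁ * αm) ≡⟨ lem (z₃ ^ D₁) c₁ αm ⟩
    c₁ * (z₃ ^ D₁ * αm) ≤⟨ *-monoʳ-≤ c₁ (close-pair cl y0 k1 D₁ ≤-refl (m≤m+n y0 D₁) (m≤m+n y0 D₁) ≤-refl (≤-trans (m≤m+n y0 D₁) (m≤m+n k1 D₁)) ≤-refl) ⟩
    c₁ * (suc z₃ ^ D₁ * ω) ≡⟨ sym (*-assoc c₁ (suc z₃ ^ D₁) ω) ⟩
    c₁ * suc z₃ ^ D₁ * ω ≤⟨ *-monoˡ-≤ ω (power-ratio c₁ z₃ D₁ room) ⟩
    suc c₁ * z₃ ^ D₁ * ω ≡⟨ lem2 (suc c₁) (z₃ ^ D₁) ω ⟩
    z₃ ^ D₁ * (suc c₁ * ω) ∎)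
    where
    open ≤-Reasoning
    lem : ∀ a b c → a * (b * c) ≡ b * (a * c)
    lem = solve-∀
    lem2 : ∀ a b c → a * b * c ≡ b * (a * c)
    lem2 = solve-∀
    room : D₁ * suc c₁ ≤ suc z₃
    room = ≤-trans (*-monoʳ-≤ D₁ (+-monoˡ-≤ c₁ (p⁺ 306))) (≤-trans (≤-reflexive (trans (lem' D₁ c₁) (cong (2 *_) (pw-mul t 646 306)))) (≤-trans (lec 2 952 953) (n≤1+n z₃)))
      where
      lem' : ∀ x y → x * (y + y) ≡ 2 * (x * y)
      lem' = solve-∀
    w : ℕ
    w = y0 ∸ D₁
    w+ : w + D₁ ≡ y0
    w+ = m∸n+n≡m (small≤y0 646)
    cl : Close z₃ y0 k1 (binom a)
    cl = binom-close a z₃ y0 k1 k1≤a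
      (*-mono-≤ (n≤1+n z₃) (≤-trans (∸-monoˡ-≤ y0 (≤-trans a≤ (≤-reflexive (sym (+-suc y0 y0))))) (≤-reflexive (m+n∸m≡n y0 (suc y0)))))
      (≤-trans (≤-reflexive (trans (cong (λ x → z₃ * (x + D₁)) (sym w+)) (lem3 z₃ w D₁))) (≤-trans (+-monoʳ-≤ (z₃ * w) 2zD) (≤-trans (≤-reflexive (+-comm (z₃ * w) w))
        (*-monoʳ-≤ (suc z₃) (m≤n⇒m≤1+n w≤)))))
      where
      lem3 : ∀ z w x → z * (w + x + x) ≡ z * w + 2 * (z * x)
      lem3 = solve-∀
      2zD : 2 * (z₃ * D₁) ≤ w
      2zD = ≤-trans (≤-reflexive (cong (2 *_) (pw-mul t 953 646))) (m+n≤o⇒m≤o∸n (2 * p 1599) (≤-trans (+-monoʳ-≤ (2 * p 1599) (le 646 1599))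
        (≤-trans (≤-reflexive (lem4 (p 1599))) (≤-trans (*-monoˡ-≤ (p 1599) (s≤s (s≤s (s≤s (z≤n {1}))))) y0-lower))))
        where
        lem4 : ∀ x → 2 * x + x ≡ 3 * x
        lem4 = solve-∀
      w≤ : w ≤ a ∸ k1
      w≤ = ≤-trans (≤-reflexive (sym ([m+n]∸[m+o]≡n∸o y0 y0 D₁))) (∸-monoˡ-≤ k1 ≤a)

  αm≤2ω : αm ≤ 2 * ω
  αm≤2ω = *-cancelˡ-≤ c₁ {{>-nonZero (p⁺ 306)}} (≤-trans flat (≤-trans (*-monoˡ-≤ ω (+-monoˡ-≤ c₁ (p⁺ 306))) (≤-reflexive (lem c₁ ω))))
    where
    lem : ∀ c w → (c + c) * w ≡ c * (2 * w)
    lem = solve-∀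

  b-half : ⌊ b /2⌋ ≡ half
  b-half = half-+ 0 half

  suc-b : suc b ≤ p 1283
  suc-b = ≤-trans (+-monoˡ-≤ b (p⁺ 1282)) (≤-trans (≤-reflexive (lem half)) (lec 3 1282 1283))
    where
    lem : ∀ h → h + (h + h) ≡ 3 * h
    lem = solve-∀

  b≤half : b ≤ suc (half + half)
  b≤half = n≤1+n b

  suc-half : ∀ i j → {So (i + j ≡ᵇ 1282)} → suc half ≤ 2 * (p i * p j)
  suc-half i j {s} = ≤-trans (+-monoˡ-≤ half (p⁺ 1282)) (≤-reflexive (trans (cong (half +_) (sym (+-identityʳ half))) (cong (2 *_) (trans (cong p (sym (≡ᵇ⇒≡ (i + j) 1282 s))) (sym (pw-mul t i j))))))

  -- J₂ counts the halvings between deviations t^643 and t^644, in runs of t^639 steps; J₃ bounds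
  -- those suffered within deviation 2 t^642, in runs of t^638. Since J₂ exceeds (t + J₃) d by at
  -- least t, all unusual columns together are lighter than any single near column.
  J₂ J₃ X₂ : ℕ
  J₂ = p 5 ∸ p 4
  J₃ = 2 * p 4
  X₂ = half + p 643

  unusual-decay : binom b (u2 * q) * 2 ^ J₂ ≤ 2 ^ b
  unusual-decay = ≤-trans (subst (λ x → binom b x * 2 ^ J₂ ≤ binom b X₂) steps (halving b (p 639) X₂ (p⁺ 639) (decay-cond b half (p 643) (p 639) X₂ b≤half ≤-refl (suc-half 643 639)) J₂)) (binom≤2^ b X₂)
    where
    steps : X₂ + J₂ * p 639 ≡ u2 * q
    steps = trans (cong (X₂ +_) (trans (*-distribʳ-∸ (p 639) (p 5) (p 4)) (cong₂ _∸_ (pw-mul t 5 639) (pw-mul t 4 639))))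
      (trans (+-assoc half (p 643) _) (trans (cong (half +_) (m+[n∸m]≡n (le 643 644))) (sym u2q)))

  S₂ A₂ : ℕ
  S₂ = sumS (d * b) (λ x → 𝟙d (¬? (inBox? 0 (u2 * q) (cards d b x))))
  A₂ = suc b * 2 ^ J₃

  S₂≤ : S₂ * 2 ^ J₂ ≤ 2 * d * suc b * 2 ^ (d * b)
  S₂≤ = outside-small d b 0 (u2 * q) (u2 * q) (2 ^ J₂) (≤-trans (≤-reflexive u2q) (+-monoʳ-≤ half (le 644 1282))) ≤-refl
    (≤-trans b≤half (s≤s (+-mono-≤ half≤ half≤))) unusual-decay
    where
    half≤ : half ≤ u2 * q
    half≤ = ≤-trans (m≤m+n half (p 644)) (≤-reflexive (sym u2q))

  near-large : ∀ x → lo ≤ x → x < hi → 2 ^ b ≤ A₂ * binom b x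
  near-large = binom-large b z lo hi (p 638) J₃ close (p⁺ 639) (≤-trans (≤-trans (≤-reflexive (*-comm (p 638) 2)) (lec 2 638 639)) (n≤1+n z))
    (≤-trans (≤-trans (m≤m+n lo radius) (≤-reflexive lo+)) (≤-reflexive (sym b-half)))
    (≤-trans (≤-reflexive b-half) (≤-trans (m≤m+n half (p 642)) (≤-reflexive (sym u3q))))
    (≤-trans (≤-reflexive (trans b-half (sym lo+))) (+-monoʳ-≤ lo (≤-trans radius≤ (≤-reflexive (sym rJ)))))
    (≤-trans (≤-reflexive (trans u3q (cong (_+ p 642) (sym b-half)))) (+-monoʳ-≤ ⌊ b /2⌋ (≤-trans (m≤m+n (p 642) _) (≤-reflexive (sym rJ)))))
    where
    rJ : p 638 * J₃ ≡ 2 * p 642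
    rJ = trans (lem (p 638) (p 4)) (cong (2 *_) (pw-mul t 638 4))
      where
      lem : ∀ x y → x * (2 * y) ≡ 2 * (x * y)
      lem = solve-∀

  A₂≤ : A₂ ^ d ≤ 2 ^ ((t + J₃) * d)
  A₂≤ = ≤-trans (^-monoˡ-≤ d (≤-trans (*-monoˡ-≤ (2 ^ J₃) (≤-trans suc-b (exp≤ 1283))) (≤-reflexive (sym (^-distribˡ-+-* 2 t J₃))))) (≤-reflexive (^-*-assoc 2 (t + J₃) d))

  exponent-room : t + (t + J₃) * d ≤ J₂
  exponent-room = m+n≤o⇒m≤o∸n (t + (t + J₃) * d) (≤-trans (+-monoˡ-≤ (p 4) (+-mono-≤ t≤p4 (*-monoˡ-≤ d (+-monoˡ-≤ J₃ t≤p4))))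
    (≤-trans (≤-reflexive (lem (p 4) d)) (raise 4 (≤-trans (+-monoˡ-≤ (3 * d) 2≤d) (≤-trans (≤-reflexive (lem2 d)) (d-times 4))))))
    where
    t≤p4 : t ≤ p 4
    t≤p4 = ≤-trans (≤-reflexive (sym (pw-one t))) (le 1 4)
    2≤d : 2 ≤ d
    2≤d = ≤-trans (s≤s (s≤s z≤n)) (≤-reflexive (sym dims≡))
    lem : ∀ x d → x + (x + 2 * x) * d + x ≡ (2 + 3 * d) * x
    lem = solve-∀
    lem2 : ∀ d → d + 3 * d ≡ 4 * d
    lem2 = solve-∀

  unusual : ∀ (v : Vec ℕ d) → InBox lo hi v → c * (αm * S₂) ≤ ω * weight b v
  unusual v bx = *-cancelʳ-≤ _ _ (2 ^ J₂) {{m^n≢0 2 J₂}} (begin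
    c * (αm * S₂) * 2 ^ J₂ ≡⟨ lem c αm S₂ (2 ^ J₂) ⟩
    c * αm * (S₂ * 2 ^ J₂) ≤⟨ *-mono-≤ (*-monoʳ-≤ c αm≤2ω) S₂≤ ⟩
    c * (2 * ω) * (2 * d * suc b * 2 ^ (d * b)) ≤⟨ *-monoʳ-≤ (c * (2 * ω)) (*-monoʳ-≤ (2 * d * suc b) (weight-large b lo hi A₂ near-large v bx)) ⟩
    c * (2 * ω) * (2 * d * suc b * (A₂ ^ d * weight b v)) ≡⟨ lem2 c ω d (suc b) (A₂ ^ d) (weight b v) ⟩
    ω * weight b v * ((4 * d) * c * suc b * A₂ ^ d) ≤⟨ *-monoʳ-≤ (ω * weight b v) (*-mono-≤ coeff A₂≤) ⟩
    ω * weight b v * (2 ^ t * 2 ^ ((t + J₃) * d)) ≡⟨ cong (ω * weight b v *_) (sym (^-distribˡ-+-* 2 t ((t + J₃) * d))) ⟩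
    ω * weight b v * 2 ^ (t + (t + J₃) * d) ≤⟨ *-monoʳ-≤ (ω * weight b v) (2^-mono exponent-room) ⟩
    ω * weight b v * 2 ^ J₂ ∎)
    where
    open ≤-Reasoning
    lem : ∀ c a s f → c * (a * s) * f ≡ c * a * (s * f)
    lem = solve-∀
    lem2 : ∀ c w d s a v → c * (2 * w) * (2 * d * s * (a * v)) ≡ w * v * ((4 * d) * c * s * a)
    lem2 = solve-∀
    coeff : (4 * d) * c * suc b ≤ 2 ^ t
    coeff = ≤-trans (*-mono-≤ (raise 312 (d-times 4)) suc-b) (≤-trans (≤-reflexive (pw-mul t 313 1283)) (exp≤ 1596))

  params : Params
  params = record
    { sides = sides
    ; G≤u1 = m+n≤o⇒m≤o∸n G (two 627 641 1281)
    ; u1≤u3 = ≤-trans (m∸n≤m (p 1281) (p 641)) (m≤m+n (p 1281) (p 641))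
    ; u3≤u2 = +-monoʳ-≤ (p 1281) (le 641 643)
    ; u2≤ρ = +-mono-≤ (le 1281 1282) (le 643 1282)
    ; b< = ≤-trans (+-monoˡ-≤ b (≤-trans (p⁺ 1282) (m≤m+n half half))) (≤-trans (≤-reflexive (lem b)) (*-monoʳ-≤ b (lit 2)))
    ; k1≤a = k1≤a ; reach = reach ; gap = gap ; tail = tail ; close = close ; near₁ = near₁ ; near₂ = near₂ ; 1≤z = p⁺ 639
    ; diag = diag ; unusual = unusual
    ; 2≤c = 2≤p312 ; 2≤m = ≤-trans 2≤p312 (≤-reflexive (sym m≡p)) ; 1≤ω = 1≤ω
    }
    where
    lem : ∀ b → b + b ≡ b * 2
    lem = solve-∀
    2≤p312 : 2 ≤ p 312
    2≤p312 = ≤-trans (lit 2) (≤-trans (≤-reflexive (sym (pw-one t))) (le 1 312))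

  N : ℕ
  N = 2 ^ (d * b)

  N2^a : N * 2 ^ a ≡ 2 ^ (a + d * b)
  N2^a = trans (*-comm N (2 ^ a)) (sym (^-distribˡ-+-* 2 a (d * b)))

  middle-n : ⌊ a + d * b /2⌋ ≡ y0 + d * half
  middle-n = trans (cong (λ x → ⌊ a + x /2⌋) db≡) (half-+ a (d * half))

  d642 : d * p 642 ≤ p 643
  d642 = ≤-trans (≤-reflexive (cong (_* p 642) (sym (*-identityˡ d)))) (raise 642 (d-times 1))

  open Scheme params using (module Output; h; m₁; m≡)

  high : a + d * b ∸ h < k1 + d * (u1 * q)
  high = ≤-<-trans (≤-trans (∸-monoˡ-≤ h (half-upper (a + d * b))) (≤-reflexive (trans (cong (_∸ h) (sym (+-suc h h))) (trans (m+n∸m≡n h (suc h)) (cong suc middle-n)))))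
    (+-cancelʳ-< (d * p 642) _ _ (<-≤-trans (≤-<-trans (+-monoʳ-≤ (suc (y0 + d * half)) d642) (room y0 (d * half))) (≤-reflexive (trans (lem y0 D₁ (d * half)) (trans (cong (λ x → k1 + x) (sym uv)) (sym (+-assoc k1 (d * (u1 * q)) (d * p 642))))))))
    where
    uv : d * (u1 * q) + d * p 642 ≡ d * half
    uv = trans (sym (*-distribˡ-+ d (u1 * q) (p 642))) (cong (d *_) (trans (cong (_+ p 642) u1q) (m∸n+n≡m (le 642 1282))))
    lem : ∀ y x h → y + h + x ≡ y + x + h
    lem = solve-∀
    room : ∀ y x → suc (y + x) + p 643 < y + x + D₁
    room y x = ≤-trans (≤-reflexive (lem' y x (p 643))) (+-monoʳ-≤ (y + x) (≤-trans (+-monoˡ-≤ (p 643) (*-monoʳ-≤ 2 (p⁺ 643))) (≤-trans (≤-reflexive (lem'' (p 643))) (lec 3 643 646))))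
      where
      lem' : ∀ y x z → suc (suc (y + x) + z) ≡ y + x + (2 * 1 + z)
      lem' = solve-∀
      lem'' : ∀ z → 2 * z + z ≡ 3 * z
      lem'' = solve-∀

  D θ : ℕ
  D = 2 * D₁
  -- This is the tolerated deviation t^(800 - 100). Markov's inequality then leaves a share of bad
  -- chains of order t^(801 - 306 - 700) = t^(-205), below the required t^(-200).
  θ = p 700

  low : k1 + d * (u3 * q) ≤ h + D
  low = ≤-trans (≤-reflexive (trans (cong (λ x → k1 + d * x) u3q) (lem y0 D₁ d half (p 642)))) (≤-trans (+-monoʳ-≤ (y0 + d * half) (+-monoʳ-≤ D₁ (≤-trans d642 (≤-trans (le 643 646) (≤-reflexive (sym (+-identityʳ D₁)))))))
    (≤-reflexive (cong (_+ D) (sym middle-n))))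
    where
    lem : ∀ y x d h r → y + x + d * (h + r) ≡ y + d * h + (x + d * r)
    lem = solve-∀

  c₁≤m₁ : c₁ ≤ m₁
  c₁≤m₁ = ∸-monoˡ-≤ 1 (≤-trans (+-monoˡ-≤ c₁ (p⁺ 306)) (≤-trans (two 306 306 312) (≤-reflexive (sym m≡p))))

  open Output D θ c₁ high low c₁≤m₁ flat using (M; T; δ; |E|; X; Y; Z; c₁δ≤; |E|≤; bad; bad-few; good-size; parts) public

  total-n : ℕ
  total-n = a + d * b

  c₁X≤ : c₁ * (2 ^ a * X) ≤ 2 ^ total-n
  c₁X≤ = *-cancelʳ-≤ _ _ (2 ^ q') {{m^n≢0 2 q'}} (begin
    c₁ * (2 ^ a * X) * 2 ^ q' ≡⟨ lem c₁ (2 ^ a) X (2 ^ q') ⟩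
    c₁ * 2 ^ a * (X * 2 ^ q') ≤⟨ *-monoʳ-≤ (c₁ * 2 ^ a) X≤ ⟩
    c₁ * 2 ^ a * (2 * d * suc b * N) ≡⟨ lem2 c₁ (2 ^ a) d (suc b) N ⟩
    N * 2 ^ a * ((2 * d) * c₁ * suc b) ≤⟨ *-mono-≤ (≤-reflexive N2^a) coeff ⟩
    2 ^ total-n * 2 ^ q' ∎)
    where
    open ≤-Reasoning
    lem : ∀ c a x f → c * (a * x) * f ≡ c * a * (x * f)
    lem = solve-∀
    lem2 : ∀ c a d s n → c * a * (2 * d * s * n) ≡ n * a * ((2 * d) * c * s)
    lem2 = solve-∀
    coeff : (2 * d) * c₁ * suc b ≤ 2 ^ q'
    coeff = *-cancelˡ-≤ 2 (≤-trans (*-monoʳ-≤ 2 (≤-trans (*-mono-≤ (raise 306 (d-times 2)) suc-b) (≤-reflexive (pw-mul t 307 1283)))) (≤-trans (lec 2 1590 1591) (exp≤ 1591)))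
    X₃ : ℕ
    X₃ = half + p 641
    hi≡ : half + p 642 ≡ X₃ + q' * p 641
    hi≡ = trans (cong (half +_) (trans (sym (pw-suc t 641)) (*-comm (p 641) t))) (sym (+-assoc half (p 641) _))
    X≤ : X * 2 ^ q' ≤ 2 * d * suc b * N
    X≤ = outside-small d b (u1 * q) (u3 * q) (half + p 642) (2 ^ q') b∸ (≤-reflexive (sym u3q)) (≤-trans b≤half (s≤s (+-mono-≤ (m≤m+n half _) (m≤m+n half _))))
      (≤-trans (subst (λ x → binom b x * 2 ^ q' ≤ binom b X₃) (sym hi≡) (halving b (p 641) X₃ (p⁺ 641) (decay-cond b half (p 641) (p 641) X₃ b≤half ≤-refl (suc-half 641 641)) q')) (binom≤2^ b X₃))
      where
      b∸ : half + p 642 ≤ b ∸ u1 * q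
      b∸ = m+n≤o⇒m≤o∸n (half + p 642) (≤-reflexive (trans (cong (half + p 642 +_) u1q) (trans (+-assoc half (p 642) _) (cong (half +_) (m+[n∸m]≡n (le 642 1282))))))

  -- The squared form of the central estimate is used throughout, as it involves no square roots of
  -- n.
  αm-small : αm * p 799 ≤ 2 ^ a
  αm-small = square-cancel _ _ (begin
    αm * p 799 * (αm * p 799) ≡⟨ lem αm (p 799) ⟩
    αm * αm * (p 799 * p 799) ≤⟨ *-monoʳ-≤ (αm * αm) (≤-trans (≤-reflexive (pw-mul t 799 799)) p1598≤) ⟩
    αm * αm * suc a ≤⟨ middle-upper a ⟩
    4 ^ a ≡⟨ 4^≡ a ⟩
    2 ^ a * 2 ^ a ∎)
    where
    open ≤-Reasoning
    lem : ∀ x y → x * y * (x * y) ≡ x * x * (y * y)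
    lem = solve-∀
    p1598≤ : p 1598 ≤ suc a
    p1598≤ = *-cancelˡ-≤ 2 (≤-trans (lec 2 1598 1600) (≤-trans a-large (*-monoʳ-≤ 2 (n≤1+n a))))

  window-waste : (c₁ + 3) * (N * (2 * (L * ω))) ≤ 2 ^ total-n
  window-waste = begin
    (c₁ + 3) * (N * (2 * (L * ω))) ≡⟨ lem (c₁ + 3) N L ω ⟩
    N * ((c₁ + 3) * (2 * L) * ω) ≤⟨ *-monoʳ-≤ N (*-mono-≤ small (binom≤middle a k1)) ⟩
    N * (p 799 * αm) ≤⟨ *-monoʳ-≤ N (≤-trans (≤-reflexive (*-comm (p 799) αm)) αm-small) ⟩
    N * 2 ^ a ≡⟨ N2^a ⟩
    2 ^ total-n ∎
    where
    open ≤-Reasoning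
    lem : ∀ c n l w → c * (n * (2 * (l * w))) ≡ n * (c * (2 * l) * w)
    lem = solve-∀
    lem2 : ∀ x y → (x + 3 * x) * (2 * y) ≡ 8 * (x * y)
    lem2 = solve-∀
    small : (c₁ + 3) * (2 * L) ≤ p 799
    small = ≤-trans (*-mono-≤ (+-monoʳ-≤ c₁ (*-monoʳ-≤ 3 (p⁺ 306))) (*-monoʳ-≤ 2 (≤-reflexive L≡))) (≤-trans (≤-reflexive (trans (lem2 (p 306) (p 488)) (cong (8 *_) (pw-mul t 306 488)))) (lec 8 794 799))

  c₁δ : c₁ * δ ≤ 5 * 2 ^ total-n
  c₁δ = ≤-trans c₁δ≤ (≤-trans (+-mono-≤ (+-mono-≤ c₁X≤ window-waste) (*-monoʳ-≤ 3 (≤-reflexive N2^a))) (≤-reflexive (lem (2 ^ total-n))))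
    where
    lem : ∀ x → x + x + 3 * x ≡ 5 * x
    lem = solve-∀

  c₁Y≤ : c₁ * (N * Y) ≤ 2 ^ total-n
  c₁Y≤ = begin
    c₁ * (N * Y) ≤⟨ *-monoʳ-≤ c₁ (*-monoʳ-≤ N (upper-tail a (k1 + V * L) (≤-trans a≤ (s≤s (+-mono-≤ y0≤ y0≤))))) ⟩
    c₁ * (N * (suc a * binom a (k1 + V * L))) ≡⟨ lem c₁ N (suc a) (binom a (k1 + V * L)) ⟩
    N * (binom a (k1 + V * L) * (c₁ * suc a)) ≤⟨ *-monoʳ-≤ N (*-monoʳ-≤ (binom a (k1 + V * L)) (≤-trans coeff (2^-mono t≤J₁))) ⟩
    N * (binom a (k1 + V * L) * 2 ^ J₁) ≤⟨ *-monoʳ-≤ N (≤-trans α-halving (binom≤2^ a X₁)) ⟩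
    N * 2 ^ a ≡⟨ N2^a ⟩
    2 ^ total-n ∎
    where
    open ≤-Reasoning
    lem : ∀ c n s x → c * (n * (s * x)) ≡ n * (x * (c * s))
    lem = solve-∀
    y0≤ : y0 ≤ k1 + V * L
    y0≤ = ≤-trans (m≤m+n y0 D₁) (m≤m+n k1 (V * L))
    suc-a : suc a ≤ 3 * p 1600
    suc-a = +-mono-≤ (p⁺ 1600) (≤-trans (m∸n≤m n (d * b)) n-upper)
    lem2 : ∀ x y → x * (3 * y) ≡ 3 * (x * y)
    lem2 = solve-∀
    coeff : c₁ * suc a ≤ 2 ^ t
    coeff = ≤-trans (*-monoʳ-≤ c₁ suc-a) (≤-trans (≤-reflexive (trans (lem2 (p 306) (p 1600)) (cong (3 *_) (pw-mul t 306 1600)))) (≤-trans (lec 3 1906 1907) (exp≤ 1907)))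

  c₁E : c₁ * |E| ≤ 2 * 2 ^ total-n
  c₁E = ≤-trans (*-monoʳ-≤ c₁ |E|≤) (≤-trans (≤-reflexive (*-distribˡ-+ c₁ (2 ^ a * X) (N * Y))) (≤-trans (+-mono-≤ c₁X≤ c₁Y≤) (≤-reflexive (cong (2 ^ total-n +_) (sym (+-identityʳ (2 ^ total-n)))))))

  c₁-potential : c₁ * (2 * δ + 2 * |E|) ≤ 14 * 2 ^ total-n
  c₁-potential = ≤-trans (≤-reflexive (lem c₁ δ |E|)) (≤-trans (*-monoʳ-≤ 2 (+-mono-≤ c₁δ c₁E)) (≤-reflexive (lem2 (2 ^ total-n))))
    where
    lem : ∀ c x y → c * (2 * x + 2 * y) ≡ 2 * (c * x + c * y)
    lem = solve-∀
    lem2 : ∀ x → 2 * (5 * x + 2 * x) ≡ 14 * x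
    lem2 = solve-∀

  M≡ : binom total-n ⌊ total-n /2⌋ ≡ M
  M≡ = binom-C total-n ⌊ total-n /2⌋

  M-upper : M * p 800 ≤ 2 ^ total-n
  M-upper = square-cancel _ _ (begin
    M * p 800 * (M * p 800) ≡⟨ lem M (p 800) ⟩
    M * M * (p 800 * p 800) ≤⟨ *-monoʳ-≤ (M * M) (≤-trans (≤-reflexive (pw-mul t 800 800)) (≤-trans n-lower (≤-trans (≤-reflexive (sym split)) (n≤1+n total-n)))) ⟩
    M * M * suc total-n ≡⟨ cong (λ x → x * x * suc total-n) (sym M≡) ⟩
    binom total-n ⌊ total-n /2⌋ * binom total-n ⌊ total-n /2⌋ * suc total-n ≤⟨ middle-upper total-n ⟩
    4 ^ total-n ≡⟨ 4^≡ total-n ⟩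
    2 ^ total-n * 2 ^ total-n ∎)
    where
    open ≤-Reasoning
    lem : ∀ x y → x * y * (x * y) ≡ x * x * (y * y)
    lem = solve-∀

  M-lower : 2 ^ total-n ≤ M * p 801
  M-lower = square-cancel _ _ (begin
    2 ^ total-n * 2 ^ total-n ≡⟨ sym (4^≡ total-n) ⟩
    4 ^ total-n ≤⟨ middle-lower total-n ⟩
    binom total-n ⌊ total-n /2⌋ * binom total-n ⌊ total-n /2⌋ * (2 * total-n + 3) ≡⟨ cong (λ x → x * x * (2 * total-n + 3)) M≡ ⟩
    M * M * (2 * total-n + 3) ≤⟨ *-monoʳ-≤ (M * M) (≤-trans (+-mono-≤ (*-monoʳ-≤ 2 (≤-trans (≤-reflexive split) n-upper)) (*-monoʳ-≤ 3 (p⁺ 1600))) (≤-trans (≤-reflexive (lem2 (p 1600))) (lec 7 1600 1602))) ⟩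
    M * M * p 1602 ≡⟨ cong (M * M *_) (sym (pw-mul t 801 801)) ⟩
    M * M * (p 801 * p 801) ≡⟨ lem M (p 801) ⟩
    M * p 801 * (M * p 801) ∎)
    where
    open ≤-Reasoning
    lem : ∀ x y → x * x * (y * y) ≡ x * y * (x * y)
    lem = solve-∀
    lem2 : ∀ x → 2 * (2 * x) + 3 * x ≡ 7 * x
    lem2 = solve-∀

  deviation : (2 * δ + 2 * |E| + (2 * D + θ) * M) * p 100 ≤ 16 * 2 ^ total-n
  deviation = ≤-trans (≤-reflexive (*-distribʳ-+ (p 100) (2 * δ + 2 * |E|) ((2 * D + θ) * M))) (≤-trans (+-mono-≤ part₁ part₂) (≤-reflexive (lem (2 ^ total-n))))
    where
    lem : ∀ x → 14 * x + 2 * x ≡ 16 * x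
    lem = solve-∀
    part₁ : (2 * δ + 2 * |E|) * p 100 ≤ 14 * 2 ^ total-n
    part₁ = ≤-trans (≤-reflexive (*-comm _ (p 100))) (≤-trans (*-monoˡ-≤ (2 * δ + 2 * |E|) (le 100 306)) c₁-potential)
    lem2 : ∀ x m y → (x + x) * m * y ≡ 2 * (m * (x * y))
    lem2 = solve-∀
    lem3 : ∀ x → 2 * (2 * x) ≡ 4 * x
    lem3 = solve-∀
    part₂ : (2 * D + θ) * M * p 100 ≤ 2 * 2 ^ total-n
    part₂ = ≤-trans (*-monoˡ-≤ (p 100) (*-monoˡ-≤ M (+-monoˡ-≤ θ (≤-trans (≤-reflexive (lem3 D₁)) (lec 4 646 700)))))
      (≤-trans (≤-reflexive (trans (lem2 (p 700) M (p 100)) (cong (λ x → 2 * (M * x)) (pw-mul t 700 100)))) (*-monoʳ-≤ 2 M-upper))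

  few : 2 * p 200 * length bad ≤ M
  few = *-cancelˡ-≤ 14 (*-cancelʳ-≤ _ _ (p 801) {{>-nonZero (p⁺ 801)}} (begin
    14 * (2 * p 200 * l) * p 801 ≡⟨ lem (p 200) l (p 801) ⟩
    28 * p 200 * (l * p 801) ≤⟨ *-monoˡ-≤ (l * p 801) (lec 28 200 205) ⟩
    p 205 * (l * p 801) ≡⟨ trans (lem2 (p 205) l (p 801)) (trans (cong (l *_) (trans (pw-mul t 205 801) (sym (pw-mul t 700 306)))) (lem3 l (p 700) (p 306))) ⟩
    p 306 * (l * p 700) ≤⟨ *-monoʳ-≤ (p 306) bad-few ⟩
    c₁ * (2 * δ + 2 * |E|) ≤⟨ c₁-potential ⟩
    14 * 2 ^ total-n ≤⟨ *-monoʳ-≤ 14 M-lower ⟩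
    14 * (M * p 801) ≡⟨ sym (*-assoc 14 M (p 801)) ⟩
    14 * M * p 801 ∎))
    where
    open ≤-Reasoning
    l : ℕ
    l = length bad
    lem : ∀ x l y → 14 * (2 * x * l) * y ≡ 28 * x * (l * y)
    lem = solve-∀
    lem2 : ∀ x l y → x * (l * y) ≡ l * (x * y)
    lem2 = solve-∀
    lem3 : ∀ l x y → l * (x * y) ≡ y * (l * x)
    lem3 = solve-∀

-- Assembly of the theorem

Regular : ℕ → ℚ → ℕ → Set
Regular K q n =
  Σ (ChainPartition n (middle n)) λ P →
  Σ (List (Fin (middle n))) λ bad →
  BoundedBy n q (length bad) (middle n) ×
  (∀ i → i ∉ bad → SizeOK K n (middle n) (length (ChainPartition.chain P i)))

^-distribʳ-* : ∀ e x y → (x * y) ^ e ≡ x ^ e * y ^ e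
^-distribʳ-* zero    x y = refl
^-distribʳ-* (suc e) x y = trans (cong (x * y *_) (^-distribʳ-* e x y)) (lem x y (x ^ e) (y ^ e))
  where
  lem : ∀ x y u v → x * y * (u * v) ≡ x * u * (y * v)
  lem = solve-∀

-- The 2 in front of Q becomes 2^e in the power and absorbs the factor 2 in the bound for n.
root-bound : ∀ e x y n Q → 1 ≤ e → n ≤ 2 * Q ^ e → 2 * Q * x ≤ y → x ^ e * n ≤ y ^ e
root-bound e x y n Q 1≤e h₁ h₂ = begin
  x ^ e * n ≤⟨ *-monoʳ-≤ (x ^ e) (≤-trans h₁ (*-monoˡ-≤ (Q ^ e) (≤-trans (≤-reflexive (sym (*-identityʳ 2))) (^-monoʳ-≤ 2 1≤e)))) ⟩
  x ^ e * (2 ^ e * Q ^ e) ≡⟨ cong (x ^ e *_) (sym (^-distribʳ-* e 2 Q)) ⟩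
  x ^ e * (2 * Q) ^ e ≡⟨ *-comm (x ^ e) _ ⟩
  (2 * Q) ^ e * x ^ e ≡⟨ sym (^-distribʳ-* e (2 * Q) x) ⟩
  (2 * Q * x) ^ e ≤⟨ ^-monoˡ-≤ e h₂ ⟩
  y ^ e ∎
  where open ≤-Reasoning

size-bound : ∀ e k x S n Q → 1 ≤ e → n ≤ 2 * Q ^ e → x * Q ≤ k * S → x ^ e * n ≤ (2 * k) ^ e * S ^ e
size-bound e k x S n Q 1≤e h₁ h₂ = ≤-trans (root-bound e x (2 * k * S) n Q 1≤e h₁ (≤-trans (≤-reflexive (lem Q x)) (≤-trans (*-monoʳ-≤ 2 h₂) (≤-reflexive (sym (*-assoc 2 k S))))))
  (≤-reflexive (^-distribʳ-* e (2 * k) S))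
  where
  lem : ∀ q x → 2 * q * x ≡ 2 * (x * q)
  lem = solve-∀

-- Abstract, since a literal factor 32 ^ 16 would be unfolded in unary.
abstract
  k₀ : ℕ
  k₀ = 16

  k₀≡ : k₀ ≡ 16
  k₀≡ = refl

-- With ε = 1 the exponent is 7/8, so all chains may be exceptional and any partition will do; the
-- rank serves as clock.
all-bad : ∀ K n → 1 ≤ n → Regular K 1ℚ n
all-bad K n 1≤n = partition , allFin (middle n) , few , λ i i∉ → ⊥-elim (i∉ (∈-allFin i))
  where
  antichain : ∀ (A : Subset n → Bool) → (∀ x y → A x ≡ true → A y ≡ true → x ⊆s y → ¬ (card x < card y)) → sumS n (𝟙 ∘ A) ≤ middle n
  antichain A anti = ≤-trans (sperner n A (λ x y ax ay l → ⊆-card x y l (≤-antisym (p⊆q⇒∣p∣≤∣q∣ l) (≮⇒≥ (anti x y ax ay l))))) (≤-reflexive (binom-C n ⌊ n /2⌋))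
  open Glue n card (timed-colouring n (middle n) card antichain) using (partition)
  few : BoundedBy n 1ℚ (length (allFin (middle n))) (middle n)
  few = subst (λ l → l ^ 8 ≤ n ^ 7 * middle n ^ 8) (sym (length-tabulate {n = middle n} id))
    (≤-trans (≤-reflexive (sym (*-identityˡ (middle n ^ 8)))) (*-monoˡ-≤ (middle n ^ 8) (m^n>0 n {{>-nonZero 1≤n}} 7)))

regular-from : ∀ k n q r Δ (P : ChainPartition n (middle n)) (bad : List (Fin (middle n))) →
  n ≤ 2 * q ^ 16 → n ≤ 2 * r ^ 8 → 2 * r * length bad ≤ middle n → Δ * q ≤ k * 2 ^ n →
  (∀ i → i ∉ bad → ∣ length (ChainPartition.chain P i) * middle n - 2 ^ n ∣ ≤ Δ) → Regular (2 * k) 0ℚ n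
regular-from k n q r Δ P bad n≤q n≤r few deviation close = P , bad , few' , λ i i∉ →
  size-bound 16 k (∣ length (ChainPartition.chain P i) * middle n - 2 ^ n ∣) (2 ^ n) n q (s≤s z≤n) n≤q (≤-trans (*-monoˡ-≤ q (close i i∉)) deviation)
  where
  few' : BoundedBy n 0ℚ (length bad) (middle n)
  few' = ≤-trans (≤-reflexive (cong (length bad ^ 8 *_) (*-identityʳ n))) (root-bound 8 (length bad) (middle n) n r (s≤s z≤n) n≤r few)

pw-split : ∀ t i k n → n ≤ 2 * pw t (i * k) → n ≤ 2 * pw t i ^ k
pw-split t i k n h = ≤-trans h (≤-reflexive (cong (2 *_) (pw-pow t i k)))

-- As 1600 = 16 · 100 = 8 · 200, the powers t^100 and t^200 stand for the roots n^(1/16) and n^(1/8)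
-- up to the factor between t^1600 and n.
mostly-good : ∀ t n → threshold ≤ t → pw t 1600 ≤ n → n ≤ 2 * pw t 1600 → Regular (2 * k₀) 0ℚ n
mostly-good (suc q') n t-large n-lower n-upper = subst (Regular (2 * k₀) 0ℚ) split
  (regular-from k₀ total-n (p 100) (p 200) _ parts bad (pw-split t 100 16 total-n upper) (pw-split t 200 8 total-n upper) few
    (≤-trans deviation (≤-reflexive (cong (_* 2 ^ total-n) (sym k₀≡)))) good-size)
  where
  open Large q' n t-large n-lower n-upper
  upper : total-n ≤ 2 * pw t 1600
  upper = ≤-trans (≤-reflexive split) n-upper

abstract
  n₀ : ℕ
  n₀ = pw threshold 1600

  n₀≡ : n₀ ≡ pw threshold 1600
  n₀≡ = refl

-- t is the integer 1600th root of n; for such large t, (t + 1)^1600 is at most 2 t^1600.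
beyond : ∀ n → n₀ ≤ n → Regular (2 * k₀) 0ℚ n
beyond n n₀≤n with pw-root 1600 n (s≤s z≤n)
... | t , lower , upper = mostly-good t n large lower (≤-trans (<⇒≤ upper) (pw-next 1600 t (≤-trans (≤ᵇ⇒≤ 3200 threshold _) (≤-trans large (n≤1+n t)))))
  where
  large : threshold ≤ t
  large = ≮⇒≥ λ l → <⇒≱ upper (≤-trans (pw-monoˡ 1600 l) (≤-trans (≤-reflexive (sym n₀≡)) n₀≤n))

-- The spare power of t in the count of bad chains leaves no error in the exponent from `n₀` on; the
-- value 1 makes the bound trivial before it.
rate : ∀ {n} → Dec (n₀ ≤ n) → ℚ
rate (yes _) = 0ℚ
rate (no _)  = 1ℚ

rate-zero : ∀ {n} (δ : ℚ) → 0ℚ <ℚ δ → n₀ ≤ n → (l : Dec (n₀ ≤ n)) → ∣ rate l ∣ℚ <ℚ δ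
rate-zero δ 0<δ l (yes _) = 0<δ
rate-zero δ 0<δ l (no g)  = ⊥-elim (g l)

regular : ∀ n → 1 ≤ n → (l : Dec (n₀ ≤ n)) → Regular (2 * k₀) (rate l) n
regular n 1≤n (yes l) = beyond n l
regular n 1≤n (no _)  = all-bad (2 * k₀) n 1≤n

theorem1p2 : Σ ℕ λ K → 1 ≤ K × Σ (ℕ → ℚ) λ ε → TendsToZero ε ×
    (∀ (n : ℕ) → 1 ≤ n →
    Σ (ChainPartition n (middle n)) λ P →
    Σ (List (Fin (middle n))) λ bad →
    BoundedBy n (ε n) (length bad) (middle n) ×
    (∀ i → i ∉ bad →
    SizeOK K n (middle n) (length (ChainPartition.chain P i))))
theorem1p2 = 2 * k₀ , ≤-trans (s≤s z≤n) (≤-reflexive (cong (2 *_) (sym k₀≡))) , (λ n → rate (n₀ ≤? n)) , (λ δ 0<δ → n₀ , λ n l → rate-zero δ 0<δ l (n₀ ≤? n)) ,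
  λ n 1≤n → regular n 1≤n (n₀ ≤? n)
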